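{- Let $R(q)=\dfrac{(q;q^5)_\infty(q^4;q^5)_\infty}{(q^2;q^5)_\infty(q^3;q^5)_\infty}$ and define integers $C(n)$ by $\dfrac{R^5(q)}{R(q^5)}=\sum_{n=0}^{\infty}C(n)q^{n}$. Then for all nonnegative integers $n$, $$C(5n)<0,\quad C(5n+1)<0,\quad C(5n+2)>0,\quad C(5n+3)<0,\quad C(5n+4)>0,$$ with the sole exception $C(0)=1$.
   Context: For complex $a,q$ with $|q|<1$, $(a;q)_\infty:=\prod_{k=0}^{\infty}(1-aq^k)$. All series are power series in $q$. -}

module Defs where

open import Data.Nat as ℕ using (ℕ; zero; suc; _≡ᵇ_)
open import Data.Nat.DivMod using (_/_; _%_)
open import Data.Integer using (ℤ; +_; -_; _+_; _*_)
open import Data.List using (List; []; _∷_; map; foldr; zipWith; upTo)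
open import Data.Vec using (Vec; []; _∷_; head; toList)
open import Data.Bool using (if_then_else_)

-- Formal power series in q with integer coefficients: n ↦ coefficient of qⁿ.
Series : Set
Series = ℕ → ℤ

sumℤ : List ℤ → ℤ
sumℤ = foldr _+_ (+ 0)

one : Series
one zero    = + 1
one (suc _) = + 0

_⊛_ : Series → Series → Series
(f ⊛ g) n = sumℤ (map (λ i → f i * g (n ℕ.∸ i)) (upTo (suc n)))

infixl 7 _⊛_

_^ˢ_ : Series → ℕ → Series
f ^ˢ zero  = one
f ^ˢ suc k = f ⊛ (f ^ˢ k)

oneMinusQ : ℕ → Series
oneMinusQ m n = if n ≡ᵇ 0 then (+ 1 + (if m ≡ᵇ 0 then - (+ 1) else + 0))
                else (if n ≡ᵇ m then - (+ 1) else + 0)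

-- (q^a ; q^b)_∞ = ∏_{k ≥ 0} (1 - q^{a+bk}), for a ≥ 1, b ≥ 1.
-- The coefficient of qⁿ only depends on the factors with a + b k ≤ n,
-- all of which have k ≤ n; so it is the coefficient of qⁿ in the finite
-- product over k = 0 … n (the remaining factors are ≡ 1 mod q^{n+1}).
qPoch : ℕ → ℕ → Series
qPoch a b n = foldr _⊛_ one (map (λ k → oneMinusQ (a ℕ.+ b ℕ.* k)) (upTo (suc n))) n

-- Multiplicative inverse of a power series with constant term 1.
-- invVec f n = (c_n , c_{n-1} , … , c_0), where c_0 = 1 and
-- c_{n+1} = - Σ_{j=1}^{n+1} f_j c_{n+1-j}.
invVec : Series → (n : ℕ) → Vec ℤ (suc n)
invVec f zero    = + 1 ∷ []
invVec f (suc n) =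
  let cs = invVec f n in
  - sumℤ (zipWith _*_ (map (λ i → f (suc i)) (upTo (suc n))) (toList cs)) ∷ cs

inv : Series → Series
inv f n = head (invVec f n)

-- f(q) / g(q), for g with constant term 1
_⊘_ : Series → Series → Series
f ⊘ g = f ⊛ inv g

subQ5 : Series → Series
subQ5 f n = if (n % 5) ≡ᵇ 0 then f (n / 5) else + 0

R : Series
R = (qPoch 1 5 ⊛ qPoch 4 5) ⊘ (qPoch 2 5 ⊛ qPoch 3 5)

C : ℕ → ℤ
C = (R ^ˢ 5) ⊘ subQ5 R

{-# OPTIONS --safe #-}
module Submission where

-- Write α = (q, q⁴; q⁵)∞ and β = (q², q³; q⁵)∞, so that R = α / β, let E = (q; q)∞ = α β E(q⁵),
-- and put a = 1/α, b = 1/β; primes denote the substitution q ↦ q⁵.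
--
-- By the Jacobi triple product α E(q⁵) and β E(q⁵) are theta series with exponents
-- (5k² - 3k)/2 and (5k² - k)/2.  Their product is a sum over ℤ², and splitting it along
-- the sublattice spanned by (1, 2) and (2, -1), i.e. by multiplication with 2 + i, gives
--     α β α′² β′² = β′² - q α′ β′ - q² α′²,
-- two of the five cosets cancelling by antisymmetry.  The norm from ℤ[[q]] to ℤ[[q⁵]] of
-- this identity is
--     β¹⁰ - 11 q α⁵ β⁵ - q² α¹⁰ = (α β)¹¹.
-- Together they make R⁵ the root of a quadratic equation over ℤ[[q]][α′/β′] whose
-- discriminant is a square, hence with v = q α′/β′
--     R⁵ / R(q⁵) = (1 - 2v + 4v² - 3v³ + v⁴) / (1 + 3v + 4v² + 2v³ + v⁴).
-- Rationalising the denominator to 1 - 11 v⁵ - v¹⁰ exhibits the five sections of C as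
--     1 - 25 q a⁶b⁶,   -5 (a¹⁰b² - 3q a⁵b⁷),   5 (3a⁹b³ + q a⁴b⁸),
--     -10 (3a⁸b⁴ + q a³b⁹),   5 (8a⁷b⁵ + q a²b¹⁰).
-- Since a and b have nonnegative coefficients only the second needs an argument: by the
-- norm identity it is -5 (b α + 8q a⁵b⁷ + q² b¹²), and 1 - α ≤ q a² coefficientwise.

open import Defs
open import Algebra.Bundles using (CommutativeRing)
import Algebra.Properties.Semiring.Exp
import Algebra.Solver.Ring
open import Algebra.Solver.Ring.AlmostCommutativeRing using (fromCommutativeRing; _-Raw-AlmostCommutative⟶_)
open import Algebra.Structures using (IsCommutativeRing)
open import Data.Bool using (true; false; if_then_else_)
open import Data.Integer as ℤ using (ℤ; +_; -[1+_])
import Data.Integer.Properties as ℤ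
import Data.Integer.Solver as ℤ
open import Data.Integer.Tactic.RingSolver using () renaming (solve-∀ to ℤ-solve)
open import Data.List using (_∷_; map; foldr; zipWith; applyUpTo)
open import Data.List.Properties using (map-applyUpTo)
open import Data.Maybe using (Maybe; just; nothing)
open import Data.Nat as ℕ using (ℕ; zero; suc; _≡ᵇ_)
open import Data.Nat.DivMod using (_/_; _%_; m/n≡1+[m∸n]/n; m/n≤m)
import Data.Nat.Properties as ℕ
open import Data.Nat.Tactic.RingSolver using () renaming (solve-∀ to ℕ-solve)
open import Data.Product using (_,_; proj₁; proj₂; ∃)
open import Data.Vec using (toList)
open import Function using (_∘_; id)
open import Level using (0ℓ)
open import Relation.Binary.PropositionalEquality as ≡ using (_≡_; cong; cong₂)
open import Relation.Nullary using (yes; no)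
open import Relation.Nullary.Decidable using (True; toWitness)

-- Triangular numbers and theta exponents

-- Theta identities are proved in ℤ[[q]]/(q^N): there q is nilpotent, and a theta sum over ℤ may be
-- cut to any finite window containing [-N, N). For this reason the algebra is developed over an
-- arbitrary commutative ring and instantiated both at ℤ[[q]] and at its truncations. Infinite
-- products enter through finite products that agree with their limits modulo q^N. The norm is a
-- circulant determinant in the five sections of a series. It is computed for a product one factor 1
-- - q^m at a time, so that each step is a polynomial identity in only six variables. The quadratic
-- equation for X = q R⁵ has the form 1/X - X = c, so its roots are X and -1/X. After clearing
-- denominators, the factor that belongs to the unwanted root has constant term 1 and hence is a
-- unit; this is what selects the root.

tri : ℕ → ℕ
tri zero    = 0
tri (suc n) = n ℕ.+ tri n

tri-spec : ∀ n → + 2 ℤ.* + tri n ≡ + n ℤ.* + n ℤ.- + n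
tri-spec zero    = ≡.refl
tri-spec (suc n) = ≡.trans (ℤ.*-distribˡ-+ (+ 2) (+ n) (+ tri n))
  (≡.trans (cong (λ x → + 2 ℤ.* + n ℤ.+ x) (tri-spec n)) (lem (+ n)))
  where
  lem : ∀ n → + 2 ℤ.* n ℤ.+ (n ℤ.* n ℤ.- n) ≡ (+ 1 ℤ.+ n) ℤ.* (+ 1 ℤ.+ n) ℤ.- (+ 1 ℤ.+ n)
  lem = ℤ-solve

-- For r + r′ = 5 this is 5 k (k - 1) / 2 + r k, written so that no subtraction occurs.
expo : ℕ → ℕ → ℤ → ℕ
expo r r′ (+ n)    = 5 ℕ.* tri n ℕ.+ r ℕ.* n
expo r r′ -[1+ n ] = 5 ℕ.* tri (suc n) ℕ.+ r′ ℕ.* suc n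

2expo : ℕ → ℤ → ℤ
2expo r k = + 5 ℤ.* (k ℤ.* k ℤ.- k) ℤ.+ + 2 ℤ.* (+ r ℤ.* k)

-- Doubling clears the denominator of k (k - 1) / 2, so that relations between theta exponents
-- become polynomial identities over ℤ; they return to ℕ through `double-injective`.
expo-spec : ∀ r r′ → r ℕ.+ r′ ≡ 5 → ∀ k → + 2 ℤ.* + expo r r′ k ≡ 2expo r k
expo-spec r r′ _ (+ n) = ≡.trans (cong (+ 2 ℤ.*_) (cong₂ ℤ._+_ (ℤ.pos-* 5 (tri n)) (ℤ.pos-* r n)))
  (≡.trans (lem (+ tri n) (+ r ℤ.* + n)) (cong (λ x → + 5 ℤ.* x ℤ.+ + 2 ℤ.* (+ r ℤ.* + n)) (tri-spec n)))
  where
  lem : ∀ t x → + 2 ℤ.* (+ 5 ℤ.* t ℤ.+ x) ≡ + 5 ℤ.* (+ 2 ℤ.* t) ℤ.+ + 2 ℤ.* x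
  lem = ℤ-solve
expo-spec r r′ r+r′ -[1+ n ] = ≡.trans
  (cong (+ 2 ℤ.*_) (cong₂ ℤ._+_ (ℤ.pos-* 5 (tri (suc n))) (ℤ.pos-* r′ (suc n))))
  (≡.trans (lem (+ tri (suc n)) (+ r′) (+ suc n))
  (≡.trans (cong (λ x → + 5 ℤ.* x ℤ.+ + 2 ℤ.* (+ r′ ℤ.* + suc n)) (tri-spec (suc n)))
  (≡.trans (lem′ (+ r) (+ r′) (+ suc n))
  (≡.trans (cong (λ x → + 2 ℤ.* + x ℤ.* + suc n ℤ.+ (+ 5 ℤ.* (+ suc n ℤ.* + suc n ℤ.- + suc n) ℤ.- + 2 ℤ.* (+ r ℤ.* + suc n))) r+r′)
    (lem″ (+ r) (+ suc n))))))
  where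
  lem : ∀ t r′ m → + 2 ℤ.* (+ 5 ℤ.* t ℤ.+ r′ ℤ.* m) ≡ + 5 ℤ.* (+ 2 ℤ.* t) ℤ.+ + 2 ℤ.* (r′ ℤ.* m)
  lem = ℤ-solve
  lem′ : ∀ r r′ m → + 5 ℤ.* (m ℤ.* m ℤ.- m) ℤ.+ + 2 ℤ.* (r′ ℤ.* m) ≡
    + 2 ℤ.* (r ℤ.+ r′) ℤ.* m ℤ.+ (+ 5 ℤ.* (m ℤ.* m ℤ.- m) ℤ.- + 2 ℤ.* (r ℤ.* m))
  lem′ = ℤ-solve
  lem″ : ∀ r m → + 2 ℤ.* + 5 ℤ.* m ℤ.+ (+ 5 ℤ.* (m ℤ.* m ℤ.- m) ℤ.- + 2 ℤ.* (r ℤ.* m))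
    ≡ + 5 ℤ.* (ℤ.- m ℤ.* ℤ.- m ℤ.- ℤ.- m) ℤ.+ + 2 ℤ.* (r ℤ.* ℤ.- m)
  lem″ = ℤ-solve

double-injective : ∀ {m n} → + 2 ℤ.* + m ≡ + 2 ℤ.* + n → m ≡ n
double-injective {m} {n} eq = ℤ.+-injective (ℤ.*-cancelˡ-≡ (+ 2) (+ m) (+ n) eq)

-- This crude bound is what makes theta terms with |k| ≥ N vanish modulo q^N.
expo-≥ : ∀ r r′ → 1 ℕ.≤ r → 1 ℕ.≤ r′ → ∀ k → ℤ.∣ k ∣ ℕ.≤ expo r r′ k
expo-≥ r r′ 1≤r 1≤r′ (+ n)    = ℕ.≤-trans (ℕ.m≤n*m n r {{ℕ.>-nonZero 1≤r}}) (ℕ.m≤n+m (r ℕ.* n) _)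
expo-≥ r r′ 1≤r 1≤r′ -[1+ n ] = ℕ.≤-trans (ℕ.m≤n*m (suc n) r′ {{ℕ.>-nonZero 1≤r′}}) (ℕ.m≤n+m (r′ ℕ.* suc n) _)

pos-∸ : ∀ {m n} → m ℕ.≤ n → + (n ℕ.∸ m) ≡ + n ℤ.- + m
pos-∸ {m} {n} m≤n = ≡.trans (lem (+ m) (+ (n ℕ.∸ m))) (cong (λ x → + x ℤ.- + m) (ℕ.m+[n∸m]≡n m≤n))
  where
  lem : ∀ m d → d ≡ m ℤ.+ d ℤ.- m
  lem = ℤ-solve

-- Polynomial identities over an arbitrary commutative ring

module RingTheory (R : CommutativeRing 0ℓ 0ℓ)
  (hom : CommutativeRing.rawRing ℤ.+-*-commutativeRing -Raw-AlmostCommutative⟶ fromCommutativeRing R) where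

  open CommutativeRing R
  open _-Raw-AlmostCommutative⟶_ hom using () renaming (⟦_⟧ to κ)

  private
    coeff≟ : ∀ c d → Maybe (κ c ≈ κ d)
    coeff≟ c d with c ℤ.≟ d
    ... | yes ≡.refl = just refl
    ... | no _       = nothing

  open Algebra.Solver.Ring _ (fromCommutativeRing R) hom coeff≟
  open import Algebra.Properties.Semiring.Exp semiring using (_^_; ^-congˡ; ^-homo-*; ^-assocʳ)
  open import Algebra.Properties.CommutativeSemiring.Exp commutativeSemiring using (^-distrib-*)
  open import Relation.Binary.Reasoning.Setoid setoid

  -- The determinant of the circulant matrix with entries x₀, …, x₄.
  Nm : (x₀ x₁ x₂ x₃ x₄ : Carrier) → Carrier
  Nm x₀ x₁ x₂ x₃ x₄ =
    (x₀ ^ 5 + x₁ ^ 5 + x₂ ^ 5 + x₃ ^ 5 + x₄ ^ 5)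
    + κ -[1+ 4 ] * (T x₀ x₁ x₄ x₂ x₃ + T x₁ x₂ x₀ x₃ x₄ + T x₂ x₃ x₁ x₄ x₀ + T x₃ x₄ x₂ x₀ x₁ + T x₄ x₀ x₃ x₁ x₂)
    + κ (+ 5) * (U x₀ x₁ x₄ x₂ x₃ + U x₁ x₂ x₀ x₃ x₄ + U x₂ x₃ x₁ x₄ x₀ + U x₃ x₄ x₂ x₀ x₁ + U x₄ x₀ x₃ x₁ x₂)
    + κ -[1+ 4 ] * (x₀ * x₁ * x₂ * x₃ * x₄)
    where
    T U : (x y z u v : Carrier) → Carrier
    T x y z u v = x ^ 3 * (y * z + u * v)
    U x y z u v = x * ((y * z) ^ 2 + (u * v) ^ 2)

  Nm-cong : ∀ {x₀ x₁ x₂ x₃ x₄ y₀ y₁ y₂ y₃ y₄} → x₀ ≈ y₀ → x₁ ≈ y₁ → x₂ ≈ y₂ → x₃ ≈ y₃ → x₄ ≈ y₄ →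
            Nm x₀ x₁ x₂ x₃ x₄ ≈ Nm y₀ y₁ y₂ y₃ y₄
  Nm-cong p₀ p₁ p₂ p₃ p₄ = +-cong (+-cong (+-cong
    (sum₅ (^-congˡ 5 p₀) (^-congˡ 5 p₁) (^-congˡ 5 p₂) (^-congˡ 5 p₃) (^-congˡ 5 p₄))
    (*-congˡ (sum₅ (T p₀ p₁ p₄ p₂ p₃) (T p₁ p₂ p₀ p₃ p₄) (T p₂ p₃ p₁ p₄ p₀) (T p₃ p₄ p₂ p₀ p₁) (T p₄ p₀ p₃ p₁ p₂))))
    (*-congˡ (sum₅ (U p₀ p₁ p₄ p₂ p₃) (U p₁ p₂ p₀ p₃ p₄) (U p₂ p₃ p₁ p₄ p₀) (U p₃ p₄ p₂ p₀ p₁) (U p₄ p₀ p₃ p₁ p₂))))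
    (*-congˡ (*-cong (*-cong (*-cong (*-cong p₀ p₁) p₂) p₃) p₄))
    where
    sum₅ : ∀ {x₀ x₁ x₂ x₃ x₄ y₀ y₁ y₂ y₃ y₄} → x₀ ≈ y₀ → x₁ ≈ y₁ → x₂ ≈ y₂ → x₃ ≈ y₃ → x₄ ≈ y₄ →
           x₀ + x₁ + x₂ + x₃ + x₄ ≈ y₀ + y₁ + y₂ + y₃ + y₄
    sum₅ p₀ p₁ p₂ p₃ p₄ = +-cong (+-cong (+-cong (+-cong p₀ p₁) p₂) p₃) p₄
    T : ∀ {x y z u v x′ y′ z′ u′ v′} → x ≈ x′ → y ≈ y′ → z ≈ z′ → u ≈ u′ → v ≈ v′ →
        x ^ 3 * (y * z + u * v) ≈ x′ ^ 3 * (y′ * z′ + u′ * v′)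
    T p r s t w = *-cong (^-congˡ 3 p) (+-cong (*-cong r s) (*-cong t w))
    U : ∀ {x y z u v x′ y′ z′ u′ v′} → x ≈ x′ → y ≈ y′ → z ≈ z′ → u ≈ u′ → v ≈ v′ →
        x * ((y * z) ^ 2 + (u * v) ^ 2) ≈ x′ * ((y′ * z′) ^ 2 + (u′ * v′) ^ 2)
    U p r s t w = *-cong p (+-cong (^-congˡ 2 (*-cong r s)) (^-congˡ 2 (*-cong t w)))

  private
    NmP : ∀ {n} (x₀ x₁ x₂ x₃ x₄ : Polynomial n) → Polynomial n
    NmP x₀ x₁ x₂ x₃ x₄ =
      (x₀ :^ 5 :+ x₁ :^ 5 :+ x₂ :^ 5 :+ x₃ :^ 5 :+ x₄ :^ 5)
      :+ con -[1+ 4 ] :* (T x₀ x₁ x₄ x₂ x₃ :+ T x₁ x₂ x₀ x₃ x₄ :+ T x₂ x₃ x₁ x₄ x₀ :+ T x₃ x₄ x₂ x₀ x₁ :+ T x₄ x₀ x₃ x₁ x₂)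
      :+ con (+ 5) :* (U x₀ x₁ x₄ x₂ x₃ :+ U x₁ x₂ x₀ x₃ x₄ :+ U x₂ x₃ x₁ x₄ x₀ :+ U x₃ x₄ x₂ x₀ x₁ :+ U x₄ x₀ x₃ x₁ x₂)
      :+ con -[1+ 4 ] :* (x₀ :* x₁ :* x₂ :* x₃ :* x₄)
      where
      T U : (x y z u v : Polynomial _) → Polynomial _
      T x y z u v = x :^ 3 :* (y :* z :+ u :* v)
      U x y z u v = x :* ((y :* z) :^ 2 :+ (u :* v) :^ 2)

  -- The circulant is multiplied by 1 - t P, where P is the cyclic permutation matrix. For P^s with
  -- s prime to 5 the determinant of 1 - t P^s is the product of 1 - t ζ over the fifth roots of
  -- unity ζ, which is 1 - t⁵; the next three lemmas are s = 2, 3, 4.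
  Nm-twist₁ : ∀ x₀ x₁ x₂ x₃ x₄ t →
    Nm (x₀ - t * x₄) (x₁ - t * x₀) (x₂ - t * x₁) (x₃ - t * x₂) (x₄ - t * x₃) ≈ (1# - t ^ 5) * Nm x₀ x₁ x₂ x₃ x₄
  Nm-twist₁ = solve 6 (λ x₀ x₁ x₂ x₃ x₄ t →
    NmP (x₀ :- t :* x₄) (x₁ :- t :* x₀) (x₂ :- t :* x₁) (x₃ :- t :* x₂) (x₄ :- t :* x₃)
      -- `t :^ 0` stands for 1 because it evaluates to `1#`, whereas `con (+ 1)` would evaluate to
      -- `κ (+ 1)`.
      := (t :^ 0 :- t :^ 5) :* NmP x₀ x₁ x₂ x₃ x₄) refl

  Nm-twist₂ : ∀ x₀ x₁ x₂ x₃ x₄ t →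
    Nm (x₀ - t * x₃) (x₁ - t * x₄) (x₂ - t * x₀) (x₃ - t * x₁) (x₄ - t * x₂) ≈ (1# - t ^ 5) * Nm x₀ x₁ x₂ x₃ x₄
  Nm-twist₂ = solve 6 (λ x₀ x₁ x₂ x₃ x₄ t →
    NmP (x₀ :- t :* x₃) (x₁ :- t :* x₄) (x₂ :- t :* x₀) (x₃ :- t :* x₁) (x₄ :- t :* x₂)
      := (t :^ 0 :- t :^ 5) :* NmP x₀ x₁ x₂ x₃ x₄) refl

  Nm-twist₃ : ∀ x₀ x₁ x₂ x₃ x₄ t →
    Nm (x₀ - t * x₂) (x₁ - t * x₃) (x₂ - t * x₄) (x₃ - t * x₀) (x₄ - t * x₁) ≈ (1# - t ^ 5) * Nm x₀ x₁ x₂ x₃ x₄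
  Nm-twist₃ = solve 6 (λ x₀ x₁ x₂ x₃ x₄ t →
    NmP (x₀ :- t :* x₂) (x₁ :- t :* x₃) (x₂ :- t :* x₄) (x₃ :- t :* x₀) (x₄ :- t :* x₁)
      := (t :^ 0 :- t :^ 5) :* NmP x₀ x₁ x₂ x₃ x₄) refl

  Nm-twist₄ : ∀ x₀ x₁ x₂ x₃ x₄ t →
    Nm (x₀ - t * x₁) (x₁ - t * x₂) (x₂ - t * x₃) (x₃ - t * x₄) (x₄ - t * x₀) ≈ (1# - t ^ 5) * Nm x₀ x₁ x₂ x₃ x₄
  Nm-twist₄ = solve 6 (λ x₀ x₁ x₂ x₃ x₄ t →
    NmP (x₀ :- t :* x₁) (x₁ :- t :* x₂) (x₂ :- t :* x₃) (x₃ :- t :* x₄) (x₄ :- t :* x₀)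
      := (t :^ 0 :- t :^ 5) :* NmP x₀ x₁ x₂ x₃ x₄) refl

  -- A shift by 5 places is trivial, so the extra factor is the scalar 1 - t and the determinant
  -- gains its fifth power.
  Nm-twist₀ : ∀ x₀ x₁ x₂ x₃ x₄ t →
    Nm (x₀ - t * x₀) (x₁ - t * x₁) (x₂ - t * x₂) (x₃ - t * x₃) (x₄ - t * x₄) ≈ (1# - t) ^ 5 * Nm x₀ x₁ x₂ x₃ x₄
  Nm-twist₀ = solve 6 (λ x₀ x₁ x₂ x₃ x₄ t →
    NmP (x₀ :- t :* x₀) (x₁ :- t :* x₁) (x₂ :- t :* x₂) (x₃ :- t :* x₃) (x₄ :- t :* x₄)
      := (t :^ 0 :- t) :^ 5 :* NmP x₀ x₁ x₂ x₃ x₄) refl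

  -- 11 = 1 + 5 + 5: the term x₁⁵ and the two mixed terms x₀ x₁³ x₂ and x₀² x₁ x₂² of the norm form.
  Nm-trinomial : ∀ x y q →
    Nm (x * x) (- (q * (y * x))) (- (q ^ 2 * (y * y))) (κ (+ 0)) (κ (+ 0))
      ≈ x ^ 10 - κ (+ 11) * (q ^ 5 * (y ^ 5 * x ^ 5)) - (q ^ 5) ^ 2 * y ^ 10
  Nm-trinomial = solve 3 (λ x y q →
    NmP (x :* x) (:- (q :* (y :* x))) (:- (q :^ 2 :* (y :* y))) (con (+ 0)) (con (+ 0))
      := x :^ 10 :- con (+ 11) :* (q :^ 5 :* (y :^ 5 :* x :^ 5)) :- (q :^ 5) :^ 2 :* y :^ 10) refl

  Nm-one : ∀ x → Nm 1# (κ (+ 0)) (κ (+ 0)) (κ (+ 0)) (κ (+ 0)) ≈ x ^ 0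
  Nm-one = solve 1 (λ x → NmP (x :^ 0) (con (+ 0)) (con (+ 0)) (con (+ 0)) (con (+ 0)) := x :^ 0) refl

  *-cancel : ∀ {c x} y z → c * x ≈ 1# → x * y ≈ x * z → y ≈ z
  *-cancel {c} {x} y z cx≈1 xy≈xz = begin
    y           ≈⟨ lem y ⟩
    c * (x * y) ≈⟨ *-congˡ xy≈xz ⟩
    c * (x * z) ≈⟨ lem z ⟨
    z           ∎
    where
    lem : ∀ u → u ≈ c * (x * u)
    lem u = begin
      u           ≈⟨ *-identityˡ u ⟨
      1# * u      ≈⟨ *-congʳ cx≈1 ⟨
      c * x * u   ≈⟨ *-assoc c x u ⟩
      c * (x * u) ∎

  -- With v = y/x these are the homogenised numerator and denominator of the quintic
  -- transformation u⁵ = v (1 - 2v + 4v² - 3v³ + v⁴) / (1 + 3v + 4v² + 2v³ + v⁴).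
  quad numer denom : Carrier → Carrier → Carrier
  quad x y = x * x - x * y - y * y
  numer x y = x ^ 4 + κ -[1+ 1 ] * (x ^ 3 * y) + κ (+ 4) * (x ^ 2 * y ^ 2) + κ -[1+ 2 ] * (x * y ^ 3) + y ^ 4
  denom x y = x ^ 4 + κ (+ 3) * (x ^ 3 * y) + κ (+ 4) * (x ^ 2 * y ^ 2) + κ (+ 2) * (x * y ^ 3) + y ^ 4

  private
    quadP numerP denomP : ∀ {n} → Polynomial n → Polynomial n → Polynomial n
    quadP x y = x :* x :- x :* y :- y :* y
    numerP x y = x :^ 4 :+ con -[1+ 1 ] :* (x :^ 3 :* y) :+ con (+ 4) :* (x :^ 2 :* y :^ 2) :+ con -[1+ 2 ] :* (x :* y :^ 3) :+ y :^ 4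
    denomP x y = x :^ 4 :+ con (+ 3) :* (x :^ 3 :* y) :+ con (+ 4) :* (x :^ 2 :* y :^ 2) :+ con (+ 2) :* (x :* y :^ 3) :+ y :^ 4

  quad-cong : ∀ {x x′ y y′} → x ≈ x′ → y ≈ y′ → quad x y ≈ quad x′ y′
  quad-cong p r = +-cong (+-cong (*-cong p p) (-‿cong (*-cong p r))) (-‿cong (*-cong r r))

  numer-cong : ∀ {x x′ y y′} → x ≈ x′ → y ≈ y′ → numer x y ≈ numer x′ y′
  numer-cong p r = +-cong (+-cong (+-cong (+-cong (^-congˡ 4 p) (*-congˡ (*-cong (^-congˡ 3 p) r)))
    (*-congˡ (*-cong (^-congˡ 2 p) (^-congˡ 2 r)))) (*-congˡ (*-cong p (^-congˡ 3 r)))) (^-congˡ 4 r)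

  denom-cong : ∀ {x x′ y y′} → x ≈ x′ → y ≈ y′ → denom x y ≈ denom x′ y′
  denom-cong p r = +-cong (+-cong (+-cong (+-cong (^-congˡ 4 p) (*-congˡ (*-cong (^-congˡ 3 p) r)))
    (*-congˡ (*-cong (^-congˡ 2 p) (^-congˡ 2 r)))) (*-congˡ (*-cong p (^-congˡ 3 r)))) (^-congˡ 4 r)

  unit-factor : ∀ {α β α′ β′ q} → β ≈ 1# → β′ ≈ 1# → q ≈ κ (+ 0) →
    β ^ 5 * (β′ * denom β′ (q * α′)) + q * (q * α′) * (α ^ 5 * numer β′ (q * α′)) ≈ 1#
  unit-factor {α} {β} {α′} {β′} {q} β≈1 β′≈1 q≈0 = trans
    (+-cong (*-cong (^-congˡ 5 β≈1) (*-cong β′≈1 (denom-cong β′≈1 (*-congʳ q≈0))))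
            (*-cong (*-cong q≈0 (*-congʳ q≈0)) (*-congˡ (numer-cong β′≈1 (*-congʳ q≈0)))))
    (solve 2 (λ α α′ → (α :^ 0) :^ 5 :* (α :^ 0 :* denomP (α :^ 0) (con (+ 0) :* α′)) :+ con (+ 0) :* (con (+ 0) :* α′) :* (α :^ 5 :* numerP (α :^ 0) (con (+ 0) :* α′))
      := α :^ 0) refl α α′)

  section₀ : ∀ x q → x - q * κ (+ 0) - q ^ 2 * κ (+ 0) ≈ x
  section₀ = solve 2 (λ x q → x :- q :* con (+ 0) :- q :^ 2 :* con (+ 0) := x) refl

  section₁ : ∀ x q → κ (+ 0) - q * x - q ^ 2 * κ (+ 0) ≈ - (q * x)
  section₁ = solve 2 (λ x q → con (+ 0) :- q :* x :- q :^ 2 :* con (+ 0) := :- (q :* x)) refl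

  section₂ : ∀ x q → κ (+ 0) - q * κ (+ 0) - q ^ 2 * x ≈ - (q ^ 2 * x)
  section₂ = solve 2 (λ x q → con (+ 0) :- q :* con (+ 0) :- q :^ 2 :* x := :- (q :^ 2 :* x)) refl

  section₃ : ∀ q → κ (+ 0) - q * κ (+ 0) - q ^ 2 * κ (+ 0) ≈ κ (+ 0)
  section₃ = solve 1 (λ q → con (+ 0) :- q :* con (+ 0) :- q :^ 2 :* con (+ 0) := con (+ 0)) refl

  -- `s` stands for E(q⁵) and `e` for E. The exponent 11 is 1 + 10: one α β is explicit and ten come
  -- from `e ^ 10`, whose s¹⁰ cancels against the other side.
  eleven-from-norm : ∀ {α β s i e q} → i * s ≈ 1# → e ≈ α * β * s →
    α * β * e ^ 10 ≈ (β * s) ^ 10 - κ (+ 11) * (q * ((α * s) ^ 5 * (β * s) ^ 5)) - q ^ 2 * (α * s) ^ 10 →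
    β ^ 10 - κ (+ 11) * (q * (α ^ 5 * β ^ 5)) - q ^ 2 * α ^ 10 ≈ (α * β) ^ 11
  eleven-from-norm {α} {β} {s} {i} {e} {q} is≈1 e≈ norm = *-cancel {i ^ 10} {s ^ 10} _ _
    (begin
      i ^ 10 * s ^ 10   ≈⟨ solve 2 (λ i s → i :^ 10 :* s :^ 10 := (i :* s) :^ 10) refl i s ⟩
      (i * s) ^ 10      ≈⟨ ^-congˡ 10 is≈1 ⟩
      1# ^ 10           ≈⟨ solve 1 (λ x → (x :^ 0) :^ 10 := x :^ 0) refl i ⟩
      1#                ∎)
    (begin
      s ^ 10 * (β ^ 10 - κ (+ 11) * (q * (α ^ 5 * β ^ 5)) - q ^ 2 * α ^ 10)
        ≈⟨ solve 4 (λ α β s q → s :^ 10 :* (β :^ 10 :- con (+ 11) :* (q :* (α :^ 5 :* β :^ 5)) :- q :^ 2 :* α :^ 10)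
             := (β :* s) :^ 10 :- con (+ 11) :* (q :* ((α :* s) :^ 5 :* (β :* s) :^ 5)) :- q :^ 2 :* (α :* s) :^ 10) refl α β s q ⟩
      (β * s) ^ 10 - κ (+ 11) * (q * ((α * s) ^ 5 * (β * s) ^ 5)) - q ^ 2 * (α * s) ^ 10
        ≈⟨ norm ⟨
      α * β * e ^ 10
        ≈⟨ *-congˡ (^-congˡ 10 e≈) ⟩
      α * β * (α * β * s) ^ 10
        ≈⟨ solve 3 (λ α β s → α :* β :* (α :* β :* s) :^ 10 := s :^ 10 :* (α :* β) :^ 11) refl α β s ⟩
      s ^ 10 * (α * β) ^ 11 ∎)

  -- `s` stands for E(q⁵) and `s′` for E(q²⁵). Rewriting both copies of `s` on the left as α′ β′ s′
  -- creates the factor (α′ β′)² and a common s′² to cancel.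
  quadratic-from-theta : ∀ {α β s α′ β′ s′ i q} → i * s′ ≈ 1# → s ≈ α′ * β′ * s′ →
    (α * s) * (β * s) ≈ (β′ * s′) * (β′ * s′) - q * ((α′ * s′) * (β′ * s′)) - q ^ 2 * ((α′ * s′) * (α′ * s′)) →
    α * β * (α′ * β′) ^ 2 ≈ quad β′ (q * α′)
  quadratic-from-theta {α} {β} {s} {α′} {β′} {s′} {i} {q} is≈1 s≈ theta = *-cancel {i ^ 2} {s′ ^ 2} _ _
    (begin
      i ^ 2 * s′ ^ 2    ≈⟨ solve 2 (λ i s → i :^ 2 :* s :^ 2 := (i :* s) :^ 2) refl i s′ ⟩
      (i * s′) ^ 2      ≈⟨ ^-congˡ 2 is≈1 ⟩
      1# ^ 2            ≈⟨ solve 1 (λ x → (x :^ 0) :^ 2 := x :^ 0) refl i ⟩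
      1#                ∎)
    (begin
      s′ ^ 2 * (α * β * (α′ * β′) ^ 2)
        ≈⟨ solve 5 (λ α β α′ β′ s → s :^ 2 :* (α :* β :* (α′ :* β′) :^ 2) := (α :* (α′ :* β′ :* s)) :* (β :* (α′ :* β′ :* s))) refl α β α′ β′ s′ ⟩
      (α * (α′ * β′ * s′)) * (β * (α′ * β′ * s′))
        ≈⟨ *-cong (*-congˡ s≈) (*-congˡ s≈) ⟨
      (α * s) * (β * s)
        ≈⟨ theta ⟩
      (β′ * s′) * (β′ * s′) - q * ((α′ * s′) * (β′ * s′)) - q ^ 2 * ((α′ * s′) * (α′ * s′))
        ≈⟨ solve 4 (λ α β s q → (β :* s) :* (β :* s) :- q :* ((α :* s) :* (β :* s)) :- q :^ 2 :* ((α :* s) :* (α :* s))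
             := s :^ 2 :* quadP β (q :* α)) refl α′ β′ s′ q ⟩
      s′ ^ 2 * quad β′ (q * α′) ∎)

  -- With v = q y / x, the right side is the product of 1 - ζ v - ζ² v² over the fifth roots of
  -- unity ζ. The root ζ = 1 gives `quad`; over ℤ[ζ] the other four quadratics split into eight
  -- linear factors, which form two Galois orbits with products `numer` and `denom`.
  quad*numer*denom : ∀ x y q → quad x (q * y) * (numer x (q * y) * denom x (q * y))
        ≈ x ^ 10 - κ (+ 11) * (q ^ 5 * (y ^ 5 * x ^ 5)) - (q ^ 5) ^ 2 * y ^ 10
  quad*numer*denom = solve 3 (λ x y q → quadP x (q :* y) :* (numerP x (q :* y) :* denomP x (q :* y))
    := x :^ 10 :- con (+ 11) :* (q :^ 5 :* (y :^ 5 :* x :^ 5)) :- (q :^ 5) :^ 2 :* y :^ 10) refl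

  module _ {α β α′ β′ b a′ b′ q z w : Carrier}
    (bβ : b * β ≈ 1#) (a′α′ : a′ * α′ ≈ 1#) (b′β′ : b′ * β′ ≈ 1#)
    (quadratic : α * β * (α′ * β′) ^ 2 ≈ quad β′ (q * α′))
    (eleven    : β ^ 10 - κ (+ 11) * (q * (α ^ 5 * β ^ 5)) - q ^ 2 * α ^ 10 ≈ (α * β) ^ 11)
    (eleven′   : β′ ^ 10 - κ (+ 11) * (q ^ 5 * (α′ ^ 5 * β′ ^ 5)) - (q ^ 5) ^ 2 * α′ ^ 10 ≈ (α′ * β′) ^ 11)
    (unit      : z * (β ^ 5 * (β′ * denom β′ (q * α′)) + q * (q * α′) * (α ^ 5 * numer β′ (q * α′))) ≈ 1#)
    (w-def     : β ^ 5 * α′ * w ≈ α ^ 5 * β′)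
    where

    private
      p y n d : Carrier
      p = α′ * β′
      y = quad β′ (q * α′)
      n = numer β′ (q * α′)
      d = denom β′ (q * α′)

      cp : (a′ * b′) * p ≈ 1#
      cp = begin
        (a′ * b′) * (α′ * β′)   ≈⟨ solve 4 (λ a b c d → (a :* b) :* (c :* d) := (a :* c) :* (b :* d)) refl a′ b′ α′ β′ ⟩
        (a′ * α′) * (b′ * β′)   ≈⟨ *-cong a′α′ b′β′ ⟩
        1# * 1#                 ≈⟨ *-identityˡ 1# ⟩
        1#                      ∎

      Bα′-unit : (b ^ 5 * a′) * (β ^ 5 * α′) ≈ 1#
      Bα′-unit = begin
        (b ^ 5 * a′) * (β ^ 5 * α′)  ≈⟨ solve 4 (λ b a β α → (b :^ 5 :* a) :* (β :^ 5 :* α) := (b :* β) :^ 5 :* (a :* α)) refl b a′ β α′ ⟩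
        (b * β) ^ 5 * (a′ * α′)      ≈⟨ *-cong (^-congˡ 5 bβ) a′α′ ⟩
        1# ^ 5 * 1#                  ≈⟨ solve 1 (λ x → (x :^ 0) :^ 5 :* x :^ 0 := x :^ 0) refl b ⟩
        1#                           ∎

      yND : y * (n * d) ≈ p ^ 11
      yND = trans (quad*numer*denom β′ α′ q) eleven′

      eND : α * β * (n * d) ≈ p ^ 9
      eND = *-cancel _ _ cp (*-cancel _ _ cp (begin
        p * (p * (α * β * (n * d)))  ≈⟨ solve 3 (λ p e m → p :* (p :* (e :* m)) := (e :* p :^ 2) :* m) refl p (α * β) (n * d) ⟩
        (α * β * p ^ 2) * (n * d)    ≈⟨ *-congʳ quadratic ⟩
        y * (n * d)                  ≈⟨ yND ⟩
        p ^ 11                       ∎))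

      F Z : Carrier
      F = β ^ 5 * (β′ * d) + q * (q * α′) * (α ^ 5 * n)
      Z = β ^ 5 * α′ * n - α ^ 5 * β′ * d

      -- Put X = q α⁵ / β⁵ and V = q α′ n / (β′ d). Then 1/X - 11 - X and 1/V - 11 - V turn out to
      -- be equal, which factors as (V - X) (1 + X V) = 0. `Z` and `F` are these two factors with
      -- denominators cleared.
      FZ≈0 : F * Z ≈ κ (+ 0)
      FZ≈0 = begin
        F * Z
          ≈⟨ solve 7 (λ α β α′ β′ n d q →
               (β :^ 5 :* (β′ :* d) :+ q :* (q :* α′) :* (α :^ 5 :* n)) :* (β :^ 5 :* α′ :* n :- α :^ 5 :* β′ :* d)
               := (α′ :* β′) :* (n :* d) :* (β :^ 10 :- con (+ 11) :* (q :* (α :^ 5 :* β :^ 5)) :- q :^ 2 :* α :^ 10)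
                  :- α :^ 5 :* β :^ 5 :* ((β′ :* d) :^ 2 :- con (+ 11) :* ((q :* α′ :* β′) :* (n :* d)) :- (q :* α′ :* n) :^ 2))
               refl α β α′ β′ n d q ⟩
        p * (n * d) * (β ^ 10 - κ (+ 11) * (q * (α ^ 5 * β ^ 5)) - q ^ 2 * α ^ 10)
          - α ^ 5 * β ^ 5 * ((β′ * d) ^ 2 - κ (+ 11) * ((q * α′ * β′) * (n * d)) - (q * α′ * n) ^ 2)
          -- The polynomial identity is 1/V - 11 - V = (1 - v - v²)⁵ / (v n d) for v = q α′ / β′,
          -- cleared of denominators. The perfect fifth power is what `quadratic` can be substituted
          -- into.
          ≈⟨ +-cong (*-congˡ eleven) (-‿cong (*-congˡ (solve 3 (λ x y q →
               (x :* denomP x (q :* y)) :^ 2 :- con (+ 11) :* ((q :* y :* x) :* (numerP x (q :* y) :* denomP x (q :* y))) :- (q :* y :* numerP x (q :* y)) :^ 2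
               := quadP x (q :* y) :^ 5) refl β′ α′ q))) ⟩
        p * (n * d) * (α * β) ^ 11 - α ^ 5 * β ^ 5 * y ^ 5
          ≈⟨ +-congˡ (-‿cong (*-congˡ (^-congˡ 5 quadratic))) ⟨
        p * (n * d) * (α * β) ^ 11 - α ^ 5 * β ^ 5 * (α * β * p ^ 2) ^ 5
          ≈⟨ solve 4 (λ p m α β → p :* m :* (α :* β) :^ 11 :- α :^ 5 :* β :^ 5 :* (α :* β :* p :^ 2) :^ 5
               := (α :* β) :^ 10 :* p :* ((α :* β :* m) :- p :^ 9)) refl p (n * d) α β ⟩
        (α * β) ^ 10 * p * ((α * β * (n * d)) - p ^ 9)
          ≈⟨ *-congˡ (+-congʳ eND) ⟩
        (α * β) ^ 10 * p * (p ^ 9 - p ^ 9)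
          ≈⟨ solve 2 (λ x y → x :* (y :- y) := con (+ 0)) refl ((α * β) ^ 10 * p) (p ^ 9) ⟩
        κ (+ 0) ∎

      linear : β ^ 5 * α′ * n ≈ α ^ 5 * β′ * d
      linear = *-cancel _ _ unit (begin
        F * (β ^ 5 * α′ * n)          ≈⟨ solve 3 (λ F x y → F :* x := F :* (x :- y) :+ F :* y) refl F (β ^ 5 * α′ * n) (α ^ 5 * β′ * d) ⟩
        F * Z + F * (α ^ 5 * β′ * d)  ≈⟨ +-congʳ FZ≈0 ⟩
        κ (+ 0) + F * (α ^ 5 * β′ * d) ≈⟨ solve 1 (λ x → con (+ 0) :+ x := x) refl _ ⟩
        F * (α ^ 5 * β′ * d)          ∎)

      wd≈n : w * d ≈ n
      wd≈n = *-cancel _ _ Bα′-unit (begin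
        β ^ 5 * α′ * (w * d)  ≈⟨ *-assoc _ w d ⟨
        β ^ 5 * α′ * w * d    ≈⟨ *-congʳ w-def ⟩
        α ^ 5 * β′ * d        ≈⟨ linear ⟨
        β ^ 5 * α′ * n        ∎)

      -- quad · numer² is homogeneous of degree 10, so the factor (a′ b′)¹⁰ turns its arguments β′, q α′ into a′, q b′.
      w-poly : w ≈ a′ * b′ * (quad a′ (q * b′) * numer a′ (q * b′) ^ 2)
      w-poly = begin
        w                      ≈⟨ *-identityʳ w ⟨
        w * 1#                 ≈⟨ *-congˡ (solve 1 (λ x → (x :^ 0) :^ 11 := x :^ 0) refl b) ⟨
        w * 1# ^ 11            ≈⟨ *-congˡ (^-congˡ 11 cp) ⟨
        w * (a′ * b′ * p) ^ 11 ≈⟨ solve 3 (λ w c p → w :* (c :* p) :^ 11 := c :^ 11 :* w :* p :^ 11) refl w (a′ * b′) p ⟩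
        (a′ * b′) ^ 11 * w * p ^ 11      ≈⟨ *-congˡ yND ⟨
        (a′ * b′) ^ 11 * w * (y * (n * d)) ≈⟨ solve 5 (λ c w y n d → c :^ 11 :* w :* (y :* (n :* d)) := c :^ 11 :* (y :* n) :* (w :* d)) refl _ w y n d ⟩
        (a′ * b′) ^ 11 * (y * n) * (w * d) ≈⟨ *-congˡ wd≈n ⟩
        (a′ * b′) ^ 11 * (y * n) * n
          ≈⟨ solve 5 (λ a b α β q → (a :* b) :^ 11 :* (quadP β (q :* α) :* numerP β (q :* α)) :* numerP β (q :* α)
               := a :* b :* (quadP (a :* (b :* β)) (q :* (b :* (a :* α))) :* numerP (a :* (b :* β)) (q :* (b :* (a :* α))) :^ 2)) refl a′ b′ α′ β′ q ⟩
        a′ * b′ * (quad (a′ * (b′ * β′)) (q * (b′ * (a′ * α′))) * numer (a′ * (b′ * β′)) (q * (b′ * (a′ * α′))) ^ 2)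
          ≈⟨ *-congˡ (*-cong (quad-cong e₁ e₂) (^-congˡ 2 (numer-cong e₁ e₂))) ⟩
        a′ * b′ * (quad a′ (q * b′) * numer a′ (q * b′) ^ 2) ∎
        where
        e₁ : a′ * (b′ * β′) ≈ a′
        e₁ = trans (*-congˡ b′β′) (*-identityʳ a′)
        e₂ : q * (b′ * (a′ * α′)) ≈ q * b′
        e₂ = *-congˡ (trans (*-congˡ a′α′) (*-identityʳ b′))

    -- In the application `a′` and `b′` are series in q⁵, so expanding `w-poly` and sorting by the
    -- exponent of the visible q modulo 5 separates the sections.
    quintisection : w ≈ (a′ ^ 11 * b′ - κ (+ 36) * (q ^ 5 * (a′ ^ 6 * b′ ^ 6)) - (q ^ 5) ^ 2 * (a′ * b′ ^ 11))
                      + q * (κ -[1+ 4 ] * (a′ ^ 10 * b′ ^ 2 - κ (+ 3) * (q ^ 5 * (a′ ^ 5 * b′ ^ 7))))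
                      + q ^ 2 * (κ (+ 5) * (κ (+ 3) * (a′ ^ 9 * b′ ^ 3) + q ^ 5 * (a′ ^ 4 * b′ ^ 8)))
                      + q ^ 3 * (κ -[1+ 9 ] * (κ (+ 3) * (a′ ^ 8 * b′ ^ 4) + q ^ 5 * (a′ ^ 3 * b′ ^ 9)))
                      + q ^ 4 * (κ (+ 5) * (κ (+ 8) * (a′ ^ 7 * b′ ^ 5) + q ^ 5 * (a′ ^ 2 * b′ ^ 10)))
    quintisection = trans w-poly (solve 3 (λ a b q →
      a :* b :* (quadP a (q :* b) :* numerP a (q :* b) :^ 2) :=
           (a :^ 11 :* b :- con (+ 36) :* (q :^ 5 :* (a :^ 6 :* b :^ 6)) :- (q :^ 5) :^ 2 :* (a :* b :^ 11))
        :+ q :* (con -[1+ 4 ] :* (a :^ 10 :* b :^ 2 :- con (+ 3) :* (q :^ 5 :* (a :^ 5 :* b :^ 7))))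
        :+ q :^ 2 :* (con (+ 5) :* (con (+ 3) :* (a :^ 9 :* b :^ 3) :+ q :^ 5 :* (a :^ 4 :* b :^ 8)))
        :+ q :^ 3 :* (con -[1+ 9 ] :* (con (+ 3) :* (a :^ 8 :* b :^ 4) :+ q :^ 5 :* (a :^ 3 :* b :^ 9)))
        :+ q :^ 4 :* (con (+ 5) :* (con (+ 8) :* (a :^ 7 :* b :^ 5) :+ q :^ 5 :* (a :^ 2 :* b :^ 10)))) refl a′ b′ q)

  module _ {α β a b q : Carrier} (aα : a * α ≈ 1#) (bβ : b * β ≈ 1#)
    (eleven : β ^ 10 - κ (+ 11) * (q * (α ^ 5 * β ^ 5)) - q ^ 2 * α ^ 10 ≈ (α * β) ^ 11) where

    private
      e₁ : a * (b * β) ≈ a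
      e₁ = trans (*-congˡ bβ) (*-identityʳ a)
      e₂ : b * (a * α) ≈ b
      e₂ = trans (*-congˡ aα) (*-identityʳ b)

    -- The norm identity multiplied by (a b)¹¹ and solved for its leading monomial, which is thereby
    -- traded for terms whose signs are all positive.
    eleven-inverse : a ^ 11 * b ≈ 1# + κ (+ 11) * (q * (a ^ 6 * b ^ 6)) + q ^ 2 * (a * b ^ 11)
    eleven-inverse = begin
      a ^ 11 * b
        ≈⟨ solve 3 (λ a b q → a :^ 11 :* b := a :* b :* (a :^ 10 :- con (+ 11) :* (q :* (b :^ 5 :* a :^ 5)) :- q :^ 2 :* b :^ 10)
             :+ con (+ 11) :* (q :* (a :^ 6 :* b :^ 6)) :+ q :^ 2 :* (a :* b :^ 11)) refl a b q ⟩
      a * b * (a ^ 10 - κ (+ 11) * (q * (b ^ 5 * a ^ 5)) - q ^ 2 * b ^ 10) + κ (+ 11) * (q * (a ^ 6 * b ^ 6)) + q ^ 2 * (a * b ^ 11)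
        ≈⟨ +-congʳ (+-congʳ one′) ⟩
      1# + κ (+ 11) * (q * (a ^ 6 * b ^ 6)) + q ^ 2 * (a * b ^ 11) ∎
      where
      one′ : a * b * (a ^ 10 - κ (+ 11) * (q * (b ^ 5 * a ^ 5)) - q ^ 2 * b ^ 10) ≈ 1#
      one′ = begin
        a * b * (a ^ 10 - κ (+ 11) * (q * (b ^ 5 * a ^ 5)) - q ^ 2 * b ^ 10)
          ≈⟨ *-congˡ (+-cong (+-cong (^-congˡ 10 e₁) (-‿cong (*-congˡ (*-congˡ (*-cong (^-congˡ 5 e₂) (^-congˡ 5 e₁))))))
               (-‿cong (*-congˡ (^-congˡ 10 e₂)))) ⟨
        a * b * ((a * (b * β)) ^ 10 - κ (+ 11) * (q * ((b * (a * α)) ^ 5 * (a * (b * β)) ^ 5)) - q ^ 2 * (b * (a * α)) ^ 10)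
          ≈⟨ solve 5 (λ a b α β q →
               a :* b :* ((a :* (b :* β)) :^ 10 :- con (+ 11) :* (q :* ((b :* (a :* α)) :^ 5 :* (a :* (b :* β)) :^ 5)) :- q :^ 2 :* (b :* (a :* α)) :^ 10)
               := (a :* b) :^ 11 :* (β :^ 10 :- con (+ 11) :* (q :* (α :^ 5 :* β :^ 5)) :- q :^ 2 :* α :^ 10)) refl a b α β q ⟩
        (a * b) ^ 11 * (β ^ 10 - κ (+ 11) * (q * (α ^ 5 * β ^ 5)) - q ^ 2 * α ^ 10)
          ≈⟨ *-congˡ eleven ⟩
        (a * b) ^ 11 * (α * β) ^ 11
          ≈⟨ solve 4 (λ a b α β → (a :* b) :^ 11 :* (α :* β) :^ 11 := (a :* α) :^ 11 :* (b :* β) :^ 11) refl a b α β ⟩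
        (a * α) ^ 11 * (b * β) ^ 11
          ≈⟨ *-cong (^-congˡ 11 aα) (^-congˡ 11 bβ) ⟩
        1# ^ 11 * 1# ^ 11
          ≈⟨ solve 1 (λ x → (x :^ 0) :^ 11 :* (x :^ 0) :^ 11 := x :^ 0) refl a ⟩
        1# ∎

    -- The 25 is 36 - 11, and the two terms in a b¹¹ cancel.
    component₀ : a ^ 11 * b - κ (+ 36) * (q * (a ^ 6 * b ^ 6)) - q ^ 2 * (a * b ^ 11)
               ≈ 1# + κ -[1+ 24 ] * (q * (a ^ 6 * b ^ 6))
    component₀ = trans (+-congʳ (+-congʳ eleven-inverse)) (solve 3 (λ a b q →
      a :^ 0 :+ con (+ 11) :* (q :* (a :^ 6 :* b :^ 6)) :+ q :^ 2 :* (a :* b :^ 11)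
        :- con (+ 36) :* (q :* (a :^ 6 :* b :^ 6)) :- q :^ 2 :* (a :* b :^ 11)
      := a :^ 0 :+ con -[1+ 24 ] :* (q :* (a :^ 6 :* b :^ 6))) refl a b q)

    -- Since a α = 1, the monomial a¹⁰ b² equals b α times a¹¹ b, to which `eleven-inverse` applies;
    -- the 8 is 11 - 3. All doubt about signs is now concentrated in b α.
    component₁ : a ^ 10 * b ^ 2 - κ (+ 3) * (q * (a ^ 5 * b ^ 7))
               ≈ b * α + κ (+ 8) * (q * (a ^ 5 * b ^ 7)) + q ^ 2 * b ^ 12
    component₁ = begin
      a ^ 10 * b ^ 2 - κ (+ 3) * (q * (a ^ 5 * b ^ 7))
        ≈⟨ +-congʳ (*-congˡ (trans (*-congˡ (*-identityʳ b)) (*-congʳ (sym e₂)))) ⟩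
      a ^ 10 * (b * (a * α) * b) - κ (+ 3) * (q * (a ^ 5 * b ^ 7))
        ≈⟨ +-congʳ (solve 3 (λ a b α → a :^ 10 :* (b :* (a :* α) :* b) := b :* α :* (a :^ 11 :* b)) refl a b α) ⟩
      b * α * (a ^ 11 * b) - κ (+ 3) * (q * (a ^ 5 * b ^ 7))
        ≈⟨ +-congʳ (*-congˡ eleven-inverse) ⟩
      b * α * (1# + κ (+ 11) * (q * (a ^ 6 * b ^ 6)) + q ^ 2 * (a * b ^ 11)) - κ (+ 3) * (q * (a ^ 5 * b ^ 7))
        ≈⟨ solve 4 (λ a b α q →
             b :* α :* (a :^ 0 :+ con (+ 11) :* (q :* (a :^ 6 :* b :^ 6)) :+ q :^ 2 :* (a :* b :^ 11)) :- con (+ 3) :* (q :* (a :^ 5 :* b :^ 7))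
             := b :* α :+ (con (+ 11) :* (q :* (a :^ 5 :* b :^ 6)) :+ q :^ 2 :* b :^ 11) :* (b :* (a :* α)) :- con (+ 3) :* (q :* (a :^ 5 :* b :^ 7)))
             refl a b α q ⟩
      b * α + (κ (+ 11) * (q * (a ^ 5 * b ^ 6)) + q ^ 2 * b ^ 11) * (b * (a * α)) - κ (+ 3) * (q * (a ^ 5 * b ^ 7))
        ≈⟨ +-congʳ (+-congˡ (*-congˡ e₂)) ⟩
      b * α + (κ (+ 11) * (q * (a ^ 5 * b ^ 6)) + q ^ 2 * b ^ 11) * b - κ (+ 3) * (q * (a ^ 5 * b ^ 7))
        ≈⟨ solve 4 (λ a b x q →
             x :+ (con (+ 11) :* (q :* (a :^ 5 :* b :^ 6)) :+ q :^ 2 :* b :^ 11) :* b :- con (+ 3) :* (q :* (a :^ 5 :* b :^ 7))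
             := x :+ con (+ 8) :* (q :* (a :^ 5 :* b :^ 7)) :+ q :^ 2 :* b :^ 12) refl a b (b * α) q ⟩
      b * α + κ (+ 8) * (q * (a ^ 5 * b ^ 7)) + q ^ 2 * b ^ 12 ∎

  *-1- : ∀ x y → x * (1# - y) ≈ x - y * x
  *-1- = solve 2 (λ x y → x :* (x :^ 0 :- y) := x :- y :* x) refl

  x-xy : ∀ x y → x - x * y ≈ x * (1# - y)
  x-xy = solve 2 (λ x y → x :- x :* y := x :* (x :^ 0 :- y)) refl

  xy-x : ∀ x y → x * y - x ≈ - x * (1# - y)
  xy-x = solve 2 (λ x y → x :* y :- x := :- x :* (x :^ 0 :- y)) refl

  rearrange : ∀ a b c d → a * b * c * d ≈ a * d * (b * c)
  rearrange = solve 4 (λ a b c d → a :* b :* c :* d := a :* d :* (b :* c)) refl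

  arrange : ∀ a b c d s → a * b * s * (c * d * s) ≈ 1# * a * b * c * d * s * s
  arrange = solve 5 (λ a b c d s → a :* b :* s :* (c :* d :* s) := a :^ 0 :* a :* b :* c :* d :* s :* s) refl

  arrange′ : ∀ a b c d s → 1# * a * b * c * d * s ^ 5 * s ^ 5 ≈ a * b * (c * d) * s ^ 10
  arrange′ = solve 5 (λ a b c d s → a :^ 0 :* a :* b :* c :* d :* s :^ 5 :* s :^ 5 := a :* b :* (c :* d) :* s :^ 10) refl

  -- Finite sums and products

  ∑ : ℕ → (ℕ → Carrier) → Carrier
  ∑ zero    f = 0#
  ∑ (suc n) f = f 0 + ∑ n (f ∘ suc)

  ∏ : ℕ → (ℕ → Carrier) → Carrier
  ∏ zero    f = 1#
  ∏ (suc n) f = f 0 * ∏ n (f ∘ suc)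

  ∑-cong< : ∀ n {f g} → (∀ i → i ℕ.< n → f i ≈ g i) → ∑ n f ≈ ∑ n g
  ∑-cong< zero    p = refl
  ∑-cong< (suc n) p = +-cong (p 0 (ℕ.s≤s ℕ.z≤n)) (∑-cong< n (λ i i<n → p (suc i) (ℕ.s≤s i<n)))

  ∑-cong : ∀ n {f g} → (∀ i → f i ≈ g i) → ∑ n f ≈ ∑ n g
  ∑-cong n p = ∑-cong< n (λ i _ → p i)

  ∑-zero : ∀ n → ∑ n (λ _ → 0#) ≈ 0#
  ∑-zero zero    = refl
  ∑-zero (suc n) = trans (+-identityˡ _) (∑-zero n)

  ∑-+ : ∀ n f g → ∑ n (λ i → f i + g i) ≈ ∑ n f + ∑ n g
  ∑-+ zero f g = sym (+-identityˡ _)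
  ∑-+ (suc n) f g = trans (+-congˡ (∑-+ n (f ∘ suc) (g ∘ suc)))
    (solve 4 (λ a b c d → a :+ b :+ (c :+ d) := (a :+ c) :+ (b :+ d)) refl _ _ _ _)

  *-∑ : ∀ n x f → x * ∑ n f ≈ ∑ n (λ i → x * f i)
  *-∑ zero x f = zeroʳ x
  *-∑ (suc n) x f = trans (distribˡ x _ _) (+-congˡ (*-∑ n x (f ∘ suc)))

  ∑-* : ∀ n f x → ∑ n f * x ≈ ∑ n (λ i → f i * x)
  ∑-* n f x = trans (*-comm _ x) (trans (*-∑ n x f) (∑-cong n (λ i → *-comm x (f i))))

  ∑-split : ∀ m n f → ∑ (m ℕ.+ n) f ≈ ∑ m f + ∑ n (λ i → f (m ℕ.+ i))
  ∑-split zero    n f = sym (+-identityˡ _)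
  ∑-split (suc m) n f = trans (+-congˡ (∑-split m n (f ∘ suc))) (sym (+-assoc _ _ _))

  ∑-snoc : ∀ n f → ∑ (suc n) f ≈ ∑ n f + f n
  ∑-snoc zero f = trans (+-identityʳ _) (sym (+-identityˡ _))
  ∑-snoc (suc n) f = trans (+-congˡ (∑-snoc n (f ∘ suc))) (sym (+-assoc _ _ _))

  ∑-reverse : ∀ n f → ∑ n f ≈ ∑ n (λ i → f (n ℕ.∸ suc i))
  ∑-reverse zero    f = refl
  ∑-reverse (suc n) f = begin
    ∑ (suc n) f                                   ≈⟨ ∑-snoc n f ⟩
    ∑ n f + f n                                   ≈⟨ +-comm _ _ ⟩
    f n + ∑ n f                                   ≈⟨ +-congˡ (∑-reverse n f) ⟩
    f n + ∑ n (λ i → f (n ℕ.∸ suc i))             ∎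

  ∑-swap : ∀ m n (f : ℕ → ℕ → Carrier) → ∑ m (λ i → ∑ n (f i)) ≈ ∑ n (λ j → ∑ m (λ i → f i j))
  ∑-swap zero    n f = sym (∑-zero n)
  ∑-swap (suc m) n f = trans (+-congˡ (∑-swap m n (f ∘ suc))) (sym (∑-+ n (f 0) _))

  ∑-mod5 : ∀ n f → ∑ (n ℕ.* 5) f ≈ ∑ n (λ i → f (i ℕ.* 5)) + ∑ n (λ i → f (1 ℕ.+ i ℕ.* 5))
    + ∑ n (λ i → f (2 ℕ.+ i ℕ.* 5)) + ∑ n (λ i → f (3 ℕ.+ i ℕ.* 5)) + ∑ n (λ i → f (4 ℕ.+ i ℕ.* 5))
  ∑-mod5 zero f = sym (trans (+-congʳ (trans (+-congʳ (trans (+-congʳ (+-identityˡ _)) (+-identityˡ _))) (+-identityˡ _))) (+-identityˡ _))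
  ∑-mod5 (suc n) f = trans
    (+-congˡ (+-congˡ (+-congˡ (+-congˡ (+-congˡ (∑-mod5 n (λ i → f (5 ℕ.+ i))))))))
    (solve 10 (λ a b c d e p r s t u → a :+ (b :+ (c :+ (d :+ (e :+ (p :+ r :+ s :+ t :+ u)))))
       := (a :+ p) :+ (b :+ r) :+ (c :+ s) :+ (d :+ t) :+ (e :+ u)) refl _ _ _ _ _ _ _ _ _ _)

  ∏-cong< : ∀ n {f g} → (∀ i → i ℕ.< n → f i ≈ g i) → ∏ n f ≈ ∏ n g
  ∏-cong< zero    p = refl
  ∏-cong< (suc n) p = *-cong (p 0 (ℕ.s≤s ℕ.z≤n)) (∏-cong< n (λ i i<n → p (suc i) (ℕ.s≤s i<n)))

  ∏-cong : ∀ n {f g} → (∀ i → f i ≈ g i) → ∏ n f ≈ ∏ n g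
  ∏-cong n p = ∏-cong< n (λ i _ → p i)

  ∏-* : ∀ n f g → ∏ n (λ i → f i * g i) ≈ ∏ n f * ∏ n g
  ∏-* zero f g = sym (*-identityˡ _)
  ∏-* (suc n) f g = trans (*-congˡ (∏-* n (f ∘ suc) (g ∘ suc)))
    (solve 4 (λ a b c d → a :* b :* (c :* d) := (a :* c) :* (b :* d)) refl _ _ _ _)

  ∏-one : ∀ n → ∏ n (λ _ → 1#) ≈ 1#
  ∏-one zero = refl
  ∏-one (suc n) = trans (*-identityˡ _) (∏-one n)

  ∏-const : ∀ n x → ∏ n (λ _ → x) ≈ x ^ n
  ∏-const zero x = refl
  ∏-const (suc n) x = *-congˡ (∏-const n x)

  ∏-^ : ∀ n f k → ∏ n (λ i → f i ^ k) ≈ ∏ n f ^ k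
  ∏-^ n f zero    = ∏-one n
  ∏-^ n f (suc k) = trans (∏-* n f (λ i → f i ^ k)) (*-congˡ (∏-^ n f k))

  ∏-split : ∀ m n f → ∏ (m ℕ.+ n) f ≈ ∏ m f * ∏ n (λ i → f (m ℕ.+ i))
  ∏-split zero    n f = sym (*-identityˡ _)
  ∏-split (suc m) n f = trans (*-congˡ (∏-split m n (f ∘ suc))) (sym (*-assoc _ _ _))

  ∏-mod5 : ∀ n f → ∏ (n ℕ.* 5) f ≈ ∏ n (λ i → f (i ℕ.* 5)) * ∏ n (λ i → f (1 ℕ.+ i ℕ.* 5))
    * ∏ n (λ i → f (2 ℕ.+ i ℕ.* 5)) * ∏ n (λ i → f (3 ℕ.+ i ℕ.* 5)) * ∏ n (λ i → f (4 ℕ.+ i ℕ.* 5))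
  ∏-mod5 zero f = solve 1 (λ x → x :^ 0 := x :^ 0 :* x :^ 0 :* x :^ 0 :* x :^ 0 :* x :^ 0) refl 1#
  ∏-mod5 (suc n) f = trans
    (*-congˡ (*-congˡ (*-congˡ (*-congˡ (*-congˡ (∏-mod5 n (λ i → f (5 ℕ.+ i))))))))
    (solve 10 (λ a b c d e p r s t u → a :* (b :* (c :* (d :* (e :* (p :* r :* s :* t :* u)))))
       := (a :* p) :* (b :* r) :* (c :* s) :* (d :* t) :* (e :* u)) refl _ _ _ _ _ _ _ _ _ _)

  ∏-snoc : ∀ n f → ∏ (suc n) f ≈ ∏ n f * f n
  ∏-snoc zero f = *-comm _ _
  ∏-snoc (suc n) f = trans (*-congˡ (∏-snoc n (f ∘ suc))) (sym (*-assoc _ _ _))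

  ∏-reverse : ∀ n f → ∏ n f ≈ ∏ n (λ i → f (n ℕ.∸ suc i))
  ∏-reverse zero    f = refl
  ∏-reverse (suc n) f = trans (∏-snoc n f) (trans (*-comm _ _) (*-congˡ (∏-reverse n f)))

  -- The sign character of ℤ

  sgn : ℤ → Carrier
  sgn k = (- 1#) ^ ℤ.∣ k ∣

  private
    neg-neg : ∀ x → - 1# * (- 1# * x) ≈ x
    neg-neg = solve 1 (λ x → (:- (x :^ 0)) :* (:- (x :^ 0) :* x) := x) refl

  sgn-suc : ∀ k → sgn (ℤ.suc k) ≈ - 1# * sgn k
  sgn-suc (+ n) = refl
  sgn-suc -[1+ zero ] = sym (neg-neg 1#)
  sgn-suc -[1+ suc n ] = sym (neg-neg _)

  sgn-neg : ∀ k → sgn (ℤ.- k) ≈ sgn k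
  sgn-neg k = reflexive (cong ((- 1#) ^_) (ℤ.∣-i∣≡∣i∣ k))

  private
    sgn-+ℕ : ∀ n k → sgn (+ n ℤ.+ k) ≈ (- 1#) ^ n * sgn k
    sgn-+ℕ zero k = trans (reflexive (cong sgn (ℤ.+-identityˡ k))) (sym (*-identityˡ _))
    sgn-+ℕ (suc n) k = begin
      sgn (+ suc n ℤ.+ k)             ≈⟨ reflexive (cong sgn (ℤ.+-assoc (+ 1) (+ n) k)) ⟩
      sgn (ℤ.suc (+ n ℤ.+ k))         ≈⟨ sgn-suc (+ n ℤ.+ k) ⟩
      - 1# * sgn (+ n ℤ.+ k)          ≈⟨ *-congˡ (sgn-+ℕ n k) ⟩
      - 1# * ((- 1#) ^ n * sgn k)     ≈⟨ *-assoc _ _ _ ⟨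
      (- 1#) ^ suc n * sgn k          ∎

  sgn-+ : ∀ j k → sgn (j ℤ.+ k) ≈ sgn j * sgn k
  sgn-+ (+ n) k = sgn-+ℕ n k
  sgn-+ -[1+ n ] k = begin
    sgn (-[1+ n ] ℤ.+ k)              ≈⟨ sgn-neg (-[1+ n ] ℤ.+ k) ⟨
    sgn (ℤ.- (-[1+ n ] ℤ.+ k))        ≈⟨ reflexive (cong sgn (ℤ.neg-distrib-+ -[1+ n ] k)) ⟩
    sgn (+ suc n ℤ.+ ℤ.- k)           ≈⟨ sgn-+ℕ (suc n) (ℤ.- k) ⟩
    (- 1#) ^ suc n * sgn (ℤ.- k)      ≈⟨ *-congˡ (sgn-neg k) ⟩
    (- 1#) ^ suc n * sgn k            ∎

  sgn-square : ∀ k → sgn k * sgn k ≈ 1#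
  sgn-square k = trans (*-congʳ (sym (sgn-neg k))) (trans (sym (sgn-+ (ℤ.- k) k))
    (reflexive (cong sgn (ℤ.+-inverseˡ k))))

  -- Sums over windows of ℤ

  ∑ℤ : ℤ → ℕ → (ℤ → Carrier) → Carrier
  ∑ℤ lo L g = ∑ L (λ i → g (lo ℤ.+ + i))

  ∑ℤ-cong : ∀ lo L {g h} → (∀ k → g k ≈ h k) → ∑ℤ lo L g ≈ ∑ℤ lo L h
  ∑ℤ-cong lo L p = ∑-cong L (λ i → p (lo ℤ.+ + i))

  ∑ℤ-shift : ∀ c lo L g → ∑ℤ lo L (λ k → g (c ℤ.+ k)) ≈ ∑ℤ (c ℤ.+ lo) L g
  ∑ℤ-shift c lo L g = ∑-cong L (λ i → reflexive (cong g (≡.sym (ℤ.+-assoc c lo (+ i)))))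

  -- The extra 1 is due to the window being half-open: its last point is lo + L - 1, and this
  -- becomes the first point after reflection.
  ∑ℤ-reflect : ∀ c lo L g → ∑ℤ lo L (λ k → g (c ℤ.- k)) ≈ ∑ℤ (+ 1 ℤ.+ c ℤ.- (lo ℤ.+ + L)) L g
  ∑ℤ-reflect c lo L g = trans (∑-reverse L _) (∑-cong< L (λ i i<L → reflexive (cong g (lem i i<L))))
    where
    lem′ : ∀ c lo i d → c ℤ.- (lo ℤ.+ d) ≡ + 1 ℤ.+ c ℤ.- (lo ℤ.+ (+ 1 ℤ.+ i ℤ.+ d)) ℤ.+ i
    lem′ = ℤ-solve
    lem : ∀ i → i ℕ.< L → c ℤ.- (lo ℤ.+ + (L ℕ.∸ suc i)) ≡ + 1 ℤ.+ c ℤ.- (lo ℤ.+ + L) ℤ.+ + i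
    lem i i<L = ≡.trans (lem′ c lo (+ i) (+ (L ℕ.∸ suc i)))
      (cong (λ x → + 1 ℤ.+ c ℤ.- (lo ℤ.+ + x) ℤ.+ + i) (ℕ.m+[n∸m]≡n i<L))

  ∑ℤ-swap : ∀ lo L lo′ L′ (g : ℤ → ℤ → Carrier) →
    ∑ℤ lo L (λ j → ∑ℤ lo′ L′ (g j)) ≈ ∑ℤ lo′ L′ (λ k → ∑ℤ lo L (λ j → g j k))
  ∑ℤ-swap lo L lo′ L′ g = ∑-swap L L′ _

  ∑ℤ-* : ∀ lo L lo′ L′ g h → ∑ℤ lo L (λ j → ∑ℤ lo′ L′ (λ k → g j * h k)) ≈ ∑ℤ lo L g * ∑ℤ lo′ L′ h
  ∑ℤ-* lo L lo′ L′ g h = trans (∑-cong L (λ i → sym (*-∑ L′ _ _))) (sym (∑-* L _ _))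

  ∑ℤ-mod5 : ∀ lo L g → ∑ℤ (lo ℤ.* + 5) (L ℕ.* 5) g ≈
    ∑ℤ lo L (λ t → g (+ 0 ℤ.+ t ℤ.* + 5)) + ∑ℤ lo L (λ t → g (+ 1 ℤ.+ t ℤ.* + 5)) + ∑ℤ lo L (λ t → g (+ 2 ℤ.+ t ℤ.* + 5))
    + ∑ℤ lo L (λ t → g (+ 3 ℤ.+ t ℤ.* + 5)) + ∑ℤ lo L (λ t → g (+ 4 ℤ.+ t ℤ.* + 5))
  ∑ℤ-mod5 lo L g = trans (∑-mod5 L _)
    (+-cong (+-cong (+-cong (+-cong (s 0) (s 1)) (s 2)) (s 3)) (s 4))
    where
    lem : ∀ lo r i → lo ℤ.* + 5 ℤ.+ (r ℤ.+ i ℤ.* + 5) ≡ r ℤ.+ (lo ℤ.+ i) ℤ.* + 5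
    lem = ℤ-solve
    s : ∀ r → ∑ L (λ i → g (lo ℤ.* + 5 ℤ.+ + (r ℕ.+ i ℕ.* 5))) ≈ ∑ L (λ i → g (+ r ℤ.+ (lo ℤ.+ + i) ℤ.* + 5))
    s r = ∑-cong L (λ i → reflexive (cong g (≡.trans
      (cong (λ x → lo ℤ.* + 5 ℤ.+ (+ r ℤ.+ x)) (ℤ.pos-* i 5)) (lem lo (+ r) (+ i)))))

  Vanishes : ℕ → (ℤ → Carrier) → Set
  Vanishes K g = ∀ k → K ℕ.≤ ℤ.∣ k ∣ → g k ≈ 0#

  private
    ∑ℤ-zero : ∀ lo L g → (∀ i → i ℕ.< L → g (lo ℤ.+ + i) ≈ 0#) → ∑ℤ lo L g ≈ 0#
    ∑ℤ-zero lo L g p = trans (∑-cong< L p) (∑-zero L)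

    ∑ℤ-split : ∀ lo m n g → ∑ℤ lo (m ℕ.+ n) g ≈ ∑ℤ lo m g + ∑ℤ (lo ℤ.+ + m) n g
    ∑ℤ-split lo m n g = trans (∑-split m n _)
      (+-congˡ (∑-cong n (λ i → reflexive (cong g (≡.sym (ℤ.+-assoc lo (+ m) (+ i)))))))

  -- `p` and `r` are the overhangs of the window beyond [-K, K) on the left and on the right. As
  -- natural numbers they certify the inclusion, so each use only has to verify two linear
  -- equations.
  ∑ℤ-window : ∀ K g → Vanishes K g → ∀ lo L p r → ℤ.- + K ≡ lo ℤ.+ + p → lo ℤ.+ + L ≡ + K ℤ.+ + r →
              ∑ℤ lo L g ≈ ∑ℤ (ℤ.- + K) (K ℕ.+ K) g
  ∑ℤ-window K g van lo L p r -K≡ hi≡ = begin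
    ∑ℤ lo L g                                          ≈⟨ reflexive (cong (λ l → ∑ℤ lo l g) L≡) ⟩
    ∑ℤ lo (p ℕ.+ ((K ℕ.+ K) ℕ.+ r)) g                  ≈⟨ ∑ℤ-split lo p _ g ⟩
    ∑ℤ lo p g + ∑ℤ (lo ℤ.+ + p) ((K ℕ.+ K) ℕ.+ r) g    ≈⟨ +-cong (∑ℤ-zero lo p g left) (reflexive (cong (λ l → ∑ℤ l ((K ℕ.+ K) ℕ.+ r) g) (≡.sym -K≡))) ⟩
    0# + ∑ℤ (ℤ.- + K) ((K ℕ.+ K) ℕ.+ r) g              ≈⟨ +-identityˡ _ ⟩
    ∑ℤ (ℤ.- + K) ((K ℕ.+ K) ℕ.+ r) g                   ≈⟨ ∑ℤ-split (ℤ.- + K) (K ℕ.+ K) r g ⟩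
    ∑ℤ (ℤ.- + K) (K ℕ.+ K) g + ∑ℤ (ℤ.- + K ℤ.+ + (K ℕ.+ K)) r g ≈⟨ +-congˡ (∑ℤ-zero (ℤ.- + K ℤ.+ + (K ℕ.+ K)) r g right) ⟩
    ∑ℤ (ℤ.- + K) (K ℕ.+ K) g + 0#                      ≈⟨ +-identityʳ _ ⟩
    ∑ℤ (ℤ.- + K) (K ℕ.+ K) g                           ∎
    where
    L≡ : L ≡ p ℕ.+ ((K ℕ.+ K) ℕ.+ r)
    L≡ = ℤ.+-injective (≡.trans (e₁ lo (+ L)) (≡.trans (cong (λ x → x ℤ.- lo) hi≡)
      (≡.trans (e₂ (+ K) (+ r) lo) (≡.trans (cong (λ x → + K ℤ.+ + K ℤ.+ + r ℤ.+ (x ℤ.- lo)) -K≡) (e₃ (+ K) (+ r) lo (+ p))))))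
      where
      e₁ : ∀ lo L → L ≡ lo ℤ.+ L ℤ.- lo
      e₁ = ℤ-solve
      e₂ : ∀ K r lo → K ℤ.+ r ℤ.- lo ≡ K ℤ.+ K ℤ.+ r ℤ.+ (ℤ.- K ℤ.- lo)
      e₂ = ℤ-solve
      e₃ : ∀ K r lo p → K ℤ.+ K ℤ.+ r ℤ.+ (lo ℤ.+ p ℤ.- lo) ≡ p ℤ.+ (K ℤ.+ K ℤ.+ r)
      e₃ = ℤ-solve
    left : ∀ i → i ℕ.< p → g (lo ℤ.+ + i) ≈ 0#
    left i i<p = van _ (≡.subst (K ℕ.≤_) (≡.sym (≡.trans (cong ℤ.∣_∣ e) (ℤ.∣-i∣≡∣i∣ (+ (K ℕ.+ d))))) (ℕ.m≤m+n K d))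
      where
      d = p ℕ.∸ i
      lem : ∀ d K → ℤ.- (K ℤ.+ d) ≡ ℤ.- K ℤ.- d
      lem = ℤ-solve
      lem′ : ∀ lo i d → lo ℤ.+ (i ℤ.+ d) ℤ.- d ≡ lo ℤ.+ i
      lem′ = ℤ-solve
      e : lo ℤ.+ + i ≡ ℤ.- + (K ℕ.+ d)
      e = ≡.sym (≡.trans (lem (+ d) (+ K)) (≡.trans (cong (ℤ._- + d) -K≡)
        (≡.trans (cong (λ x → lo ℤ.+ + x ℤ.- + d) (≡.sym (ℕ.m+[n∸m]≡n (ℕ.<⇒≤ i<p)))) (lem′ lo (+ i) (+ d)))))
    right : ∀ i → i ℕ.< r → g (ℤ.- + K ℤ.+ + (K ℕ.+ K) ℤ.+ + i) ≈ 0#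
    right i _ = van _ (≡.subst (K ℕ.≤_) (≡.sym (cong ℤ.∣_∣ (lem (+ K) (+ i)))) (ℕ.m≤m+n K i))
      where
      lem : ∀ K i → ℤ.- K ℤ.+ (K ℤ.+ K) ℤ.+ i ≡ K ℤ.+ i
      lem = ℤ-solve

  -- The window [1-K , K] is symmetric under k ↦ 1 - k.
  ∑ℤ-antisymmetric : ∀ K g → (∀ k → g (+ 1 ℤ.- k) ≈ - g k) → ∑ℤ (+ 1 ℤ.- + K) (K ℕ.+ K) g ≈ 0#
  ∑ℤ-antisymmetric K g anti = begin
    ∑ℤ (+ 1 ℤ.- + K) (K ℕ.+ K) g                                ≈⟨ ∑ℤ-split (+ 1 ℤ.- + K) K K g ⟩
    ∑ℤ (+ 1 ℤ.- + K) K g + ∑ℤ (+ 1 ℤ.- + K ℤ.+ + K) K g         ≈⟨ +-cong half (reflexive (cong (λ l → ∑ℤ l K g) (lem (+ K)))) ⟩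
    ∑ℤ (+ 1) K (λ k → - 1# * g k) + ∑ℤ (+ 1) K g                ≈⟨ +-congʳ (*-∑ K (- 1#) (λ i → g (+ 1 ℤ.+ + i))) ⟨
    - 1# * ∑ℤ (+ 1) K g + ∑ℤ (+ 1) K g                          ≈⟨ solve 1 (λ x → :- (x :^ 0) :* x :+ x := x :- x) refl _ ⟩
    ∑ℤ (+ 1) K g - ∑ℤ (+ 1) K g                                 ≈⟨ -‿inverseʳ _ ⟩
    0#                                                          ∎
    where
    lem : ∀ K → + 1 ℤ.- K ℤ.+ K ≡ + 1
    lem = ℤ-solve
    lem′ : ∀ K → + 1 ℤ.- K ≡ + 1 ℤ.+ + 1 ℤ.- (+ 1 ℤ.+ K)
    lem′ = ℤ-solve
    half : ∑ℤ (+ 1 ℤ.- + K) K g ≈ ∑ℤ (+ 1) K (λ k → - 1# * g k)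
    half = begin
      ∑ℤ (+ 1 ℤ.- + K) K g                          ≈⟨ reflexive (cong (λ l → ∑ℤ l K g) (lem′ (+ K))) ⟩
      ∑ℤ (+ 1 ℤ.+ + 1 ℤ.- (+ 1 ℤ.+ + K)) K g        ≈⟨ ∑ℤ-reflect (+ 1) (+ 1) K g ⟨
      ∑ℤ (+ 1) K (λ k → g (+ 1 ℤ.- k))              ≈⟨ ∑ℤ-cong (+ 1) K (λ k → trans (anti k) (solve 1 (λ x → :- x := :- (x :^ 0) :* x) refl (g k))) ⟩
      ∑ℤ (+ 1) K (λ k → - 1# * g k)                 ∎

  -- Gaussian binomial coefficients

  module Gauss (Q : Carrier) where

    qb : ℕ → ℕ → Carrier
    qb n       zero    = 1#
    qb zero    (suc j) = 0#
    qb (suc n) (suc j) = qb n j + Q ^ suc j * qb n (suc j)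

    qb-beyond : ∀ n j → n ℕ.< j → qb n j ≈ 0#
    qb-beyond zero    (suc j) _ = refl
    qb-beyond (suc n) (suc j) (ℕ.s≤s n<j) = trans
      (+-cong (qb-beyond n j n<j) (trans (*-congˡ (qb-beyond n (suc j) (ℕ.m<n⇒m<1+n n<j))) (zeroʳ _)))
      (+-identityˡ 0#)

    qb-top : ∀ n → qb n n ≈ 1#
    qb-top zero    = refl
    qb-top (suc n) = trans (+-cong (qb-top n) (trans (*-congˡ (qb-beyond n (suc n) ℕ.≤-refl)) (zeroʳ _))) (+-identityʳ 1#)

    poch : ℕ → Carrier
    poch n = ∏ n (λ i → 1# - Q ^ suc i)

    -- The factorial formula in multiplied form, free of division. Both branches of the Pascal
    -- recursion contribute, and they combine by (1 - x) + x (1 - y) = 1 - x y.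
    qb-poch : ∀ i j {k} → k ≡ i ℕ.+ j → qb k j * (poch i * poch j) ≈ poch k
    qb-poch zero j ≡.refl = trans (*-cong (qb-top j) (*-identityˡ _)) (*-identityˡ _)
    qb-poch (suc i) zero {k} ≡.refl = trans (*-identityˡ _) (trans (*-identityʳ _)
      (reflexive (cong poch (≡.sym (ℕ.+-identityʳ (suc i))))))
    qb-poch (suc i) (suc j) {suc k} eq = begin
      (qb k j + Q ^ suc j * qb k (suc j)) * (poch (suc i) * poch (suc j))
        ≈⟨ distribʳ _ _ _ ⟩
      qb k j * (poch (suc i) * poch (suc j)) + Q ^ suc j * qb k (suc j) * (poch (suc i) * poch (suc j))
        ≈⟨ +-cong (*-congˡ (*-congˡ (∏-snoc j _))) (*-congˡ (*-congʳ (∏-snoc i _))) ⟩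
      qb k j * (poch (suc i) * (poch j * (1# - Q ^ suc j))) + Q ^ suc j * qb k (suc j) * (poch i * (1# - Q ^ suc i) * poch (suc j))
        ≈⟨ solve 9 (λ x y z w p r a b v → x :* (p :* (y :* w)) :+ a :* z :* (r :* b :* v)
                     := x :* (p :* y) :* w :+ a :* b :* (z :* (r :* v))) refl
             (qb k j) (poch j) (qb k (suc j)) (1# - Q ^ suc j) (poch (suc i)) (poch i) (Q ^ suc j) (1# - Q ^ suc i) (poch (suc j)) ⟩
      qb k j * (poch (suc i) * poch j) * (1# - Q ^ suc j) + Q ^ suc j * (1# - Q ^ suc i) * (qb k (suc j) * (poch i * poch (suc j)))
        ≈⟨ +-cong (*-congʳ (qb-poch (suc i) j k≡)) (*-congˡ (qb-poch i (suc j) (ℕ.suc-injective eq))) ⟩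
      poch k * (1# - Q ^ suc j) + Q ^ suc j * (1# - Q ^ suc i) * poch k
        ≈⟨ solve 3 (λ P x y → P :* (P :^ 0 :- x) :+ x :* (P :^ 0 :- y) :* P := P :* (P :^ 0 :- x :* y)) refl (poch k) (Q ^ suc j) (Q ^ suc i) ⟩
      poch k * (1# - Q ^ suc j * Q ^ suc i)
        ≈⟨ *-congˡ (+-congˡ (-‿cong (^-homo-* Q (suc j) (suc i)))) ⟨
      poch k * (1# - Q ^ (suc j ℕ.+ suc i))
        ≈⟨ *-congˡ (+-congˡ (-‿cong (reflexive (cong (Q ^_) (≡.trans (ℕ.+-comm (suc j) (suc i)) (≡.sym eq)))))) ⟩
      poch k * (1# - Q ^ suc k)
        ≈⟨ ∏-snoc k _ ⟨
      poch (suc k) ∎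
      where
      k≡ : k ≡ suc i ℕ.+ j
      k≡ = ≡.trans (ℕ.suc-injective eq) (ℕ.+-suc i j)

    -- The homogeneous form in X and Y permits X = q⁵ⁿ later on, where the usual form would need
    -- negative powers of q. Splitting off the factor i = 0 leaves a product of the same shape with
    -- Q Y in place of Y.
    q-binomial : ∀ M X Y → ∏ M (λ i → X - Q ^ i * Y)
      ≈ ∑ (suc M) (λ j → (- 1#) ^ j * Q ^ tri j * X ^ (M ℕ.∸ j) * Y ^ j * qb M j)
    q-binomial zero X Y = sym (trans (+-identityʳ _)
      (solve 1 (λ x → x :^ 0 :* x :^ 0 :* x :^ 0 :* x :^ 0 :* x :^ 0 := x :^ 0) refl Q))
    q-binomial (suc M) X Y = begin
      (X - 1# * Y) * ∏ M (λ i → X - Q ^ suc i * Y)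
        ≈⟨ *-congˡ (trans (∏-cong M (λ i → +-congˡ (-‿cong (solve 3 (λ a b c → a :* b :* c := b :* (a :* c)) refl Q (Q ^ i) Y))))
                          (q-binomial M X (Q * Y))) ⟩
      (X - 1# * Y) * ∑ (suc M) u
        ≈⟨ solve 3 (λ x y z → (x :- x :^ 0 :* y) :* z := x :* z :+ :- y :* z) refl X Y (∑ (suc M) u) ⟩
      X * ∑ (suc M) u + - Y * ∑ (suc M) u
        ≈⟨ +-cong X∑u (*-∑ (suc M) (- Y) u) ⟩
      t 0 + ∑ (suc M) x + ∑ (suc M) (λ i → - Y * u i)
        ≈⟨ trans (+-assoc _ _ _) (+-congˡ (sym (∑-+ (suc M) x (λ i → - Y * u i)))) ⟩
      t 0 + ∑ (suc M) (λ i → x i + - Y * u i)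
        ≈⟨ +-congˡ (∑-cong (suc M) t-suc) ⟨
      t 0 + ∑ (suc M) (λ i → t (suc i)) ∎
      where
      t u x : ℕ → Carrier
      t j = (- 1#) ^ j * Q ^ tri j * X ^ (suc M ℕ.∸ j) * Y ^ j * qb (suc M) j
      u j = (- 1#) ^ j * Q ^ tri j * X ^ (M ℕ.∸ j) * (Q * Y) ^ j * qb M j
      x i = (- 1#) ^ suc i * Q ^ tri (suc i) * X ^ (M ℕ.∸ i) * (Q * Y) ^ suc i * qb M (suc i)

      t-suc : ∀ i → t (suc i) ≈ x i + - Y * u i
      t-suc i = begin
        (- 1# * (- 1#) ^ i) * Q ^ (i ℕ.+ tri i) * X ^ (M ℕ.∸ i) * (Y * Y ^ i) * (qb M i + Q * Q ^ i * qb M (suc i))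
          ≈⟨ *-congʳ (*-congʳ (*-congʳ (*-congˡ (^-homo-* Q i (tri i))))) ⟩
        (- 1# * (- 1#) ^ i) * (Q ^ i * Q ^ tri i) * X ^ (M ℕ.∸ i) * (Y * Y ^ i) * (qb M i + Q * Q ^ i * qb M (suc i))
          ≈⟨ solve 9 (λ s Q Qi T Z Y Yi b c →
               (:- (s :^ 0) :* s) :* (Qi :* T) :* Z :* (Y :* Yi) :* (b :+ Q :* Qi :* c)
               := (:- (s :^ 0) :* s) :* (Qi :* T) :* Z :* ((Q :* Y) :* (Qi :* Yi)) :* c
                  :+ :- Y :* (s :* T :* Z :* (Qi :* Yi) :* b)) refl
               ((- 1#) ^ i) Q (Q ^ i) (Q ^ tri i) (X ^ (M ℕ.∸ i)) Y (Y ^ i) (qb M i) (qb M (suc i)) ⟩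
        (- 1# * (- 1#) ^ i) * (Q ^ i * Q ^ tri i) * X ^ (M ℕ.∸ i) * ((Q * Y) * (Q ^ i * Y ^ i)) * qb M (suc i)
          + - Y * ((- 1#) ^ i * Q ^ tri i * X ^ (M ℕ.∸ i) * (Q ^ i * Y ^ i) * qb M i)
          ≈⟨ +-cong (*-congʳ (*-cong (*-congʳ (*-congˡ (^-homo-* Q i (tri i)))) (*-congˡ (^-distrib-* Q Y i))))
                    (*-congˡ (*-congʳ (*-congˡ (^-distrib-* Q Y i)))) ⟨
        x i + - Y * u i ∎

      X*u : ∀ i → i ℕ.< M → X * u (suc i) ≈ x i
      X*u i i<M = trans
        (solve 5 (λ X s Z y b → X :* (s :* Z :* y :* b) := s :* (X :* Z) :* y :* b) refl X _ _ _ _)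
        (*-congʳ (*-congʳ (*-congˡ (reflexive (cong (X ^_) (≡.sym (ℕ.+-∸-assoc 1 i<M)))))))

      X∑u : X * ∑ (suc M) u ≈ t 0 + ∑ (suc M) x
      X∑u = begin
        X * (u 0 + ∑ M (λ i → u (suc i)))         ≈⟨ distribˡ X _ _ ⟩
        X * u 0 + X * ∑ M (λ i → u (suc i))       ≈⟨ +-cong (solve 2 (λ X Z → X :* (X :^ 0 :* X :^ 0 :* Z :* X :^ 0 :* X :^ 0)
                                                           := X :^ 0 :* X :^ 0 :* (X :* Z) :* X :^ 0 :* X :^ 0) refl X (X ^ M))
                                                      (*-∑ M X (λ i → u (suc i))) ⟩
        t 0 + ∑ M (λ i → X * u (suc i))           ≈⟨ +-congˡ (∑-cong< M X*u) ⟩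
        -- The zero term `x M`, in which the Gaussian binomial is out of range, is appended so that
        -- this sum gets as many terms as the other one.
        t 0 + ∑ M x                               ≈⟨ +-congˡ (+-identityʳ _) ⟨
        t 0 + (∑ M x + 0#)                        ≈⟨ +-congˡ (+-congˡ (trans (*-congˡ (qb-beyond M (suc M) ℕ.≤-refl)) (zeroʳ _))) ⟨
        t 0 + (∑ M x + x M)                       ≈⟨ +-congˡ (∑-snoc M x) ⟨
        t 0 + ∑ (suc M) x                         ∎

    ∏-neg-geometric : ∀ n Y → ∏ n (λ i → - (Q ^ i * Y)) ≈ (- 1#) ^ n * (Q ^ tri n * Y ^ n)
    ∏-neg-geometric zero Y = sym (trans (*-identityˡ _) (*-identityˡ 1#))
    ∏-neg-geometric (suc n) Y = begin
      ∏ (suc n) (λ i → - (Q ^ i * Y))                         ≈⟨ ∏-snoc n _ ⟩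
      ∏ n (λ i → - (Q ^ i * Y)) * - (Q ^ n * Y)               ≈⟨ *-congʳ (∏-neg-geometric n Y) ⟩
      (- 1#) ^ n * (Q ^ tri n * Y ^ n) * - (Q ^ n * Y)        ≈⟨ solve 5 (λ s a b c y → s :* (a :* b) :* :- (c :* y) := :- (s :^ 0) :* s :* ((c :* a) :* (y :* b))) refl _ _ _ _ _ ⟩
      - 1# * (- 1#) ^ n * ((Q ^ n * Q ^ tri n) * (Y * Y ^ n)) ≈⟨ *-congˡ (*-congʳ (^-homo-* Q n (tri n))) ⟨
      (- 1#) ^ suc n * (Q ^ tri (suc n) * Y ^ suc n)          ∎

  -- Theta sums

  θ : Carrier → ℕ → ℕ → ℤ → Carrier
  θ x r r′ k = sgn k * x ^ expo r r′ k

  Θ : ℕ → Carrier → ℕ → ℕ → Carrier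
  Θ N x r r′ = ∑ℤ (ℤ.- + N) (N ℕ.+ N) (θ x r r′)

  ^-nilpotent : ∀ {x N} → x ^ N ≈ 0# → ∀ {n} → N ℕ.≤ n → x ^ n ≈ 0#
  ^-nilpotent {x} {N} x^N≈0 {n} N≤n = begin
    x ^ n                      ≈⟨ reflexive (cong (x ^_) (ℕ.m+[n∸m]≡n N≤n)) ⟨
    x ^ (N ℕ.+ (n ℕ.∸ N))      ≈⟨ ^-homo-* x N (n ℕ.∸ N) ⟩
    x ^ N * x ^ (n ℕ.∸ N)      ≈⟨ *-congʳ x^N≈0 ⟩
    0# * x ^ (n ℕ.∸ N)         ≈⟨ zeroˡ _ ⟩
    0#                         ∎

  θ-vanishes : ∀ {x N} → x ^ N ≈ 0# → ∀ r r′ → 1 ℕ.≤ r → 1 ℕ.≤ r′ → Vanishes N (θ x r r′)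
  θ-vanishes {x} {N} x^N≈0 r r′ 1≤r 1≤r′ k N≤k = trans
    (*-congˡ (^-nilpotent {x} x^N≈0 (ℕ.≤-trans N≤k (expo-≥ r r′ 1≤r 1≤r′ k)))) (zeroʳ _)

  θ-antisymmetric : ∀ x k → θ x 0 5 (+ 1 ℤ.- k) ≈ - θ x 0 5 k
  θ-antisymmetric x k = begin
    sgn (+ 1 ℤ.- k) * x ^ expo 0 5 (+ 1 ℤ.- k)   ≈⟨ *-cong (trans (sgn-suc (ℤ.- k)) (*-congˡ (sgn-neg k))) (reflexive (cong (x ^_) e≡)) ⟩
    - 1# * sgn k * x ^ expo 0 5 k                ≈⟨ solve 2 (λ s y → :- (s :^ 0) :* s :* y := :- (s :* y)) refl (sgn k) (x ^ expo 0 5 k) ⟩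
    - (sgn k * x ^ expo 0 5 k)                   ∎
    where
    lem : ∀ k → + 5 ℤ.* ((+ 1 ℤ.- k) ℤ.* (+ 1 ℤ.- k) ℤ.- (+ 1 ℤ.- k)) ℤ.+ + 2 ℤ.* (+ 0 ℤ.* (+ 1 ℤ.- k))
              ≡ + 5 ℤ.* (k ℤ.* k ℤ.- k) ℤ.+ + 2 ℤ.* (+ 0 ℤ.* k)
    lem = ℤ-solve
    e≡ : expo 0 5 (+ 1 ℤ.- k) ≡ expo 0 5 k
    e≡ = double-injective (≡.trans (expo-spec 0 5 ≡.refl (+ 1 ℤ.- k)) (≡.trans (lem k) (≡.sym (expo-spec 0 5 ≡.refl k))))

  -- The window runs from -K-1 to K, and only [1-K, K] is symmetric under k ↦ 1 - k. The two points
  -- -K-1 and -K are discarded by their size; since `expo-≥` excludes r = 0, the exponent is bounded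
  -- anew on the negative side.
  θ-cancels : ∀ {x N} → x ^ N ≈ 0# → ∀ K → N ℕ.≤ K → ∑ℤ (ℤ.- + suc K) (suc K ℕ.+ suc K) (θ x 0 5) ≈ 0#
  θ-cancels {x} {N} x^N≈0 K N≤K = begin
    ∑ (suc K ℕ.+ suc K) (λ i → θ x 0 5 (ℤ.- + suc K ℤ.+ + i))
      ≈⟨ reflexive (cong (λ l → ∑ (suc l) (λ i → θ x 0 5 (ℤ.- + suc K ℤ.+ + i))) (ℕ.+-suc K K)) ⟩
    θ x 0 5 (ℤ.- + suc K ℤ.+ + 0) + (θ x 0 5 (ℤ.- + suc K ℤ.+ + 1) + ∑ (K ℕ.+ K) (λ i → θ x 0 5 (ℤ.- + suc K ℤ.+ + (2 ℕ.+ i))))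
      ≈⟨ +-cong (small (suc K) (ℕ.m≤n⇒m≤1+n N≤K) (lem₀ (+ suc K))) (+-cong (small K N≤K (lem₁ (+ K)))
           (∑-cong (K ℕ.+ K) (λ i → reflexive (cong (θ x 0 5) (lem₂ (+ K) (+ i)))))) ⟩
    0# + (0# + ∑ℤ (+ 1 ℤ.- + K) (K ℕ.+ K) (θ x 0 5))
      ≈⟨ trans (+-identityˡ _) (+-identityˡ _) ⟩
    ∑ℤ (+ 1 ℤ.- + K) (K ℕ.+ K) (θ x 0 5)
      ≈⟨ ∑ℤ-antisymmetric K (θ x 0 5) (θ-antisymmetric x) ⟩
    0# ∎
    where
    lem₀ : ∀ K → ℤ.- K ℤ.+ + 0 ≡ ℤ.- K
    lem₀ = ℤ-solve
    lem₁ : ∀ K → ℤ.- (+ 1 ℤ.+ K) ℤ.+ + 1 ≡ ℤ.- K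
    lem₁ = ℤ-solve
    lem₂ : ∀ K i → ℤ.- (+ 1 ℤ.+ K) ℤ.+ (+ 2 ℤ.+ i) ≡ + 1 ℤ.- K ℤ.+ i
    lem₂ = ℤ-solve
    expo-neg : ∀ n → n ℕ.≤ expo 0 5 (ℤ.- + n)
    expo-neg zero    = ℕ.z≤n
    expo-neg (suc n) = ℕ.≤-trans (ℕ.m≤n*m (suc n) 5) (ℕ.m≤n+m (5 ℕ.* suc n) _)
    small : ∀ n → N ℕ.≤ n → ∀ {k} → k ≡ ℤ.- + n → θ x 0 5 k ≈ 0#
    small n N≤n ≡.refl = trans (*-congˡ (^-nilpotent {x} x^N≈0 (ℕ.≤-trans N≤n (expo-neg n)))) (zeroʳ _)

  -- Splitting a product of two theta sums along a sublattice of index 5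

  module Lattice (q : Carrier) (N : ℕ) (q^N≈0 : q ^ N ≈ 0#) where

    Q : Carrier
    Q = q ^ 5

    private
      M : ℕ
      M = suc N

      Q^N≈0 : Q ^ N ≈ 0#
      Q^N≈0 = trans (^-assocʳ q 5 N) (^-nilpotent {q} q^N≈0 (ℕ.m≤n*m N 5))

      θ₁ θ₂ : ℤ → Carrier
      θ₁ = θ q 1 4
      θ₂ = θ q 2 3

      -- The point (m , n) of ℤ² is written as m = t + 2s + r - 2 and n = 2t - s with 0 ≤ r < 5; in terms of
      -- n and t this reads m = pt r n t.
      pt : ℕ → ℤ → ℤ → ℤ
      pt r n t = (ℤ.- (+ 2 ℤ.* n) ℤ.- + 2) ℤ.+ (+ r ℤ.+ t ℤ.* + 5)

      -- The windows lose no nonzero term: with |t| ≤ M = N + 1 and |n| ≤ N, the coordinate s = 2t -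
      -- n satisfies |s| < 3 M.
      class : ℕ → Carrier
      class r = ∑ℤ (ℤ.- + M) (M ℕ.+ M) (λ t → ∑ℤ (ℤ.- + (3 ℕ.* M)) (3 ℕ.* M ℕ.+ 3 ℕ.* M)
                  (λ s → θ₂ (+ 2 ℤ.* t ℤ.- s) * θ₁ (pt r (+ 2 ℤ.* t ℤ.- s) t)))

      Vanishes-*ˡ : ∀ {K g} x → Vanishes K g → Vanishes K (λ k → x * g k)
      Vanishes-*ˡ x v k K≤k = trans (*-congˡ (v k K≤k)) (zeroʳ x)

      Vanishes-*ʳ : ∀ {K g} (x : ℤ → Carrier) → Vanishes K g → Vanishes K (λ k → g k * x k)
      Vanishes-*ʳ x v k K≤k = trans (*-congʳ (v k K≤k)) (zeroˡ (x k))

      -- For fixed n, translating m by -2n - 2 turns the coset index into the residue of the new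
      -- variable modulo 5. As n is bounded by N, the window [-5M, 5M) still covers [-N, N) after
      -- the translation.
      shear : ∀ i → i ℕ.< N ℕ.+ N → let n = ℤ.- + N ℤ.+ + i in
        ∑ℤ (ℤ.- + N) (N ℕ.+ N) (λ m → θ₂ n * θ₁ m) ≈ ∑ℤ (ℤ.- + M ℤ.* + 5) ((M ℕ.+ M) ℕ.* 5) (λ m → θ₂ n * θ₁ ((ℤ.- (+ 2 ℤ.* n) ℤ.- + 2) ℤ.+ m))
      shear i i<2N = sym (trans (∑ℤ-shift c (ℤ.- + M ℤ.* + 5) ((M ℕ.+ M) ℕ.* 5) (λ m → θ₂ n * θ₁ m))
        (∑ℤ-window N (λ m → θ₂ n * θ₁ m) (Vanishes-*ˡ (θ₂ n) (θ-vanishes {q} q^N≈0 1 4 (ℕ.s≤s ℕ.z≤n) (ℕ.s≤s ℕ.z≤n)))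
          (c ℤ.+ ℤ.- + M ℤ.* + 5) ((M ℕ.+ M) ℕ.* 5) (N ℕ.+ N ℕ.+ (i ℕ.+ i) ℕ.+ 7) (N ℕ.+ N ℕ.+ (d ℕ.+ d) ℕ.+ 3)
          (lower (+ N) (+ i)) (≡.trans (cong (λ x → c ℤ.+ ℤ.- + M ℤ.* + 5 ℤ.+ x) (ℤ.pos-* (M ℕ.+ M) 5))
            (≡.trans (upper (+ N) (+ i)) (cong (λ x → + N ℤ.+ (+ N ℤ.+ + N ℤ.+ (x ℤ.+ x) ℤ.+ + 3)) (≡.sym (pos-∸ (ℕ.<⇒≤ i<2N))))))))
        where
        n c : ℤ
        n = ℤ.- + N ℤ.+ + i
        c = ℤ.- (+ 2 ℤ.* n) ℤ.- + 2
        d : ℕ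
        d = (N ℕ.+ N) ℕ.∸ i
        lower : ∀ N i → ℤ.- N ≡ (ℤ.- (+ 2 ℤ.* (ℤ.- N ℤ.+ i)) ℤ.- + 2) ℤ.+ ℤ.- (+ 1 ℤ.+ N) ℤ.* + 5 ℤ.+ (N ℤ.+ N ℤ.+ (i ℤ.+ i) ℤ.+ + 7)
        lower = ℤ-solve
        upper : ∀ N i → (ℤ.- (+ 2 ℤ.* (ℤ.- N ℤ.+ i)) ℤ.- + 2) ℤ.+ ℤ.- (+ 1 ℤ.+ N) ℤ.* + 5 ℤ.+ ((+ 1 ℤ.+ N) ℤ.+ (+ 1 ℤ.+ N)) ℤ.* + 5
          ≡ N ℤ.+ (N ℤ.+ N ℤ.+ ((N ℤ.+ N ℤ.- i) ℤ.+ (N ℤ.+ N ℤ.- i)) ℤ.+ + 3)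
        upper = ℤ-solve

      turn : ∀ r i → i ℕ.< M ℕ.+ M → let t = ℤ.- + M ℤ.+ + i in
        ∑ℤ (ℤ.- + N) (N ℕ.+ N) (λ n → θ₂ n * θ₁ (pt r n t))
          ≈ ∑ℤ (ℤ.- + (3 ℕ.* M)) (3 ℕ.* M ℕ.+ 3 ℕ.* M) (λ s → θ₂ (+ 2 ℤ.* t ℤ.- s) * θ₁ (pt r (+ 2 ℤ.* t ℤ.- s) t))
      turn r i i<2M = sym (trans (∑ℤ-reflect (+ 2 ℤ.* t) (ℤ.- + (3 ℕ.* M)) (3 ℕ.* M ℕ.+ 3 ℕ.* M) (λ n → θ₂ n * θ₁ (pt r n t)))
        (∑ℤ-window N (λ n → θ₂ n * θ₁ (pt r n t))
          (Vanishes-*ʳ (λ n → θ₁ (pt r n t)) (θ-vanishes {q} q^N≈0 2 3 (ℕ.s≤s ℕ.z≤n) (ℕ.s≤s ℕ.z≤n)))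
          (+ 1 ℤ.+ + 2 ℤ.* t ℤ.- (ℤ.- + (3 ℕ.* M) ℤ.+ + (3 ℕ.* M ℕ.+ 3 ℕ.* M))) (3 ℕ.* M ℕ.+ 3 ℕ.* M) (d ℕ.+ d) (2 ℕ.+ (i ℕ.+ i))
          (≡.trans (lower (+ N) (+ i)) (cong₂ (λ x y → + 1 ℤ.+ + 2 ℤ.* t ℤ.- (ℤ.- x ℤ.+ (x ℤ.+ x)) ℤ.+ (y ℤ.+ y))
            (≡.sym (ℤ.pos-* 3 M)) (≡.sym (pos-∸ (ℕ.<⇒≤ i<2M)))))
          (≡.trans (cong (λ x → + 1 ℤ.+ + 2 ℤ.* t ℤ.- (ℤ.- x ℤ.+ (x ℤ.+ x)) ℤ.+ (x ℤ.+ x)) (ℤ.pos-* 3 M)) (upper (+ N) (+ i)))))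
        where
        t : ℤ
        t = ℤ.- + M ℤ.+ + i
        d : ℕ
        d = (M ℕ.+ M) ℕ.∸ i
        lower : ∀ N i → ℤ.- N ≡ + 1 ℤ.+ + 2 ℤ.* (ℤ.- (+ 1 ℤ.+ N) ℤ.+ i)
          ℤ.- (ℤ.- (+ 3 ℤ.* (+ 1 ℤ.+ N)) ℤ.+ (+ 3 ℤ.* (+ 1 ℤ.+ N) ℤ.+ + 3 ℤ.* (+ 1 ℤ.+ N)))
          ℤ.+ (((+ 1 ℤ.+ N) ℤ.+ (+ 1 ℤ.+ N) ℤ.- i) ℤ.+ ((+ 1 ℤ.+ N) ℤ.+ (+ 1 ℤ.+ N) ℤ.- i))
        lower = ℤ-solve
        upper : ∀ N i → + 1 ℤ.+ + 2 ℤ.* (ℤ.- (+ 1 ℤ.+ N) ℤ.+ i)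
          ℤ.- (ℤ.- (+ 3 ℤ.* (+ 1 ℤ.+ N)) ℤ.+ (+ 3 ℤ.* (+ 1 ℤ.+ N) ℤ.+ + 3 ℤ.* (+ 1 ℤ.+ N)))
          ℤ.+ (+ 3 ℤ.* (+ 1 ℤ.+ N) ℤ.+ + 3 ℤ.* (+ 1 ℤ.+ N)) ≡ N ℤ.+ (+ 2 ℤ.+ (i ℤ.+ i))
        upper = ℤ-solve

      dissect : Θ N q 1 4 * Θ N q 2 3 ≈ class 0 + class 1 + class 2 + class 3 + class 4
      dissect = begin
        Θ N q 1 4 * Θ N q 2 3
          ≈⟨ *-comm _ _ ⟩
        Θ N q 2 3 * Θ N q 1 4
          ≈⟨ ∑ℤ-* -N 2N -N 2N θ₂ θ₁ ⟨
        ∑ℤ -N 2N (λ n → ∑ℤ -N 2N (λ m → θ₂ n * θ₁ m))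
          ≈⟨ ∑-cong< 2N (λ i i<2N → trans (shear i i<2N) (let n = -N ℤ.+ + i in
               ∑ℤ-mod5 -M 2M (λ m → θ₂ n * θ₁ ((ℤ.- (+ 2 ℤ.* n) ℤ.- + 2) ℤ.+ m)))) ⟩
        ∑ℤ -N 2N (λ n → part 0 n + part 1 n + part 2 n + part 3 n + part 4 n)
          ≈⟨ trans (∑-+ 2N _ _) (+-congʳ (trans (∑-+ 2N _ _) (+-congʳ (trans (∑-+ 2N _ _) (+-congʳ (∑-+ 2N _ _)))))) ⟩
        ∑ℤ -N 2N (part 0) + ∑ℤ -N 2N (part 1) + ∑ℤ -N 2N (part 2) + ∑ℤ -N 2N (part 3) + ∑ℤ -N 2N (part 4)
          ≈⟨ +-cong (+-cong (+-cong (+-cong (rotate 0) (rotate 1)) (rotate 2)) (rotate 3)) (rotate 4) ⟩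
        class 0 + class 1 + class 2 + class 3 + class 4 ∎
        where
        -N -M : ℤ
        -N = ℤ.- + N
        -M = ℤ.- + M
        2N 2M : ℕ
        2N = N ℕ.+ N
        2M = M ℕ.+ M
        part : ℕ → ℤ → Carrier
        part r n = ∑ℤ -M 2M (λ t → θ₂ n * θ₁ (pt r n t))
        rotate : ∀ r → ∑ℤ -N 2N (part r) ≈ class r
        rotate r = trans (∑ℤ-swap -N 2N -M 2M (λ n t → θ₂ n * θ₁ (pt r n t))) (∑-cong< 2M (turn r))

      -- The two basis vectors are orthogonal of squared length 5, so the quadratic part m² + n² of
      -- the exponent becomes 5 (t² + s²) without a cross term, and the double sum splits. The
      -- affine maps `t′` and `s′` bring the linear parts into standard form; `c` and `ε` are the
      -- exponent and the sign left over.
      factor : ∀ r ρ₁ ρ₁′ ρ₂ ρ₂′ c ε (t′ s′ : ℤ → ℤ) → ρ₁ ℕ.+ ρ₁′ ≡ 5 → ρ₂ ℕ.+ ρ₂′ ≡ 5 →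
        (∀ t s → let n = + 2 ℤ.* t ℤ.- s in
          2expo 2 n ℤ.+ 2expo 1 (pt r n t) ≡ + 2 ℤ.* + c ℤ.+ + 5 ℤ.* (2expo ρ₁ (t′ t) ℤ.+ 2expo ρ₂ (s′ s))) →
        (∀ t s → sgn (+ r) * (sgn t * sgn s) ≈ ε * (sgn (t′ t) * sgn (s′ s))) →
        class r ≈ ε * q ^ c * (∑ℤ (ℤ.- + M) (M ℕ.+ M) (λ t → θ Q ρ₁ ρ₁′ (t′ t))
                             * ∑ℤ (ℤ.- + (3 ℕ.* M)) (3 ℕ.* M ℕ.+ 3 ℕ.* M) (λ s → θ Q ρ₂ ρ₂′ (s′ s)))
      factor r ρ₁ ρ₁′ ρ₂ ρ₂′ c ε t′ s′ ρ₁≡ ρ₂≡ exps signs = begin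
        class r
          ≈⟨ ∑ℤ-cong (ℤ.- + M) (M ℕ.+ M) (λ t → ∑ℤ-cong (ℤ.- + (3 ℕ.* M)) (3 ℕ.* M ℕ.+ 3 ℕ.* M) (term t)) ⟩
        ∑ℤ (ℤ.- + M) (M ℕ.+ M) (λ t → ∑ℤ (ℤ.- + (3 ℕ.* M)) (3 ℕ.* M ℕ.+ 3 ℕ.* M) (λ s → ε * q ^ c * θ Q ρ₁ ρ₁′ (t′ t) * θ Q ρ₂ ρ₂′ (s′ s)))
          ≈⟨ ∑ℤ-* (ℤ.- + M) (M ℕ.+ M) (ℤ.- + (3 ℕ.* M)) (3 ℕ.* M ℕ.+ 3 ℕ.* M) (λ t → ε * q ^ c * θ Q ρ₁ ρ₁′ (t′ t)) (λ s → θ Q ρ₂ ρ₂′ (s′ s)) ⟩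
        ∑ℤ (ℤ.- + M) (M ℕ.+ M) (λ t → ε * q ^ c * θ Q ρ₁ ρ₁′ (t′ t)) * ∑ℤ (ℤ.- + (3 ℕ.* M)) (3 ℕ.* M ℕ.+ 3 ℕ.* M) (λ s → θ Q ρ₂ ρ₂′ (s′ s))
          ≈⟨ trans (*-congʳ (sym (*-∑ (M ℕ.+ M) (ε * q ^ c) (λ i → θ Q ρ₁ ρ₁′ (t′ (ℤ.- + M ℤ.+ + i)))))) (*-assoc _ _ _) ⟩
        ε * q ^ c * (∑ℤ (ℤ.- + M) (M ℕ.+ M) (λ t → θ Q ρ₁ ρ₁′ (t′ t))
                    * ∑ℤ (ℤ.- + (3 ℕ.* M)) (3 ℕ.* M ℕ.+ 3 ℕ.* M) (λ s → θ Q ρ₂ ρ₂′ (s′ s))) ∎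
        where
        distrib₂ : ∀ x y → + 2 ℤ.* (x ℤ.+ y) ≡ + 2 ℤ.* x ℤ.+ + 2 ℤ.* y
        distrib₂ = ℤ-solve
        distrib₃ : ∀ c x y → + 2 ℤ.* (c ℤ.+ + 5 ℤ.* (x ℤ.+ y)) ≡ + 2 ℤ.* c ℤ.+ + 5 ℤ.* (+ 2 ℤ.* x ℤ.+ + 2 ℤ.* y)
        distrib₃ = ℤ-solve
        -- The sum n + m is r + t + s plus an even number. The even part is written as t - 1 twice,
        -- so that `sgn-square` removes it.
        parity : ∀ r t s → + 2 ℤ.* t ℤ.- s ℤ.+ ((ℤ.- (+ 2 ℤ.* (+ 2 ℤ.* t ℤ.- s)) ℤ.- + 2) ℤ.+ (r ℤ.+ t ℤ.* + 5))
          ≡ (t ℤ.- + 1) ℤ.+ ((t ℤ.- + 1) ℤ.+ (r ℤ.+ (t ℤ.+ s)))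
        parity = ℤ-solve
        term : ∀ t s → θ₂ (+ 2 ℤ.* t ℤ.- s) * θ₁ (pt r (+ 2 ℤ.* t ℤ.- s) t) ≈ ε * q ^ c * θ Q ρ₁ ρ₁′ (t′ t) * θ Q ρ₂ ρ₂′ (s′ s)
        term t s = begin
          sgn n * q ^ expo 2 3 n * (sgn m * q ^ expo 1 4 m)
            ≈⟨ solve 4 (λ a b c d → a :* b :* (c :* d) := (a :* c) :* (b :* d)) refl _ _ _ _ ⟩
          (sgn n * sgn m) * (q ^ expo 2 3 n * q ^ expo 1 4 m)
            ≈⟨ *-cong sign (trans (sym (^-homo-* q (expo 2 3 n) (expo 1 4 m))) (trans (reflexive (cong (q ^_) e≡)) power)) ⟩
          ε * (sgn (t′ t) * sgn (s′ s)) * (q ^ c * (Q ^ e₁ * Q ^ e₂))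
            ≈⟨ solve 6 (λ ε a b c d e → ε :* (a :* b) :* (c :* (d :* e)) := ε :* c :* (a :* d) :* (b :* e)) refl
                 ε (sgn (t′ t)) (sgn (s′ s)) (q ^ c) (Q ^ e₁) (Q ^ e₂) ⟩
          ε * q ^ c * θ Q ρ₁ ρ₁′ (t′ t) * θ Q ρ₂ ρ₂′ (s′ s) ∎
          where
          n m : ℤ
          n = + 2 ℤ.* t ℤ.- s
          m = pt r n t
          e₁ e₂ : ℕ
          e₁ = expo ρ₁ ρ₁′ (t′ t)
          e₂ = expo ρ₂ ρ₂′ (s′ s)
          e≡ : expo 2 3 n ℕ.+ expo 1 4 m ≡ c ℕ.+ 5 ℕ.* (e₁ ℕ.+ e₂)
          e≡ = double-injective (≡.trans (distrib₂ (+ expo 2 3 n) (+ expo 1 4 m))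
            (≡.trans (cong₂ ℤ._+_ (expo-spec 2 3 ≡.refl n) (expo-spec 1 4 ≡.refl m)) (≡.trans (exps t s)
            (≡.sym (≡.trans (cong (λ x → + 2 ℤ.* (+ c ℤ.+ x)) (ℤ.pos-* 5 (e₁ ℕ.+ e₂)))
              (≡.trans (distrib₃ (+ c) (+ e₁) (+ e₂)) (cong₂ (λ x y → + 2 ℤ.* + c ℤ.+ + 5 ℤ.* (x ℤ.+ y))
                (expo-spec ρ₁ ρ₁′ ρ₁≡ (t′ t)) (expo-spec ρ₂ ρ₂′ ρ₂≡ (s′ s)))))))))
          power : q ^ (c ℕ.+ 5 ℕ.* (e₁ ℕ.+ e₂)) ≈ q ^ c * (Q ^ e₁ * Q ^ e₂)
          power = trans (^-homo-* q c (5 ℕ.* (e₁ ℕ.+ e₂)))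
            (*-congˡ (trans (sym (^-assocʳ q 5 (e₁ ℕ.+ e₂))) (^-homo-* Q e₁ e₂)))
          sign : sgn n * sgn m ≈ ε * (sgn (t′ t) * sgn (s′ s))
          sign = begin
            sgn n * sgn m                                  ≈⟨ sgn-+ n m ⟨
            sgn (n ℤ.+ m)                                  ≈⟨ reflexive (cong sgn (parity (+ r) t s)) ⟩
            sgn ((t ℤ.- + 1) ℤ.+ ((t ℤ.- + 1) ℤ.+ (+ r ℤ.+ (t ℤ.+ s))))
              ≈⟨ trans (sgn-+ (t ℤ.- + 1) _) (*-congˡ (sgn-+ (t ℤ.- + 1) _)) ⟩
            sgn (t ℤ.- + 1) * (sgn (t ℤ.- + 1) * sgn (+ r ℤ.+ (t ℤ.+ s)))
              ≈⟨ trans (sym (*-assoc _ _ _)) (trans (*-congʳ (sgn-square (t ℤ.- + 1))) (*-identityˡ _)) ⟩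
            sgn (+ r ℤ.+ (t ℤ.+ s))                        ≈⟨ trans (sgn-+ (+ r) (t ℤ.+ s)) (*-congˡ (sgn-+ t s)) ⟩
            sgn (+ r) * (sgn t * sgn s)                    ≈⟨ signs t s ⟩
            ε * (sgn (t′ t) * sgn (s′ s))                  ∎

      -- Translation by 1 and reflection both move the half-open window one place to the right,
      -- which the slack `suc d` beyond N absorbs.
      module Windows (g : ℤ → Carrier) (van : Vanishes N g) (d : ℕ) where
        private
          K : ℕ
          K = N ℕ.+ suc d
          van-window = ∑ℤ-window N g van
          l₁ : ∀ N d → ℤ.- N ≡ ℤ.- (N ℤ.+ d) ℤ.+ d
          l₁ = ℤ-solve
          l₂ : ∀ N d → ℤ.- (N ℤ.+ d) ℤ.+ ((N ℤ.+ d) ℤ.+ (N ℤ.+ d)) ≡ N ℤ.+ d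
          l₂ = ℤ-solve
          l₃ : ∀ N d → ℤ.- N ≡ + 1 ℤ.+ ℤ.- (N ℤ.+ (+ 1 ℤ.+ d)) ℤ.+ d
          l₃ = ℤ-solve
          l₄ : ∀ N d → + 1 ℤ.+ ℤ.- (N ℤ.+ d) ℤ.+ ((N ℤ.+ d) ℤ.+ (N ℤ.+ d)) ≡ N ℤ.+ (+ 1 ℤ.+ d)
          l₄ = ℤ-solve
          l₅ : ∀ K → + 1 ℤ.+ + 0 ℤ.- (ℤ.- K ℤ.+ (K ℤ.+ K)) ≡ + 1 ℤ.+ ℤ.- K
          l₅ = ℤ-solve

        identity : ∑ℤ (ℤ.- + K) (K ℕ.+ K) g ≈ ∑ℤ (ℤ.- + N) (N ℕ.+ N) g
        identity = van-window (ℤ.- + K) (K ℕ.+ K) (suc d) (suc d) (l₁ (+ N) (+ suc d)) (l₂ (+ N) (+ suc d))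

        shift : ∑ℤ (ℤ.- + K) (K ℕ.+ K) (λ k → g (+ 1 ℤ.+ k)) ≈ ∑ℤ (ℤ.- + N) (N ℕ.+ N) g
        shift = trans (∑ℤ-shift (+ 1) (ℤ.- + K) (K ℕ.+ K) g)
          (van-window (+ 1 ℤ.+ ℤ.- + K) (K ℕ.+ K) d (2 ℕ.+ d) (l₃ (+ N) (+ d)) (l₄ (+ N) (+ suc d)))

        negate : ∑ℤ (ℤ.- + K) (K ℕ.+ K) (λ k → g (+ 0 ℤ.- k)) ≈ ∑ℤ (ℤ.- + N) (N ℕ.+ N) g
        negate = trans (∑ℤ-reflect (+ 0) (ℤ.- + K) (K ℕ.+ K) g)
          (trans (reflexive (cong (λ l → ∑ℤ l (K ℕ.+ K) g) (l₅ (+ K))))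
          (van-window (+ 1 ℤ.+ ℤ.- + K) (K ℕ.+ K) d (2 ℕ.+ d) (l₃ (+ N) (+ d)) (l₄ (+ N) (+ suc d))))

      module P = ℤ.+-*-Solver

      E : ∀ {n} → ℕ → P.Polynomial n → P.Polynomial n
      E r k = P.con (+ 5) P.:* (k P.:* k P.:- k) P.:+ P.con (+ 2) P.:* (P.con (+ r) P.:* k)

      LHS : ∀ {n} → ℕ → (t s : P.Polynomial n) → P.Polynomial n
      LHS r t s = E 2 n P.:+ E 1 ((P.:- (P.con (+ 2) P.:* n) P.:- P.con (+ 2)) P.:+ (P.con (+ r) P.:+ t P.:* P.con (+ 5)))
        where n = P.con (+ 2) P.:* t P.:- s

      RHS : ∀ {n} → ℕ → ℕ → ℕ → (t s : P.Polynomial n) → P.Polynomial n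
      RHS c ρ₁ ρ₂ t s = P.con (+ 2) P.:* P.con (+ c) P.:+ P.con (+ 5) P.:* (E ρ₁ t P.:+ E ρ₂ s)

      sgn-1- : ∀ k → sgn (+ 1 ℤ.- k) ≈ - 1# * sgn k
      sgn-1- k = trans (sgn-suc (ℤ.- k)) (*-congˡ (sgn-neg k))

      sgn-0- : ∀ k → sgn (+ 0 ℤ.- k) ≈ sgn k
      sgn-0- k = trans (reflexive (cong sgn (ℤ.+-identityˡ (ℤ.- k)))) (sgn-neg k)

      M≡ : M ≡ N ℕ.+ 1
      M≡ = ℕ.+-comm 1 N

      3M≡ : 3 ℕ.* M ≡ N ℕ.+ suc (2 ℕ.* M)
      3M≡ = ≡.sym (ℕ.+-suc N (2 ℕ.* M))

      θ-window : ∀ r r′ → 1 ℕ.≤ r → 1 ℕ.≤ r′ → ∀ {K d} → K ≡ N ℕ.+ suc d →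
        ∑ℤ (ℤ.- + K) (K ℕ.+ K) (θ Q r r′) ≈ Θ N Q r r′
      θ-window r r′ p p′ {d = d} ≡.refl = Windows.identity (θ Q r r′) (θ-vanishes {Q} Q^N≈0 r r′ p p′) d

      θ-window-shift : ∀ r r′ → 1 ℕ.≤ r → 1 ℕ.≤ r′ → ∀ {K d} → K ≡ N ℕ.+ suc d →
        ∑ℤ (ℤ.- + K) (K ℕ.+ K) (λ k → θ Q r r′ (+ 1 ℤ.+ k)) ≈ Θ N Q r r′
      θ-window-shift r r′ p p′ {d = d} ≡.refl = Windows.shift (θ Q r r′) (θ-vanishes {Q} Q^N≈0 r r′ p p′) d

      θ-window-negate : ∀ r r′ → 1 ℕ.≤ r → 1 ℕ.≤ r′ → ∀ {K d} → K ≡ N ℕ.+ suc d →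
        ∑ℤ (ℤ.- + K) (K ℕ.+ K) (λ k → θ Q r r′ (+ 0 ℤ.- k)) ≈ Θ N Q r r′
      θ-window-negate r r′ p p′ {d = d} ≡.refl = Windows.negate (θ Q r r′) (θ-vanishes {Q} Q^N≈0 r r′ p p′) d

      1≤ : ∀ {n} → 1 ℕ.≤ suc n
      1≤ = ℕ.s≤s ℕ.z≤n

      -- The theta sum with r = 0, antisymmetric about 1/2, occurs here in the variable t; in
      -- `class₁` it occurs in s.
      class₀ : class 0 ≈ 0#
      class₀ = trans (factor 0 0 5 2 3 3 (- 1#) id (λ s → + 1 ℤ.- s) ≡.refl ≡.refl
        (P.solve 2 (λ t s → LHS 0 t s P.:= RHS 3 0 2 t (P.con (+ 1) P.:- s)) ≡.refl)
        (λ t s → trans (solve 2 (λ x y → x :^ 0 :* (x :* y) := :- (x :^ 0) :* (x :* (:- (x :^ 0) :* y))) refl (sgn t) (sgn s))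
          (*-congˡ (*-congˡ (sym (sgn-1- s))))))
        (trans (*-congˡ (trans (*-congʳ (θ-cancels {Q} Q^N≈0 N ℕ.≤-refl)) (zeroˡ _))) (zeroʳ _))

      class₁ : class 1 ≈ 0#
      class₁ = trans (factor 1 1 4 0 5 4 (- 1#) id id ≡.refl ≡.refl
        (P.solve 2 (λ t s → LHS 1 t s P.:= RHS 4 1 0 t s) ≡.refl)
        (λ t s → *-congʳ (*-identityʳ (- 1#))))
        (trans (*-congˡ (trans (*-congˡ (θ-cancels {Q} Q^N≈0 (N ℕ.+ 2 ℕ.* M) (ℕ.m≤m+n N _))) (zeroʳ _))) (zeroʳ _))

      class₂ : class 2 ≈ Θ N Q 2 3 * Θ N Q 2 3
      class₂ = trans (factor 2 2 3 2 3 0 1# id id ≡.refl ≡.refl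
        (P.solve 2 (λ t s → LHS 2 t s P.:= RHS 0 2 2 t s) ≡.refl)
        (λ t s → solve 1 (λ x → (:- (x :^ 0)) :* (:- (x :^ 0) :* x :^ 0) :* x := x :^ 0 :* x) refl (sgn t * sgn s)))
        (trans (*-cong (*-identityˡ 1#) (*-cong (θ-window 2 3 1≤ 1≤ M≡) (θ-window 2 3 1≤ 1≤ 3M≡))) (*-identityˡ _))

      class₃ : class 3 ≈ - (q * (Θ N Q 1 4 * Θ N Q 2 3))
      class₃ = trans (factor 3 2 3 1 4 1 (- 1#) (λ t → + 0 ℤ.- t) (λ s → + 0 ℤ.- s) ≡.refl ≡.refl
        (P.solve 2 (λ t s → LHS 3 t s P.:= RHS 1 2 1 (P.con (+ 0) P.:- t) (P.con (+ 0) P.:- s)) ≡.refl)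
        (λ t s → trans (solve 1 (λ x → (:- (x :^ 0)) :* (:- (x :^ 0) :* (:- (x :^ 0) :* x :^ 0)) :* x := :- (x :^ 0) :* x) refl (sgn t * sgn s))
          (*-congˡ (*-cong (sym (sgn-0- t)) (sym (sgn-0- s))))))
        (trans (*-congˡ (*-cong (θ-window-negate 2 3 1≤ 1≤ M≡) (θ-window-negate 1 4 1≤ 1≤ 3M≡)))
          (solve 3 (λ q x y → :- (q :^ 0) :* (q :^ 1) :* (x :* y) := :- (q :* (y :* x))) refl q _ _))

      class₄ : class 4 ≈ - (q ^ 2 * (Θ N Q 1 4 * Θ N Q 1 4))
      class₄ = trans (factor 4 1 4 1 4 2 (- 1#) (λ t → + 0 ℤ.- t) (λ s → + 1 ℤ.+ s) ≡.refl ≡.refl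
        (P.solve 2 (λ t s → LHS 4 t s P.:= RHS 2 1 1 (P.con (+ 0) P.:- t) (P.con (+ 1) P.:+ s)) ≡.refl)
        (λ t s → trans (solve 2 (λ x y → (:- (x :^ 0)) :^ 4 :* (x :* y) := :- (x :^ 0) :* (x :* (:- (x :^ 0) :* y))) refl (sgn t) (sgn s))
          (*-congˡ (*-cong (sym (sgn-0- t)) (sym (sgn-suc s))))))
        (trans (*-congˡ (*-cong (θ-window-negate 1 4 1≤ 1≤ M≡) (θ-window-shift 1 4 1≤ 1≤ 3M≡)))
          (solve 2 (λ q x → :- (q :^ 0) :* (q :^ 2) :* (x :* x) := :- (q :^ 2 :* (x :* x))) refl q _))

    Θ-quadratic : Θ N q 1 4 * Θ N q 2 3
      ≈ Θ N Q 2 3 * Θ N Q 2 3 - q * (Θ N Q 1 4 * Θ N Q 2 3) - q ^ 2 * (Θ N Q 1 4 * Θ N Q 1 4)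
    Θ-quadratic = trans dissect (+-cong (+-cong (trans (+-cong (trans (+-cong class₀ class₁) (+-identityˡ 0#)) class₂) (+-identityˡ _)) class₃) class₄)

  -- Identities for bounding a product of factors 1 - x and its inverse

  module _ {x i : Carrier} (i-inverse : i * (1# - x) ≈ 1#) where

    divide-unfold : ∀ g → g * i ≈ g + x * (g * i)
    divide-unfold g = begin
      g * i                          ≈⟨ solve 3 (λ g i x → g :* i := g :* (i :* (x :^ 0 :- x)) :+ x :* (g :* i)) refl g i x ⟩
      g * (i * (1# - x)) + x * (g * i) ≈⟨ +-congʳ (trans (*-congˡ i-inverse) (*-identityʳ g)) ⟩
      g + x * (g * i)                ∎

    divide-inverse : ∀ {f g} → g * f ≈ 1# → (g * i) * (f * (1# - x)) ≈ 1#
    divide-inverse {f} {g} gf≈1 = begin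
      (g * i) * (f * (1# - x))   ≈⟨ solve 4 (λ g i f y → (g :* i) :* (f :* y) := (g :* f) :* (i :* y)) refl g i f (1# - x) ⟩
      (g * f) * (i * (1# - x))   ≈⟨ *-cong gf≈1 i-inverse ⟩
      1# * 1#                    ≈⟨ *-identityˡ 1# ⟩
      1#                         ∎

    -- Replacing (f, g) by (f (1 - x), g / (1 - x)) feeds x times the old sum g + f into the new
    -- difference, and `divide-plus` feeds the old difference into the new sum. Nonnegativity of the
    -- two therefore has to be carried through an induction together.
    divide-minus : ∀ f g → (g - f) + x * ((g + f) + x * (g * i)) ≈ g * i - f * (1# - x)
    divide-minus f g = sym (begin
      g * i - f * (1# - x)                            ≈⟨ +-congʳ (divide-unfold g) ⟩
      g + x * (g * i) - f * (1# - x)                  ≈⟨ +-congʳ (+-congˡ (*-congˡ (divide-unfold g))) ⟩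
      g + x * (g + x * (g * i)) - f * (1# - x)        ≈⟨ solve 4 (λ g h f x → g :+ x :* (g :+ x :* h) :- f :* (x :^ 0 :- x) := (g :- f) :+ x :* ((g :+ f) :+ x :* h)) refl g (g * i) f x ⟩
      (g - f) + x * ((g + f) + x * (g * i))           ∎)

    divide-plus : ∀ f g → (g + f) + x * ((g - f) + x * (g * i)) ≈ g * i + f * (1# - x)
    divide-plus f g = sym (begin
      g * i + f * (1# - x)                            ≈⟨ +-congʳ (divide-unfold g) ⟩
      g + x * (g * i) + f * (1# - x)                  ≈⟨ +-congʳ (+-congˡ (*-congˡ (divide-unfold g))) ⟩
      g + x * (g + x * (g * i)) + f * (1# - x)        ≈⟨ solve 4 (λ g h f x → g :+ x :* (g :+ x :* h) :+ f :* (x :^ 0 :- x) := (g :+ f) :+ x :* ((g :- f) :+ x :* h)) refl g (g * i) f x ⟩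
      (g + f) + x * ((g - f) + x * (g * i))           ∎)

    divide-lower : ∀ g v → (g - v) + x * (g * i) ≈ g * i - v
    divide-lower g v = sym (trans (+-congʳ (divide-unfold g))
      (solve 3 (λ g h v → g :+ h :- v := (g :- v) :+ h) refl g (x * (g * i)) v))

    -- Written so that each summand on the left is visibly nonnegative once u, x, g / (1 - x), g - f
    -- and the old bound are.
    divide-bound : ∀ f g u → (u * g - (1# - f)) + (x * (u * (g * i)) + x * ((g - f) + x * (g * i))) ≈ (u + x) * (g * i) - (1# - f * (1# - x))
    divide-bound f g u = sym (begin
      (u + x) * (g * i) - (1# - f * (1# - x))                ≈⟨ +-congʳ (*-congˡ (divide-unfold g)) ⟩
      (u + x) * (g + x * (g * i)) - (1# - f * (1# - x))      ≈⟨ solve 5 (λ u x g h f → (u :+ x) :* (g :+ x :* h) :- (x :^ 0 :- f :* (x :^ 0 :- x))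
                                                                  := (u :* g :- (x :^ 0 :- f)) :+ (x :* (u :* h) :+ x :* ((g :- f) :+ x :* h))) refl u x g (g * i) f ⟩
      (u * g - (1# - f)) + (x * (u * (g * i)) + x * ((g - f) + x * (g * i))) ∎)

  skip-bound : ∀ f g u x → (u * g - (1# - f)) + x * g ≈ (u + x) * g - (1# - f)
  skip-bound = solve 4 (λ f g u x → (u :* g :- (x :^ 0 :- f)) :+ x :* g := (u :+ x) :* g :- (x :^ 0 :- f)) refl

  start-minus : 1# - 1# ≈ κ (+ 0)
  start-minus = solve 0 (con (+ 1) :^ 0 :- con (+ 1) :^ 0 := con (+ 0)) refl

  start-bound : κ (+ 0) * 1# - (1# - 1#) ≈ κ (+ 0)
  start-bound = solve 0 (con (+ 0) :* (con (+ 1) :^ 0) :- (con (+ 1) :^ 0 :- con (+ 1) :^ 0) := con (+ 0)) refl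

  module _ {o q : Carrier} (o-unfold : o ≈ 1# + q * o) where

    private
      twice : o ≈ 1# + q * (1# + q * o)
      twice = trans o-unfold (+-congˡ (*-congˡ o-unfold))

    geometric-inverse : o * (1# - q) ≈ 1#
    geometric-inverse = begin
      o * (1# - q)                 ≈⟨ solve 2 (λ o q → o :* (q :^ 0 :- q) := o :- q :* o) refl o q ⟩
      o - q * o                    ≈⟨ +-congʳ o-unfold ⟩
      1# + q * o - q * o           ≈⟨ solve 2 (λ q y → q :^ 0 :+ y :- y := q :^ 0) refl q (q * o) ⟩
      1#                           ∎

    geometric-minus : q * o + q ≈ o - (1# - q)
    geometric-minus = sym (trans (+-congʳ o-unfold) (solve 2 (λ o q → q :^ 0 :+ q :* o :- (q :^ 0 :- q) := q :* o :+ q) refl o q))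

    geometric-plus : 1# + 1# + q * (q * o) ≈ o + (1# - q)
    geometric-plus = sym (trans (+-congʳ twice) (solve 2 (λ o q → q :^ 0 :+ q :* (q :^ 0 :+ q :* o) :+ (q :^ 0 :- q) := q :^ 0 :+ q :^ 0 :+ q :* (q :* o)) refl o q))

    geometric-bound : q * (q * o) ≈ (κ (+ 0) + q ^ 1) * o - (1# - (1# - q))
    geometric-bound = sym (begin
      (κ (+ 0) + q ^ 1) * o - (1# - (1# - q))    ≈⟨ solve 2 (λ o q → (con (+ 0) :+ q :^ 1) :* o :- (q :^ 0 :- (q :^ 0 :- q)) := q :* o :- q) refl o q ⟩
      q * o - q                                  ≈⟨ +-congʳ (*-congˡ o-unfold) ⟩
      q * (1# + q * o) - q                       ≈⟨ solve 2 (λ o q → q :* (q :^ 0 :+ q :* o) :- q := q :* (q :* o)) refl o q ⟩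
      q * (q * o)                                ∎)

    tail-unfold : ∀ u x → u + x * o ≈ (u + x) + q * x * o
    tail-unfold u x = trans (+-congˡ (*-congˡ o-unfold)) (solve 4 (λ u x q o → u :+ x :* (x :^ 0 :+ q :* o) := (u :+ x) :+ q :* x :* o) refl u x q o)

  square-bound : ∀ q o a f → q * ((a - o) * a) + (q * o * a - (1# - f)) ≈ q * (a * a) - (1# - f)
  square-bound = solve 4 (λ q o a f → q :* ((a :- o) :* a) :+ (q :* o :* a :- (q :^ 0 :- f)) := q :* (a :* a) :- (q :^ 0 :- f)) refl

  -- This distributes the eight copies of q a⁵ b⁷. Replacing 1 - α by its bound q a² costs q a² b,
  -- which one copy pays because a³ b⁶ ≥ 1 coefficientwise; one copy joins b to give strict
  -- positivity; six remain.
  first-component : ∀ a b α q →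
    (b + q * (a ^ 5 * b ^ 7)) + (b * (q * (a * a) - (1# - α)) + (κ (+ 6) * (q * (a ^ 5 * b ^ 7))
      + (q * (a * a * b * (a ^ 3 * b ^ 6 - 1#)) + q ^ 2 * b ^ 12)))
    ≈ b * α + κ (+ 8) * (q * (a ^ 5 * b ^ 7)) + q ^ 2 * b ^ 12
  first-component = solve 4 (λ a b α q →
    (b :+ q :* (a :^ 5 :* b :^ 7)) :+ (b :* (q :* (a :* a) :- (q :^ 0 :- α)) :+ (con (+ 6) :* (q :* (a :^ 5 :* b :^ 7))
      :+ (q :* (a :* a :* b :* (a :^ 3 :* b :^ 6 :- q :^ 0)) :+ q :^ 2 :* b :^ 12)))
    := b :* α :+ con (+ 8) :* (q :* (a :^ 5 :* b :^ 7)) :+ q :^ 2 :* b :^ 12) refl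

  quotient-relation : ∀ {r β α r′ β′ α′ i} → r * β ≈ α → r′ * β′ ≈ α′ → i * r′ ≈ 1# → β ^ 5 * α′ * (r ^ 5 * i) ≈ α ^ 5 * β′
  quotient-relation {r} {β} {α} {r′} {β′} {α′} {i} rβ r′β′ ir′ = begin
    β ^ 5 * α′ * (r ^ 5 * i)             ≈⟨ solve 4 (λ r β α′ i → β :^ 5 :* α′ :* (r :^ 5 :* i) := (r :* β) :^ 5 :* (i :* α′)) refl r β α′ i ⟩
    (r * β) ^ 5 * (i * α′)               ≈⟨ *-cong (^-congˡ 5 rβ) (*-congˡ (sym r′β′)) ⟩
    α ^ 5 * (i * (r′ * β′))              ≈⟨ *-congˡ (trans (sym (*-assoc i r′ β′)) (trans (*-congʳ ir′) (*-identityˡ β′))) ⟩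
    α ^ 5 * β′                           ∎

-- The ring of power series

tl : Series → Series
tl f n = f (suc n)

infixl 6 _⊞_
_⊞_ : Series → Series → Series
(f ⊞ g) n = f n ℤ.+ g n

⊟_ : Series → Series
(⊟ f) n = ℤ.- f n

infixr 7 _·_
_·_ : ℤ → Series → Series
(c · f) n = c ℤ.* f n

κ : ℤ → Series
κ c zero    = c
κ c (suc _) = + 0

⊛-suc : ∀ f g n → (f ⊛ g) (suc n) ≡ f 0 ℤ.* g (suc n) ℤ.+ (tl f ⊛ g) n
⊛-suc f g n = cong (λ l → f 0 ℤ.* g (suc n) ℤ.+ sumℤ l) (≡.trans
  (map-applyUpTo suc (λ i → f i ℤ.* g (suc n ℕ.∸ i)) (suc n))
  (≡.sym (map-applyUpTo id (λ i → f (suc i) ℤ.* g (n ℕ.∸ i)) (suc n))))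

⊛-zero : ∀ f g → (f ⊛ g) 0 ≡ f 0 ℤ.* g 0
⊛-zero f g = ℤ.+-identityʳ _

record _≈_ (f g : Series) : Set where
  constructor mk≈
  field at : ∀ n → f n ≡ g n
open _≈_ public

infix 4 _≈_

-- The bounds on the indices are there because the same fact makes congruence modulo q^N compatible
-- with products.
⊛-cong≤ : ∀ n {f f′ g g′ : Series} → (∀ i → i ℕ.≤ n → f i ≡ f′ i) → (∀ i → i ℕ.≤ n → g i ≡ g′ i) →
          (f ⊛ g) n ≡ (f′ ⊛ g′) n
⊛-cong≤ zero {f} {f′} {g} {g′} p r rewrite ⊛-zero f g | ⊛-zero f′ g′ = cong₂ ℤ._*_ (p 0 ℕ.≤-refl) (r 0 ℕ.≤-refl)
⊛-cong≤ (suc n) {f} {f′} {g} {g′} p r rewrite ⊛-suc f g n | ⊛-suc f′ g′ n =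
  cong₂ ℤ._+_ (cong₂ ℤ._*_ (p 0 ℕ.z≤n) (r (suc n) ℕ.≤-refl))
    (⊛-cong≤ n (λ i i≤n → p (suc i) (ℕ.s≤s i≤n)) (λ i i≤n → r i (ℕ.m≤n⇒m≤1+n i≤n)))

⊛-cong : ∀ {f f′ g g′} → f ≈ f′ → g ≈ g′ → (f ⊛ g) ≈ (f′ ⊛ g′)
⊛-cong p r .at n = ⊛-cong≤ n (λ i _ → p .at i) (λ i _ → r .at i)

⊛-distribʳ : ∀ n f g h → ((f ⊞ g) ⊛ h) n ≡ (f ⊛ h) n ℤ.+ (g ⊛ h) n
⊛-distribʳ zero f g h rewrite ⊛-zero (f ⊞ g) h | ⊛-zero f h | ⊛-zero g h = ℤ.*-distribʳ-+ (h 0) (f 0) (g 0)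
⊛-distribʳ (suc n) f g h rewrite ⊛-suc (f ⊞ g) h n | ⊛-suc f h n | ⊛-suc g h n | ⊛-distribʳ n (tl f) (tl g) h =
  lem (f 0) (g 0) (h (suc n)) _ _
  where
  lem : ∀ a b c d e → (a ℤ.+ b) ℤ.* c ℤ.+ (d ℤ.+ e) ≡ (a ℤ.* c ℤ.+ d) ℤ.+ (b ℤ.* c ℤ.+ e)
  lem = ℤ-solve

⊛-scale : ∀ n c f g → ((c · f) ⊛ g) n ≡ c ℤ.* (f ⊛ g) n
⊛-scale zero c f g rewrite ⊛-zero (c · f) g | ⊛-zero f g = ℤ.*-assoc c (f 0) (g 0)
⊛-scale (suc n) c f g rewrite ⊛-suc (c · f) g n | ⊛-suc f g n | ⊛-scale n c (tl f) g =
  lem c (f 0) (g (suc n)) _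
  where
  lem : ∀ a b c d → a ℤ.* b ℤ.* c ℤ.+ a ℤ.* d ≡ a ℤ.* (b ℤ.* c ℤ.+ d)
  lem = ℤ-solve

⊛-sucʳ : ∀ n f g → (f ⊛ g) (suc n) ≡ f (suc n) ℤ.* g 0 ℤ.+ (f ⊛ tl g) n
⊛-sucʳ zero f g rewrite ⊛-suc f g 0 | ⊛-zero (tl f) g | ⊛-zero f (tl g) = ℤ.+-comm (f 0 ℤ.* g 1) _
⊛-sucʳ (suc n) f g rewrite ⊛-suc f g (suc n) | ⊛-sucʳ n (tl f) g | ⊛-suc f (tl g) n =
  lem (f 0 ℤ.* g (2 ℕ.+ n)) (f (2 ℕ.+ n) ℤ.* g 0) _
  where
  lem : ∀ a b c → a ℤ.+ (b ℤ.+ c) ≡ b ℤ.+ (a ℤ.+ c)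
  lem = ℤ-solve

⊛-comm : ∀ n f g → (f ⊛ g) n ≡ (g ⊛ f) n
⊛-comm zero f g rewrite ⊛-zero f g | ⊛-zero g f = ℤ.*-comm (f 0) (g 0)
⊛-comm (suc n) f g rewrite ⊛-suc f g n | ⊛-sucʳ n g f | ⊛-comm n (tl f) g =
  cong (ℤ._+ (g ⊛ tl f) n) (ℤ.*-comm (f 0) (g (suc n)))

⊛-assoc : ∀ n f g h → ((f ⊛ g) ⊛ h) n ≡ (f ⊛ (g ⊛ h)) n
⊛-assoc zero f g h
  rewrite ⊛-zero (f ⊛ g) h | ⊛-zero f (g ⊛ h) | ⊛-zero f g | ⊛-zero g h = ℤ.*-assoc (f 0) (g 0) (h 0)
⊛-assoc (suc n) f g h
  rewrite ⊛-suc (f ⊛ g) h n | ⊛-suc f (g ⊛ h) n | ⊛-zero f g | ⊛-suc g h n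
        | ⊛-cong {tl (f ⊛ g)} {(f 0 · tl g) ⊞ (tl f ⊛ g)} {h} {h} (mk≈ (⊛-suc f g)) (mk≈ λ _ → ≡.refl) .at n
        | ⊛-distribʳ n (f 0 · tl g) (tl f ⊛ g) h | ⊛-scale n (f 0) (tl g) h | ⊛-assoc n (tl f) g h =
  lem (f 0) (g 0) (h (suc n)) _ _
  where
  lem : ∀ a b c d e → a ℤ.* b ℤ.* c ℤ.+ (a ℤ.* d ℤ.+ e) ≡ a ℤ.* (b ℤ.* c ℤ.+ d) ℤ.+ e
  lem = ℤ-solve

⊛-zeroˡ : ∀ n g → (κ (+ 0) ⊛ g) n ≡ + 0
⊛-zeroˡ zero g = ≡.refl
⊛-zeroˡ (suc n) g rewrite ⊛-suc (κ (+ 0)) g n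
  | ⊛-cong {tl (κ (+ 0))} {κ (+ 0)} {g} {g} (mk≈ λ { zero → ≡.refl ; (suc _) → ≡.refl }) (mk≈ λ _ → ≡.refl) .at n = 
  ≡.trans (ℤ.+-identityˡ _) (⊛-zeroˡ n g)

κ-⊛ : ∀ c g → (κ c ⊛ g) ≈ (c · g)
κ-⊛ c g .at zero = ⊛-zero (κ c) g
κ-⊛ c g .at (suc n) rewrite ⊛-suc (κ c) g n
  | ⊛-cong {tl (κ c)} {κ (+ 0)} {g} {g} (mk≈ λ { zero → ≡.refl ; (suc _) → ≡.refl }) (mk≈ λ _ → ≡.refl) .at n
  | ⊛-zeroˡ n g = ℤ.+-identityʳ _

one≈κ1 : one ≈ κ (+ 1)
one≈κ1 .at zero = ≡.refl
one≈κ1 .at (suc n) = ≡.refl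

⊛-identityˡ : ∀ f → (one ⊛ f) ≈ f
⊛-identityˡ f .at n = ≡.trans (⊛-cong {g = f} one≈κ1 (mk≈ λ _ → ≡.refl) .at n)
  (≡.trans (κ-⊛ (+ 1) f .at n) (ℤ.*-identityˡ (f n)))

-- Opaque copies of the operations, so that the arguments of a product can be inferred.
infixl 6 _+ˢ_
infixl 7 _*ˢ_
infix  8 -ˢ_
opaque
  _+ˢ_ _*ˢ_ : Series → Series → Series
  _+ˢ_ = _⊞_
  _*ˢ_ = _⊛_

  -ˢ_ : Series → Series
  -ˢ_ = ⊟_

  +ˢ-at : ∀ f g n → (f +ˢ g) n ≡ f n ℤ.+ g n
  +ˢ-at f g n = ≡.refl

  -ˢ-at : ∀ f n → (-ˢ f) n ≡ ℤ.- f n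
  -ˢ-at f n = ≡.refl

  *ˢ≡⊛ : ∀ f g → f *ˢ g ≡ f ⊛ g
  *ˢ≡⊛ f g = ≡.refl

  isCommutativeRing : IsCommutativeRing _≈_ _+ˢ_ _*ˢ_ -ˢ_ (κ (+ 0)) one
  isCommutativeRing = record
    { isRing = record
      { +-isAbelianGroup = record
        { isGroup = record
          { isMonoid = record
            { isSemigroup = record
              { isMagma = record
                { isEquivalence = record
                  { refl = mk≈ λ _ → ≡.refl
                  ; sym = λ p → mk≈ λ n → ≡.sym (p .at n)
                  ; trans = λ p r → mk≈ λ n → ≡.trans (p .at n) (r .at n) }
                ; ∙-cong = λ p r → mk≈ λ n → cong₂ ℤ._+_ (p .at n) (r .at n) }
              ; assoc = λ f g h → mk≈ λ n → ℤ.+-assoc (f n) (g n) (h n) }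
            ; identity = (λ f → mk≈ λ { zero → ℤ.+-identityˡ _ ; (suc n) → ℤ.+-identityˡ _ })
                       , (λ f → mk≈ λ { zero → ℤ.+-identityʳ _ ; (suc n) → ℤ.+-identityʳ _ }) }
          ; inverse = (λ f → mk≈ λ { zero → ℤ.+-inverseˡ (f 0) ; (suc n) → ℤ.+-inverseˡ (f (suc n)) })
                    , (λ f → mk≈ λ { zero → ℤ.+-inverseʳ (f 0) ; (suc n) → ℤ.+-inverseʳ (f (suc n)) })
          ; ⁻¹-cong = λ p → mk≈ λ n → cong ℤ.-_ (p .at n) }
        ; comm = λ f g → mk≈ λ n → ℤ.+-comm (f n) (g n) }
      ; *-cong = ⊛-cong
      ; *-assoc = λ f g h → mk≈ λ n → ⊛-assoc n f g h
      ; *-identity = ⊛-identityˡ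
                   , (λ f → mk≈ λ n → ≡.trans (⊛-comm n f one) (⊛-identityˡ f .at n))
      ; distrib = (λ f g h → mk≈ λ n → ≡.trans (⊛-comm n f (g ⊞ h)) (≡.trans (⊛-distribʳ n g h f)
                    (cong₂ ℤ._+_ (⊛-comm n g f) (⊛-comm n h f))))
                , (λ f g h → mk≈ λ n → ⊛-distribʳ n g h f)
      }
    ; *-comm = λ f g → mk≈ λ n → ⊛-comm n f g }

  κ-+ : ∀ c d → κ (c ℤ.+ d) ≈ κ c +ˢ κ d
  κ-+ c d .at zero = ≡.refl
  κ-+ c d .at (suc n) = ≡.refl

  κ-* : ∀ c d → κ (c ℤ.* d) ≈ κ c *ˢ κ d
  κ-* c d .at zero = ≡.sym (κ-⊛ c (κ d) .at 0)
  κ-* c d .at (suc n) = ≡.sym (≡.trans (κ-⊛ c (κ d) .at (suc n)) (ℤ.*-zeroʳ c))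

  κ-neg : ∀ c → κ (ℤ.- c) ≈ -ˢ κ c
  κ-neg c .at zero = ≡.refl
  κ-neg c .at (suc n) = ≡.refl

series : CommutativeRing 0ℓ 0ℓ
series = record { isCommutativeRing = isCommutativeRing }

-- Multiplicative inverses of power series

zipWith-applyUpTo : ∀ (f g : ℕ → ℤ) n →
  zipWith ℤ._*_ (applyUpTo f n) (applyUpTo g n) ≡ applyUpTo (λ i → f i ℤ.* g i) n
zipWith-applyUpTo f g zero    = ≡.refl
zipWith-applyUpTo f g (suc n) = cong (_ ∷_) (zipWith-applyUpTo (f ∘ suc) (g ∘ suc) n)

-- `invVec` lists its coefficients in descending order, so the pairing in its recursion is already a
-- Cauchy product.
toList-invVec : ∀ f n → toList (invVec f n) ≡ applyUpTo (λ i → inv f (n ℕ.∸ i)) (suc n)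
toList-invVec f zero    = ≡.refl
toList-invVec f (suc n) = cong (inv f (suc n) ∷_) (toList-invVec f n)

inv-suc : ∀ f n → inv f (suc n) ≡ ℤ.- (tl f ⊛ inv f) n
inv-suc f n = cong (λ l → ℤ.- sumℤ l) (≡.trans
  (cong₂ (zipWith ℤ._*_) (map-applyUpTo id (f ∘ suc) (suc n)) (toList-invVec f n))
  (≡.trans (zipWith-applyUpTo (f ∘ suc) (λ i → inv f (n ℕ.∸ i)) (suc n))
    (≡.sym (map-applyUpTo id (λ i → f (suc i) ℤ.* inv f (n ℕ.∸ i)) (suc n)))))

opaque
  unfolding _*ˢ_

  *ˢ-zero : ∀ f g → (f *ˢ g) 0 ≡ f 0 ℤ.* g 0
  *ˢ-zero = ⊛-zero

  *ˢ-suc : ∀ f g n → (f *ˢ g) (suc n) ≡ f 0 ℤ.* g (suc n) ℤ.+ (tl f *ˢ g) n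
  *ˢ-suc = ⊛-suc

  *ˢ-cong≤ : ∀ n {f f′ g g′ : Series} → (∀ i → i ℕ.≤ n → f i ≡ f′ i) → (∀ i → i ℕ.≤ n → g i ≡ g′ i) →
             (f *ˢ g) n ≡ (f′ *ˢ g′) n
  *ˢ-cong≤ = ⊛-cong≤

  κ-*ˢ : ∀ c g → κ c *ˢ g ≈ c · g
  κ-*ˢ = κ-⊛

  inv-inverseʳ : ∀ f → f 0 ≡ + 1 → f *ˢ inv f ≈ one
  inv-inverseʳ f f₀ .at zero rewrite ⊛-zero f (inv f) | f₀ = ≡.refl
  inv-inverseʳ f f₀ .at (suc n) rewrite ⊛-suc f (inv f) n | f₀ | inv-suc f n =
    lem ((tl f ⊛ inv f) n)
    where
    lem : ∀ x → + 1 ℤ.* (ℤ.- x) ℤ.+ x ≡ + 0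
    lem = ℤ-solve

module QSeries where

  open CommutativeRing series hiding (_≈_; zero)
  open import Algebra.Properties.Semiring.Exp semiring using (_^_; ^-congˡ; ^-homo-*; ^-assocʳ)
  open import Algebra.Properties.CommutativeSemigroup *-commutativeSemigroup using (interchange)
  open import Algebra.Properties.Ring ring using (-0#≈0#)
  open import Relation.Binary.Reasoning.Setoid setoid

  κ-hom : CommutativeRing.rawRing ℤ.+-*-commutativeRing -Raw-AlmostCommutative⟶ fromCommutativeRing series
  κ-hom = record { ⟦_⟧ = κ ; +-homo = κ-+ ; *-homo = κ-* ; -‿homo = κ-neg ; 0-homo = refl ; 1-homo = sym one≈κ1 }

  open RingTheory series κ-hom

  -- Congruence modulo powers of q

  infix 4 _≈[_]_
  record _≈[_]_ (f : Series) (N : ℕ) (g : Series) : Set where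
    constructor mk≈[]
    field at< : ∀ i → i ℕ.< N → f i ≡ g i
  open _≈[_]_ public

  ≈⇒≈[] : ∀ {N f g} → f ≈ g → f ≈[ N ] g
  ≈⇒≈[] p .at< i _ = p .at i

  -- The quotient ℤ[[q]]/(q^N), obtained by coarsening equality while keeping carrier and
  -- operations, so that a series is literally its own residue class.
  series/ : ℕ → CommutativeRing 0ℓ 0ℓ
  series/ N = record
    { Carrier = Series ; _≈_ = _≈[ N ]_ ; _+_ = _+_ ; _*_ = _*_ ; -_ = -_ ; 0# = 0# ; 1# = 1#
    ; isCommutativeRing = record
      { isRing = record
        { +-isAbelianGroup = record
          { isGroup = record
            { isMonoid = record
              { isSemigroup = record
                { isMagma = record
                  { isEquivalence = record
                    { refl = mk≈[] λ _ _ → ≡.refl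
                    ; sym = λ p → mk≈[] λ i i<N → ≡.sym (p .at< i i<N)
                    ; trans = λ p r → mk≈[] λ i i<N → ≡.trans (p .at< i i<N) (r .at< i i<N) }
                  ; ∙-cong = λ p r → mk≈[] λ i i<N → ≡.trans (+ˢ-at _ _ i)
                      (≡.trans (cong₂ ℤ._+_ (p .at< i i<N) (r .at< i i<N)) (≡.sym (+ˢ-at _ _ i))) }
                ; assoc = λ f g h → ≈⇒≈[] (+-assoc f g h) }
              ; identity = (λ f → ≈⇒≈[] (+-identityˡ f)) , (λ f → ≈⇒≈[] (+-identityʳ f)) }
            ; inverse = (λ f → ≈⇒≈[] (-‿inverseˡ f)) , (λ f → ≈⇒≈[] (-‿inverseʳ f))
            ; ⁻¹-cong = λ p → mk≈[] λ i i<N → ≡.trans (-ˢ-at _ i)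
                (≡.trans (cong ℤ.-_ (p .at< i i<N)) (≡.sym (-ˢ-at _ i))) }
          ; comm = λ f g → ≈⇒≈[] (+-comm f g) }
        ; *-cong = λ p r → mk≈[] λ i i<N → *ˢ-cong≤ i
            (λ j j≤i → p .at< j (ℕ.≤-<-trans j≤i i<N)) (λ j j≤i → r .at< j (ℕ.≤-<-trans j≤i i<N))
        ; *-assoc = λ f g h → ≈⇒≈[] (*-assoc f g h)
        ; *-identity = (λ f → ≈⇒≈[] (*-identityˡ f)) , (λ f → ≈⇒≈[] (*-identityʳ f))
        ; distrib = (λ f g h → ≈⇒≈[] (distribˡ f g h)) , (λ f g h → ≈⇒≈[] (distribʳ f g h)) }
      ; *-comm = λ f g → ≈⇒≈[] (*-comm f g) }
    }

  module Mod (N : ℕ) = CommutativeRing (series/ N)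

  κ-hom/ : ∀ N → CommutativeRing.rawRing ℤ.+-*-commutativeRing -Raw-AlmostCommutative⟶ fromCommutativeRing (series/ N)
  κ-hom/ N = record { ⟦_⟧ = κ ; +-homo = λ c d → ≈⇒≈[] (κ-+ c d) ; *-homo = λ c d → ≈⇒≈[] (κ-* c d)
    ; -‿homo = λ c → ≈⇒≈[] (κ-neg c) ; 0-homo = Mod.refl N ; 1-homo = ≈⇒≈[] (sym one≈κ1) }

  infix 4 _⟶_
  -- Convergence at a fixed rate: precision N from index N on. The rate survives products, the
  -- substitution q ↦ q⁵ and norms, so no modulus of convergence has to be carried along.
  _⟶_ : (ℕ → Series) → Series → Set
  F ⟶ f = ∀ N K → N ℕ.≤ K → f ≈[ N ] F K

  ⟶-unique : ∀ {F G f g} → F ⟶ f → G ⟶ g → (∀ K → F K ≈ G K) → f ≈ g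
  ⟶-unique F⟶f G⟶g F≈G .at n =
    ≡.trans (F⟶f (suc n) (suc n) ℕ.≤-refl .at< n ℕ.≤-refl)
    (≡.trans (F≈G (suc n) .at n) (≡.sym (G⟶g (suc n) (suc n) ℕ.≤-refl .at< n ℕ.≤-refl)))

  ⟶-* : ∀ {F G f g} → F ⟶ f → G ⟶ g → (λ K → F K * G K) ⟶ (f * g)
  ⟶-* p r N K N≤K = Mod.*-cong N (p N K N≤K) (r N K N≤K)

  ⟶-cong : ∀ {F G f} → (∀ K → F K ≈ G K) → F ⟶ f → G ⟶ f
  ⟶-cong F≈G p N K N≤K = Mod.trans N (p N K N≤K) (≈⇒≈[] (F≈G K))

  ⟶-subsequence : ∀ {F f} (φ : ℕ → ℕ) → (∀ K → K ℕ.≤ φ K) → F ⟶ f → (λ K → F (φ K)) ⟶ f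
  ⟶-subsequence φ K≤φK p N K N≤K = p N (φ K) (ℕ.≤-trans N≤K (K≤φK K))

  -- Powers of q

  shift : Series → Series
  shift f zero    = + 0
  shift f (suc n) = f n

  q : Series
  q = shift one

  shift-cong : ∀ {f g} → f ≈ g → shift f ≈ shift g
  shift-cong p .at zero    = ≡.refl
  shift-cong p .at (suc n) = p .at n

  shift-* : ∀ f g → shift f * g ≈ shift (f * g)
  shift-* f g .at zero    = *ˢ-zero (shift f) g
  shift-* f g .at (suc n) = ≡.trans (*ˢ-suc (shift f) g n) (ℤ.+-identityˡ _)

  q-* : ∀ f → q * f ≈ shift f
  q-* f = trans (shift-* one f) (shift-cong (*-identityˡ f))

  q^-suc-* : ∀ k f → q ^ suc k * f ≈ shift (q ^ k * f)
  q^-suc-* k f = trans (*-assoc q (q ^ k) f) (q-* (q ^ k * f))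

  q^-*-high : ∀ k f n → (q ^ k * f) (k ℕ.+ n) ≡ f n
  q^-*-high zero    f n = *-identityˡ f .at n
  q^-*-high (suc k) f n = ≡.trans (q^-suc-* k f .at (suc k ℕ.+ n)) (q^-*-high k f n)

  q^-*-low : ∀ k f n → n ℕ.< k → (q ^ k * f) n ≡ + 0
  q^-*-low (suc k) f zero    _           = q^-suc-* k f .at 0
  q^-*-low (suc k) f (suc n) (ℕ.s≤s n<k) = ≡.trans (q^-suc-* k f .at (suc n)) (q^-*-low k f n n<k)

  q^-cancel : ∀ k {f g} → q ^ k * f ≈ q ^ k * g → f ≈ g
  q^-cancel k {f} {g} p .at n = ≡.trans (≡.sym (q^-*-high k f n)) (≡.trans (p .at (k ℕ.+ n)) (q^-*-high k g n))

  κ0≡0 : ∀ n → κ (+ 0) n ≡ + 0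
  κ0≡0 zero    = ≡.refl
  κ0≡0 (suc n) = ≡.refl

  q^-≈[]0 : ∀ {N k} → N ℕ.≤ k → q ^ k ≈[ N ] 0#
  q^-≈[]0 {N} {k} N≤k .at< i i<N = ≡.trans (≡.sym (*-identityʳ (q ^ k) .at i))
    (≡.trans (q^-*-low k 1# i (ℕ.<-≤-trans i<N N≤k)) (≡.sym (κ0≡0 i)))

  q^-at : ∀ m n → (q ^ m) n ≡ (if n ≡ᵇ m then + 1 else + 0)
  q^-at zero    zero    = ≡.refl
  q^-at zero    (suc n) = ≡.refl
  q^-at (suc m) zero    = q-* (q ^ m) .at 0
  q^-at (suc m) (suc n) = ≡.trans (q-* (q ^ m) .at (suc n)) (q^-at m n)

  -ˢ-q^-at : ∀ f m n → (f - q ^ m) n ≡ f n ℤ.- (if n ≡ᵇ m then + 1 else + 0)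
  -ˢ-q^-at f m n = ≡.trans (+ˢ-at f (- (q ^ m)) n)
    (cong (λ x → f n ℤ.+ x) (≡.trans (-ˢ-at (q ^ m) n) (cong ℤ.-_ (q^-at m n))))

  oneMinusQ-suc : ∀ m → oneMinusQ (suc m) ≈ 1# - q ^ suc m
  oneMinusQ-suc m .at zero = ≡.sym (-ˢ-q^-at 1# (suc m) 0)
  oneMinusQ-suc m .at (suc n) with n ≡ᵇ m | -ˢ-q^-at 1# (suc m) (suc n)
  ... | true  | eq = ≡.sym eq
  ... | false | eq = ≡.sym eq

  -- Infinite products

  Π : ℕ → ℕ → ℕ → Series
  Π a b K = ∏ K (λ k → 1# - q ^ (a ℕ.+ b ℕ.* k))

  ∏-≈[]1 : ∀ N d {u} → (∀ i → u i ≈[ N ] 1#) → ∏ d u ≈[ N ] 1#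
  ∏-≈[]1 N zero    p = Mod.refl N
  ∏-≈[]1 N (suc d) p = Mod.trans N (Mod.*-cong N (p 0) (∏-≈[]1 N d (p ∘ suc))) (Mod.*-identityˡ N 1#)

  ∏-stable : ∀ {u} N → (∀ k → N ℕ.≤ k → u k ≈[ N ] 1#) → ∀ {K} → N ℕ.≤ K → ∏ K u ≈[ N ] ∏ N u
  ∏-stable {u} N p {K} N≤K = ≡.subst (λ k → ∏ k u ≈[ N ] ∏ N u) (ℕ.m+[n∸m]≡n N≤K)
    (Mod.trans N (≈⇒≈[] (∏-split N (K ℕ.∸ N) u))
    (Mod.trans N (Mod.*-congˡ N (∏-≈[]1 N (K ℕ.∸ N) (λ i → p (N ℕ.+ i) (ℕ.m≤m+n N i)))) (Mod.*-identityʳ N _)))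

  1-q^≈[]1 : ∀ {N k} → N ℕ.≤ k → 1# - q ^ k ≈[ N ] 1#
  1-q^≈[]1 {N} N≤k = Mod.trans N (Mod.+-congˡ N (Mod.-‿cong N (q^-≈[]0 N≤k)))
    (≈⇒≈[] (trans (+-congˡ -0#≈0#) (+-identityʳ 1#)))

  foldr-⊛ : ∀ {u v : ℕ → Series} → (∀ k → u k ≈ v k) → ∀ (g : ℕ → ℕ) K →
            foldr _⊛_ one (map u (applyUpTo g K)) ≈ ∏ K (v ∘ g)
  foldr-⊛ p g zero    = refl
  foldr-⊛ {u} p g (suc K) = trans (reflexive (≡.sym (*ˢ≡⊛ (u (g 0)) _))) (*-cong (p (g 0)) (foldr-⊛ p (g ∘ suc) K))

  qPoch-limit : ∀ a b → Π (suc a) (suc b) ⟶ qPoch (suc a) (suc b)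
  qPoch-limit a b N K N≤K .at< i i<N = ≡.trans
    (foldr-⊛ (λ k → oneMinusQ-suc (a ℕ.+ suc b ℕ.* k)) id (suc i) .at i)
    (≡.sym (∏-stable (suc i) (λ k i<k → 1-q^≈[]1 (ℕ.≤-trans i<k
      (ℕ.≤-trans (ℕ.m≤n*m k (suc b)) (ℕ.m≤n+m _ (suc a))))) (ℕ.≤-trans i<N N≤K) .at< i ℕ.≤-refl))

  -- The substitution q ↦ q⁵

  subQ5-tail : ∀ f n → subQ5 f (5 ℕ.+ n) ≡ subQ5 (tl f) n
  subQ5-tail f n = cong (λ m → if (n % 5) ≡ᵇ 0 then f m else + 0) (m/n≡1+[m∸n]/n (ℕ.m≤m+n 5 n))

  subQ5-cong : ∀ {f g} → f ≈ g → subQ5 f ≈ subQ5 g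
  subQ5-cong p .at n = cong (λ x → if (n % 5) ≡ᵇ 0 then x else + 0) (p .at (n / 5))

  subQ5-tail-* : ∀ f g → tl (f * g) ≈ f 0 · tl g + tl f * g
  subQ5-tail-* f g .at n = ≡.trans (*ˢ-suc f g n) (≡.sym (+ˢ-at (f 0 · tl g) (tl f * g) n))

  subQ5-at-+ : ∀ f g n → subQ5 (f + g) n ≡ subQ5 f n ℤ.+ subQ5 g n
  subQ5-at-+ f g n with (n % 5) ≡ᵇ 0
  ... | true  = +ˢ-at f g (n / 5)
  ... | false = ≡.refl

  subQ5-· : ∀ c f n → subQ5 (c · f) n ≡ c ℤ.* subQ5 f n
  subQ5-· c f n with (n % 5) ≡ᵇ 0
  ... | true  = ≡.refl
  ... | false = ≡.sym (ℤ.*-zeroʳ c)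

  subQ5-* : ∀ f g → subQ5 (f * g) ≈ subQ5 f * subQ5 g
  subQ5-* f g .at n = go n f g
    where
    go : ∀ n f g → subQ5 (f * g) n ≡ (subQ5 f * subQ5 g) n
    go zero f g = ≡.trans (*ˢ-zero f g) (≡.sym (*ˢ-zero (subQ5 f) (subQ5 g)))
    go 1 f g
      rewrite *ˢ-suc (subQ5 f) (subQ5 g) 0 | *ˢ-zero (tl (subQ5 f)) (subQ5 g) | ℤ.*-zeroʳ (f 0) = ≡.refl
    go 2 f g
      rewrite *ˢ-suc (subQ5 f) (subQ5 g) 1 | *ˢ-suc (tl (subQ5 f)) (subQ5 g) 0
            | *ˢ-zero (tl (tl (subQ5 f))) (subQ5 g) | ℤ.*-zeroʳ (f 0) = ≡.refl
    go 3 f g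
      rewrite *ˢ-suc (subQ5 f) (subQ5 g) 2 | *ˢ-suc (tl (subQ5 f)) (subQ5 g) 1 | *ˢ-suc (tl (tl (subQ5 f))) (subQ5 g) 0
            | *ˢ-zero (tl (tl (tl (subQ5 f)))) (subQ5 g) | ℤ.*-zeroʳ (f 0) = ≡.refl
    go 4 f g
      rewrite *ˢ-suc (subQ5 f) (subQ5 g) 3 | *ˢ-suc (tl (subQ5 f)) (subQ5 g) 2 | *ˢ-suc (tl (tl (subQ5 f))) (subQ5 g) 1
            | *ˢ-suc (tl (tl (tl (subQ5 f)))) (subQ5 g) 0
            | *ˢ-zero (tl (tl (tl (tl (subQ5 f))))) (subQ5 g) | ℤ.*-zeroʳ (f 0) = ≡.refl
    -- Five unfoldings of the Cauchy product meet only one coefficient of `subQ5 f` at an exponent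
    -- divisible by 5; the other four products are 0.
    go (suc (suc (suc (suc (suc n))))) f g
      rewrite *ˢ-suc (subQ5 f) (subQ5 g) (4 ℕ.+ n) | *ˢ-suc (tl (subQ5 f)) (subQ5 g) (3 ℕ.+ n)
            | *ˢ-suc (tl (tl (subQ5 f))) (subQ5 g) (2 ℕ.+ n) | *ˢ-suc (tl (tl (tl (subQ5 f)))) (subQ5 g) (1 ℕ.+ n)
            | *ˢ-suc (tl (tl (tl (tl (subQ5 f))))) (subQ5 g) n
            | *-congʳ {subQ5 g} {λ m → subQ5 f (5 ℕ.+ m)} {subQ5 (tl f)} (mk≈ (subQ5-tail f)) .at n
            | subQ5-tail g n | subQ5-tail (f * g) n | subQ5-cong (subQ5-tail-* f g) .at n
            | subQ5-at-+ (f 0 · tl g) (tl f * g) n | subQ5-· (f 0) (tl g) n | go n (tl f) g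
            = cong (λ x → f 0 ℤ.* subQ5 (tl g) n ℤ.+ x) (≡.sym (zeros _))
      where
      zeros : ∀ x → + 0 ℤ.+ (+ 0 ℤ.+ (+ 0 ℤ.+ (+ 0 ℤ.+ x))) ≡ x
      zeros x rewrite ℤ.+-identityˡ x | ℤ.+-identityˡ x | ℤ.+-identityˡ x | ℤ.+-identityˡ x = ≡.refl

  subQ5-+ : ∀ f g → subQ5 (f + g) ≈ subQ5 f + subQ5 g
  subQ5-+ f g .at n = ≡.trans (subQ5-at-+ f g n) (≡.sym (+ˢ-at (subQ5 f) (subQ5 g) n))

  subQ5-neg : ∀ f → subQ5 (- f) ≈ - subQ5 f
  subQ5-neg f .at n = ≡.trans (lem ((n % 5) ≡ᵇ 0)) (≡.sym (-ˢ-at (subQ5 f) n))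
    where
    lem : ∀ b → (if b then (- f) (n / 5) else + 0) ≡ ℤ.- (if b then f (n / 5) else + 0)
    lem true  = -ˢ-at f (n / 5)
    lem false = ≡.refl

  subQ5-zero : ∀ f → f ≈ κ (+ 0) → subQ5 f ≈ κ (+ 0)
  subQ5-zero f p .at n = ≡.trans (lem ((n % 5) ≡ᵇ 0)) (≡.sym (κ0≡0 n))
    where
    lem : ∀ b → (if b then f (n / 5) else + 0) ≡ + 0
    lem true  = ≡.trans (p .at (n / 5)) (κ0≡0 (n / 5))
    lem false = ≡.refl

  subQ5-κ : ∀ c → subQ5 (κ c) ≈ κ c
  subQ5-κ c .at 0 = ≡.refl
  subQ5-κ c .at 1 = ≡.refl
  subQ5-κ c .at 2 = ≡.refl
  subQ5-κ c .at 3 = ≡.refl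
  subQ5-κ c .at 4 = ≡.refl
  subQ5-κ c .at (suc (suc (suc (suc (suc n))))) = ≡.trans (subQ5-tail (κ c) n)
    (≡.trans (subQ5-zero (tl (κ c)) (mk≈ λ m → ≡.sym (κ0≡0 m)) .at n) (κ0≡0 n))

  subQ5-one : subQ5 1# ≈ 1#
  subQ5-one = trans (subQ5-cong one≈κ1) (trans (subQ5-κ (+ 1)) (sym one≈κ1))

  subQ5-q : subQ5 q ≈ q ^ 5
  subQ5-q .at 0 = ≡.sym (q^-at 5 0)
  subQ5-q .at 1 = ≡.sym (q^-at 5 1)
  subQ5-q .at 2 = ≡.sym (q^-at 5 2)
  subQ5-q .at 3 = ≡.sym (q^-at 5 3)
  subQ5-q .at 4 = ≡.sym (q^-at 5 4)
  subQ5-q .at (suc (suc (suc (suc (suc n))))) = ≡.trans (subQ5-tail q n)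
    (≡.trans (subQ5-one .at n) (≡.sym (≡.trans (≡.sym (*-identityʳ (q ^ 5) .at (5 ℕ.+ n))) (q^-*-high 5 1# n))))

  subQ5-^ : ∀ f n → subQ5 (f ^ n) ≈ subQ5 f ^ n
  subQ5-^ f zero    = subQ5-one
  subQ5-^ f (suc n) = trans (subQ5-* f (f ^ n)) (*-congˡ (subQ5-^ f n))

  subQ5-∏ : ∀ n u → subQ5 (∏ n u) ≈ ∏ n (λ i → subQ5 (u i))
  subQ5-∏ zero    u = subQ5-one
  subQ5-∏ (suc n) u = trans (subQ5-* (u 0) (∏ n (u ∘ suc))) (*-congˡ (subQ5-∏ n (u ∘ suc)))

  subQ5-∑ : ∀ n u → subQ5 (∑ n u) ≈ ∑ n (λ i → subQ5 (u i))
  subQ5-∑ zero    u = subQ5-κ (+ 0)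
  subQ5-∑ (suc n) u = trans (subQ5-+ (u 0) (∑ n (u ∘ suc))) (+-congˡ (subQ5-∑ n (u ∘ suc)))

  subQ5-1-q^ : ∀ m → subQ5 (1# - q ^ m) ≈ 1# - q ^ (5 ℕ.* m)
  subQ5-1-q^ m = trans (subQ5-+ 1# (- (q ^ m))) (+-cong subQ5-one (trans (subQ5-neg (q ^ m))
    (-‿cong (trans (subQ5-^ q m) (trans (^-congˡ m subQ5-q) (^-assocʳ q 5 m))))))

  subQ5-multiple : ∀ f n → subQ5 f (n ℕ.* 5) ≡ f n
  subQ5-multiple f zero    = ≡.refl
  subQ5-multiple f (suc n) = ≡.trans (subQ5-tail f (n ℕ.* 5)) (subQ5-multiple (tl f) n)

  subQ5-injective : ∀ {f g} → subQ5 f ≈ subQ5 g → f ≈ g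
  subQ5-injective {f} {g} p .at n =
    ≡.trans (≡.sym (subQ5-multiple f n)) (≡.trans (p .at (n ℕ.* 5)) (subQ5-multiple g n))

  subQ5-cong[] : ∀ {N f g} → f ≈[ N ] g → subQ5 f ≈[ N ] subQ5 g
  subQ5-cong[] p .at< i i<N = cong (λ x → if (i % 5) ≡ᵇ 0 then x else + 0)
    (p .at< (i / 5) (ℕ.≤-<-trans (m/n≤m i 5) i<N))

  ⟶-subQ5 : ∀ {F f} → F ⟶ f → (λ K → subQ5 (F K)) ⟶ subQ5 f
  ⟶-subQ5 p N K N≤K = subQ5-cong[] (p N K N≤K)

  -- Sections of a series by the residue of the exponent modulo 5

  prev : ℕ → ℕ
  prev zero    = 4
  prev (suc r) = r

  -- For r < 5 the exponents congruent to r modulo 5 are kept in place, not divided by 5, so that f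
  -- is the sum of its five parts. The index counts down to the next exponent to be kept.
  part : ℕ → Series → Series
  part zero    f zero    = f 0
  part (suc r) f zero    = + 0
  part r       f (suc n) = part (prev r) (tl f) n

  part-local : ∀ r f g n → f n ≡ g n → part r f n ≡ part r g n
  part-local zero    f g zero    p = p
  part-local (suc r) f g zero    p = ≡.refl
  part-local zero    f g (suc n) p = part-local 4 (tl f) (tl g) n p
  part-local (suc r) f g (suc n) p = part-local r (tl f) (tl g) n p

  part-cong : ∀ r {f g} → f ≈ g → part r f ≈ part r g
  part-cong r {f} {g} p .at n = part-local r f g n (p .at n)

  part-difference : ∀ r f g → part r (f - g) ≈ part r f - part r g
  part-difference r f g .at n = ≡.trans (part-local r (f - g) (λ m → f m ℤ.- g m) n (at-difference f g n))
    (≡.trans (go r f g n) (≡.sym (at-difference (part r f) (part r g) n)))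
    where
    at-difference : ∀ f g n → (f - g) n ≡ f n ℤ.- g n
    at-difference f g n = ≡.trans (+ˢ-at f (- g) n) (cong (λ x → f n ℤ.+ x) (-ˢ-at g n))
    go : ∀ r f g n → part r (λ m → f m ℤ.- g m) n ≡ part r f n ℤ.- part r g n
    go zero    f g zero    = ≡.refl
    go (suc r) f g zero    = ≡.refl
    go zero    f g (suc n) = go 4 (tl f) (tl g) n
    go (suc r) f g (suc n) = go r (tl f) (tl g) n

  part-shift : ∀ r f → part r (shift f) ≈ shift (part (prev r) f)
  part-shift zero    f .at zero    = ≡.refl
  part-shift (suc r) f .at zero    = ≡.refl
  part-shift zero    f .at (suc n) = ≡.refl
  part-shift (suc r) f .at (suc n) = ≡.refl

  prevs : ℕ → ℕ → ℕ
  prevs zero    r = r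
  prevs (suc k) r = prevs k (prev r)

  part-q^ : ∀ k r f → part r (q ^ k * f) ≈ q ^ k * part (prevs k r) f
  part-q^ zero    r f = trans (part-cong r (*-identityˡ f)) (sym (*-identityˡ _))
  part-q^ (suc k) r f = begin
    part r (q ^ suc k * f)                     ≈⟨ part-cong r (q^-suc-* k f) ⟩
    part r (shift (q ^ k * f))                 ≈⟨ part-shift r (q ^ k * f) ⟩
    shift (part (prev r) (q ^ k * f))          ≈⟨ shift-cong (part-q^ k (prev r) f) ⟩
    shift (q ^ k * part (prevs (suc k) r) f)   ≈⟨ q^-suc-* k _ ⟨
    q ^ suc k * part (prevs (suc k) r) f       ∎

  prevs-5 : ∀ k r → r ℕ.< 5 → prevs (5 ℕ.* k) r ≡ r
  prevs-5 k r r<5 rewrite ℕ.*-comm 5 k = go k r r<5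
    where
    go : ∀ k r → r ℕ.< 5 → prevs (k ℕ.* 5) r ≡ r
    go zero    r _ = ≡.refl
    go (suc k) 0 p = go k 0 p
    go (suc k) 1 p = go k 1 p
    go (suc k) 2 p = go k 2 p
    go (suc k) 3 p = go k 3 p
    go (suc k) 4 p = go k 4 p
    go (suc k) (suc (suc (suc (suc (suc r))))) (ℕ.s≤s (ℕ.s≤s (ℕ.s≤s (ℕ.s≤s (ℕ.s≤s ())))))

  part-subQ5 : ∀ f → part 0 (subQ5 f) ≈ subQ5 f
  part-subQ5 f .at n = go n f
    where
    go : ∀ n f → part 0 (subQ5 f) n ≡ subQ5 f n
    go 0 f = ≡.refl
    go 1 f = ≡.refl
    go 2 f = ≡.refl
    go 3 f = ≡.refl
    go 4 f = ≡.refl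
    go (suc (suc (suc (suc (suc n))))) f = ≡.trans
      (part-local 0 (λ m → subQ5 f (5 ℕ.+ m)) (subQ5 (tl f)) n (subQ5-tail f n))
      (≡.trans (go n (tl f)) (≡.sym (subQ5-tail f n)))

  part-subQ5-suc : ∀ r f → r ℕ.< 4 → part (suc r) (subQ5 f) ≈ κ (+ 0)
  part-subQ5-suc r f r<4 .at n = ≡.trans (go n r f r<4) (≡.sym (κ0≡0 n))
    where
    step : ∀ r f n → part r (λ m → subQ5 f (5 ℕ.+ m)) n ≡ part r (subQ5 (tl f)) n
    step r f n = part-local r (λ m → subQ5 f (5 ℕ.+ m)) (subQ5 (tl f)) n (subQ5-tail f n)
    go : ∀ n r f → r ℕ.< 4 → part (suc r) (subQ5 f) n ≡ + 0
    go 0 r f _ = ≡.refl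
    go 1 0 f _ = ≡.refl
    go 1 (suc r) f _ = ≡.refl
    go 2 0 f _ = ≡.refl
    go 2 1 f _ = ≡.refl
    go 2 (suc (suc r)) f _ = ≡.refl
    go 3 0 f _ = ≡.refl
    go 3 1 f _ = ≡.refl
    go 3 2 f _ = ≡.refl
    go 3 (suc (suc (suc r))) f _ = ≡.refl
    go 4 0 f _ = ≡.refl
    go 4 1 f _ = ≡.refl
    go 4 2 f _ = ≡.refl
    go 4 3 f _ = ≡.refl
    go 4 (suc (suc (suc (suc r)))) f (ℕ.s≤s (ℕ.s≤s (ℕ.s≤s (ℕ.s≤s ()))))
    go (suc (suc (suc (suc (suc n))))) 0 f p = ≡.trans (step 1 f n) (go n 0 (tl f) p)
    go (suc (suc (suc (suc (suc n))))) 1 f p = ≡.trans (step 2 f n) (go n 1 (tl f) p)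
    go (suc (suc (suc (suc (suc n))))) 2 f p = ≡.trans (step 3 f n) (go n 2 (tl f) p)
    go (suc (suc (suc (suc (suc n))))) 3 f p = ≡.trans (step 4 f n) (go n 3 (tl f) p)
    go (suc (suc (suc (suc (suc n))))) (suc (suc (suc (suc r)))) f (ℕ.s≤s (ℕ.s≤s (ℕ.s≤s (ℕ.s≤s ()))))

  -- The norm from ℤ[[q]] to ℤ[[q⁵]]: the determinant of multiplication by f, on the basis 1, q, …, q⁴.
  Norm : Series → Series
  Norm f = Nm (part 0 f) (part 1 f) (part 2 f) (part 3 f) (part 4 f)

  ⟶-Norm : ∀ {F f} → F ⟶ f → (λ K → Norm (F K)) ⟶ Norm f
  ⟶-Norm {F} {f} p N K N≤K = RingTheory.Nm-cong (series/ N) (κ-hom/ N) (c 0) (c 1) (c 2) (c 3) (c 4)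
    where
    c : ∀ r → part r f ≈[ N ] part r (F K)
    c r .at< i i<N = part-local r f (F K) i (p N K N≤K .at< i i<N)

  Norm-cong : ∀ {f g} → f ≈ g → Norm f ≈ Norm g
  Norm-cong p = Nm-cong (part-cong 0 p) (part-cong 1 p) (part-cong 2 p) (part-cong 3 p) (part-cong 4 p)

  Norm-one : Norm 1# ≈ 1#
  Norm-one = trans (Nm-cong (p 0) (p 1) (p 2) (p 3) (p 4)) (Nm-one q)
    where
    e : ℕ → Series
    e zero    = 1#
    e (suc r) = κ (+ 0)
    z : ∀ r n → part r (tl one) n ≡ + 0
    z zero    zero    = ≡.refl
    z (suc r) zero    = ≡.refl
    z zero    (suc n) = z 4 n
    z (suc r) (suc n) = z r n
    p : ∀ r → part r 1# ≈ e r
    p zero    .at zero    = ≡.refl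
    p (suc r) .at zero    = ≡.refl
    p zero    .at (suc n) = z 4 n
    p (suc r) .at (suc n) = z r n

  part-*-1-q^ : ∀ s k r f → prevs s r ℕ.< 5 →
    part r (f * (1# - q ^ (s ℕ.+ 5 ℕ.* k))) ≈ part r f - q ^ (s ℕ.+ 5 ℕ.* k) * part (prevs s r) f
  part-*-1-q^ s k r f prev<5 = begin
    part r (f * (1# - x))                              ≈⟨ part-cong r (*-1- f x) ⟩
    part r (f - x * f)                                 ≈⟨ part-difference r f (x * f) ⟩
    part r f - part r (x * f)                          ≈⟨ +-congˡ (-‿cong (part-q^ (s ℕ.+ 5 ℕ.* k) r f)) ⟩
    part r f - x * part (prevs (s ℕ.+ 5 ℕ.* k) r) f    ≈⟨ +-congˡ (-‿cong (*-congˡ (reflexive (cong (λ m → part m f) (go s r prev<5))))) ⟩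
    part r f - x * part (prevs s r) f                  ∎
    where
    x : Series
    x = q ^ (s ℕ.+ 5 ℕ.* k)
    go : ∀ s r → prevs s r ℕ.< 5 → prevs (s ℕ.+ 5 ℕ.* k) r ≡ prevs s r
    go zero    r p = prevs-5 k r p
    go (suc s) r p = go s (prev r) p

  private
    <5 : ∀ r {r<5 : True (r ℕ.<? 5)} → r ℕ.< 5
    <5 r {r<5} = toWitness r<5

  -- Multiplication by q^m permutes the sections cyclically by m modulo 5, hence the writing of m as
  -- s + 5k. The resulting factor 1 - q^(5m) is the original factor at q⁵.
  Norm-twist : ∀ s → 1 ℕ.≤ s → s ℕ.≤ 4 → ∀ k f →
    Norm (f * (1# - q ^ (s ℕ.+ 5 ℕ.* k))) ≈ subQ5 (1# - q ^ (s ℕ.+ 5 ℕ.* k)) * Norm f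
  Norm-twist s 1≤s s≤4 k f = trans (go s 1≤s s≤4) (*-congʳ (trans
    (+-congˡ (-‿cong (trans (^-assocʳ q m 5) (reflexive (cong (q ^_) (ℕ.*-comm m 5)))))) (sym (subQ5-1-q^ m))))
    where
    m : ℕ
    m = s ℕ.+ 5 ℕ.* k
    go : ∀ s → 1 ℕ.≤ s → s ℕ.≤ 4 → Norm (f * (1# - q ^ (s ℕ.+ 5 ℕ.* k))) ≈ (1# - (q ^ (s ℕ.+ 5 ℕ.* k)) ^ 5) * Norm f
    go 1 _ _ = trans (Nm-cong (part-*-1-q^ 1 k 0 f (<5 4)) (part-*-1-q^ 1 k 1 f (<5 0)) (part-*-1-q^ 1 k 2 f (<5 1))
      (part-*-1-q^ 1 k 3 f (<5 2)) (part-*-1-q^ 1 k 4 f (<5 3))) (Nm-twist₁ _ _ _ _ _ _)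
    go 2 _ _ = trans (Nm-cong (part-*-1-q^ 2 k 0 f (<5 3)) (part-*-1-q^ 2 k 1 f (<5 4)) (part-*-1-q^ 2 k 2 f (<5 0))
      (part-*-1-q^ 2 k 3 f (<5 1)) (part-*-1-q^ 2 k 4 f (<5 2))) (Nm-twist₂ _ _ _ _ _ _)
    go 3 _ _ = trans (Nm-cong (part-*-1-q^ 3 k 0 f (<5 2)) (part-*-1-q^ 3 k 1 f (<5 3)) (part-*-1-q^ 3 k 2 f (<5 4))
      (part-*-1-q^ 3 k 3 f (<5 0)) (part-*-1-q^ 3 k 4 f (<5 1))) (Nm-twist₃ _ _ _ _ _ _)
    go 4 _ _ = trans (Nm-cong (part-*-1-q^ 4 k 0 f (<5 1)) (part-*-1-q^ 4 k 1 f (<5 2)) (part-*-1-q^ 4 k 2 f (<5 3))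
      (part-*-1-q^ 4 k 3 f (<5 4)) (part-*-1-q^ 4 k 4 f (<5 0))) (Nm-twist₄ _ _ _ _ _ _)
    go (suc (suc (suc (suc (suc s))))) _ (ℕ.s≤s (ℕ.s≤s (ℕ.s≤s (ℕ.s≤s ()))))

  -- A factor that already lies in ℤ[[q⁵]] scales every section, so its norm is its fifth power.
  Norm-twist₅ : ∀ k f → Norm (f * (1# - q ^ (5 ℕ.+ 5 ℕ.* k))) ≈ (1# - q ^ (5 ℕ.+ 5 ℕ.* k)) ^ 5 * Norm f
  Norm-twist₅ k f = trans (Nm-cong (part-*-1-q^ 5 k 0 f (<5 0)) (part-*-1-q^ 5 k 1 f (<5 1)) (part-*-1-q^ 5 k 2 f (<5 2))
    (part-*-1-q^ 5 k 3 f (<5 3)) (part-*-1-q^ 5 k 4 f (<5 4))) (Nm-twist₀ _ _ _ _ _ _)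

  Norm-∏ : ∀ u v → (∀ k f → Norm (f * u k) ≈ v k * Norm f) → ∀ K f → Norm (f * ∏ K u) ≈ Norm f * ∏ K v
  Norm-∏ u v step zero    f = trans (Norm-cong (*-identityʳ f)) (sym (*-identityʳ _))
  Norm-∏ u v step (suc K) f = begin
    Norm (f * ∏ (suc K) u)       ≈⟨ Norm-cong (trans (*-congˡ (∏-snoc K u)) (sym (*-assoc f _ _))) ⟩
    Norm ((f * ∏ K u) * u K)     ≈⟨ step K (f * ∏ K u) ⟩
    v K * Norm (f * ∏ K u)       ≈⟨ *-congˡ (Norm-∏ u v step K f) ⟩
    v K * (Norm f * ∏ K v)       ≈⟨ trans (*-comm _ _) (*-assoc _ _ _) ⟩
    Norm f * (∏ K v * v K)       ≈⟨ *-congˡ (∏-snoc K v) ⟨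
    Norm f * ∏ (suc K) v         ∎

  Norm-Π : ∀ s → 1 ℕ.≤ s → s ℕ.≤ 4 → ∀ K f → Norm (f * Π s 5 K) ≈ Norm f * subQ5 (Π s 5 K)
  Norm-Π s 1≤s s≤4 K f = trans (Norm-∏ _ _ (Norm-twist s 1≤s s≤4) K f) (*-congˡ (sym (subQ5-∏ K _)))

  Norm-Π₅ : ∀ K f → Norm (f * Π 5 5 K) ≈ Norm f * Π 5 5 K ^ 5
  Norm-Π₅ K f = trans (Norm-∏ _ _ Norm-twist₅ K f) (*-congˡ (∏-^ K _ 5))

  -- The Jacobi triple product

  open Gauss (q ^ 5)

  private
    Q^ : ∀ n → (q ^ 5) ^ n ≈ q ^ (5 ℕ.* n)
    Q^ = ^-assocʳ q 5

    pow : ∀ {m n} → m ≡ n → q ^ m ≈ q ^ n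
    pow p = reflexive (cong (q ^_) p)

  E : Series
  E = qPoch 1 1

  E-limit : Π 1 1 ⟶ E
  E-limit = qPoch-limit 0 0

  Π₅ : ∀ K → Π 5 5 K ≈ subQ5 (Π 1 1 K)
  Π₅ K = sym (trans (subQ5-∏ K _) (∏-cong K (λ i → trans (subQ5-1-q^ (1 ℕ.+ 1 ℕ.* i))
    (+-congˡ (-‿cong (reflexive (cong (q ^_) (lem i))))))))
    where
    lem : ∀ i → 5 ℕ.* (1 ℕ.+ 1 ℕ.* i) ≡ 5 ℕ.+ 5 ℕ.* i
    lem = ℕ-solve

  Π₅-limit : Π 5 5 ⟶ subQ5 E
  Π₅-limit = ⟶-cong (λ K → sym (Π₅ K)) (⟶-subQ5 E-limit)

  poch-limit : poch ⟶ subQ5 E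
  poch-limit = ⟶-cong (λ K → ∏-cong K (λ i → +-congˡ (-‿cong (trans (pow (≡.sym (ℕ.*-suc 5 i))) (sym (Q^ (suc i))))))) Π₅-limit

  inv-inverseˡ : ∀ f → f 0 ≡ + 1 → inv f * f ≈ 1#
  inv-inverseˡ f f₀ = trans (*-comm (inv f) f) (inv-inverseʳ f f₀)

  module Truncated (N : ℕ) where
    module ring = CommutativeRing (series/ N)
    module exp = Algebra.Properties.Semiring.Exp ring.semiring
    module T = RingTheory (series/ N) (κ-hom/ N)

    -- The instances of the ring theory at `series` and at `series/ N` define powers and sums by the
    -- same recursion but as separate functions; this and the next lemmas identify them.
    ^-transfer : ∀ x n → x exp.^ n ≡ x ^ n
    ^-transfer x zero    = ≡.refl
    ^-transfer x (suc n) = cong (x *_) (^-transfer x n)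

    ∑-transfer : ∀ n {f g : ℕ → Series} → (∀ i → f i ≡ g i) → T.∑ n f ≡ ∑ n g
    ∑-transfer zero    p = ≡.refl
    ∑-transfer (suc n) p = cong₂ _+_ (p 0) (∑-transfer n (p ∘ suc))

    θ-transfer : ∀ x r r′ k → T.θ x r r′ k ≡ θ x r r′ k
    θ-transfer x r r′ k = cong₂ _*_ (^-transfer (- 1#) ℤ.∣ k ∣) (^-transfer x (expo r r′ k))

    ∑ℤ-transfer : ∀ lo L x r r′ → T.∑ℤ lo L (T.θ x r r′) ≡ ∑ℤ lo L (θ x r r′)
    ∑ℤ-transfer lo L x r r′ = ∑-transfer L (λ i → θ-transfer x r r′ (lo ℤ.+ + i))

    ∑-cong<[] : ∀ n {f g : ℕ → Series} → (∀ i → i ℕ.< n → f i ≈[ N ] g i) → ∑ n f ≈[ N ] ∑ n g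
    ∑-cong<[] n {f} {g} p = ≡.subst₂ (_≈[ N ]_) (∑-transfer n (λ _ → ≡.refl)) (∑-transfer n (λ _ → ≡.refl)) (T.∑-cong< n p)

    q^N≈0 : q exp.^ N ≈[ N ] 0#
    q^N≈0 = ≡.subst (_≈[ N ] 0#) (≡.sym (^-transfer q N)) (q^-≈[]0 ℕ.≤-refl)

    -- Modulo q^N the three q-factorials in `qb-poch`, with indices M - j, j and M all at least N,
    -- coincide with s = E(q⁵). Hence `qb M j` times s² is s, and s can be cancelled.
    qb-limit : ∀ {M j} → N ℕ.≤ j → N ℕ.≤ M ℕ.∸ j → j ℕ.≤ M → qb M j * subQ5 E ≈[ N ] 1#
    qb-limit {M} {j} N≤j N≤M-j j≤M = RingTheory.*-cancel (series/ N) (κ-hom/ N) {inv s} {s} (qb M j * s) 1#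
      (≈⇒≈[] (inv-inverseˡ s ≡.refl))
      (ring.trans (≈⇒≈[] (trans (*-comm s _) (*-assoc _ s s)))
      (ring.trans (ring.*-congˡ {qb M j} (ring.*-cong (poch-limit N (M ℕ.∸ j) N≤M-j) (poch-limit N j N≤j)))
      (ring.trans (≈⇒≈[] (qb-poch (M ℕ.∸ j) j (≡.sym (ℕ.m∸n+n≡m j≤M))))
      (ring.trans (ring.sym (poch-limit N M (ℕ.≤-trans N≤j j≤M))) (≈⇒≈[] (sym (*-identityʳ s)))))))
      where
      s : Series
      s = subQ5 E

  module JacobiTriple (r r′ : ℕ) (r+r′ : r ℕ.+ r′ ≡ 5) (1≤r : 1 ℕ.≤ r) (1≤r′ : 1 ℕ.≤ r′) where

    private
      module _ (n : ℕ) where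
        X Y : Series
        X = q ^ (5 ℕ.* n)
        Y = q ^ r

        -- Of the 2n factors in the q-binomial theorem, those of index at least n yield the product
        -- for r once X is taken out; `lower` takes the other monomial out of the rest, which yields
        -- the product for r′ because r + r′ = 5.
        upper : ∀ i → X - (q ^ 5) ^ (n ℕ.+ i) * Y ≈ X * (1# - q ^ (r ℕ.+ 5 ℕ.* i))
        upper i = trans (+-congˡ (-‿cong (begin
          (q ^ 5) ^ (n ℕ.+ i) * q ^ r              ≈⟨ *-congʳ (Q^ (n ℕ.+ i)) ⟩
          q ^ (5 ℕ.* (n ℕ.+ i)) * q ^ r            ≈⟨ ^-homo-* q (5 ℕ.* (n ℕ.+ i)) r ⟨
          q ^ (5 ℕ.* (n ℕ.+ i) ℕ.+ r)              ≈⟨ pow (lem n i r) ⟩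
          q ^ (5 ℕ.* n ℕ.+ (r ℕ.+ 5 ℕ.* i))        ≈⟨ ^-homo-* q (5 ℕ.* n) (r ℕ.+ 5 ℕ.* i) ⟩
          X * q ^ (r ℕ.+ 5 ℕ.* i)                  ∎))) (x-xy X (q ^ (r ℕ.+ 5 ℕ.* i)))
          where
          lem : ∀ n i r → 5 ℕ.* (n ℕ.+ i) ℕ.+ r ≡ 5 ℕ.* n ℕ.+ (r ℕ.+ 5 ℕ.* i)
          lem = ℕ-solve

        lower : ∀ i → i ℕ.< n → X - (q ^ 5) ^ (n ℕ.∸ suc i) * Y ≈ - ((q ^ 5) ^ (n ℕ.∸ suc i) * Y) * (1# - q ^ (r′ ℕ.+ 5 ℕ.* i))
        lower i i<n = trans (+-congʳ (sym (begin
          (q ^ 5) ^ m * q ^ r * q ^ (r′ ℕ.+ 5 ℕ.* i)              ≈⟨ *-congʳ (trans (*-congʳ (Q^ m)) (sym (^-homo-* q (5 ℕ.* m) r))) ⟩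
          q ^ (5 ℕ.* m ℕ.+ r) * q ^ (r′ ℕ.+ 5 ℕ.* i)              ≈⟨ ^-homo-* q (5 ℕ.* m ℕ.+ r) (r′ ℕ.+ 5 ℕ.* i) ⟨
          q ^ (5 ℕ.* m ℕ.+ r ℕ.+ (r′ ℕ.+ 5 ℕ.* i))                ≈⟨ pow e ⟩
          X                                                       ∎))) (xy-x ((q ^ 5) ^ m * Y) (q ^ (r′ ℕ.+ 5 ℕ.* i)))
          where
          m : ℕ
          m = n ℕ.∸ suc i
          lem : ∀ m r r′ i → 5 ℕ.* m ℕ.+ r ℕ.+ (r′ ℕ.+ 5 ℕ.* i) ≡ 5 ℕ.* (m ℕ.+ i) ℕ.+ (r ℕ.+ r′)
          lem = ℕ-solve
          lem′ : ∀ m i → 5 ℕ.* (m ℕ.+ i) ℕ.+ 5 ≡ 5 ℕ.* (suc i ℕ.+ m)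
          lem′ = ℕ-solve
          e : 5 ℕ.* m ℕ.+ r ℕ.+ (r′ ℕ.+ 5 ℕ.* i) ≡ 5 ℕ.* n
          e = ≡.trans (lem m r r′ i) (≡.trans (cong (5 ℕ.* (m ℕ.+ i) ℕ.+_) r+r′)
            (≡.trans (lem′ m i) (cong (5 ℕ.*_) (ℕ.m+[n∸m]≡n i<n))))

        T : ℕ
        T = 5 ℕ.* tri n ℕ.+ r ℕ.* n ℕ.+ 5 ℕ.* n ℕ.* n

        -- The factor by which both sides of the q-binomial theorem at X = q⁵ⁿ, Y = qʳ exceed those of the triple product.
        prefactor : Series
        prefactor = (- 1#) ^ n * q ^ T

        product-side : ∏ (n ℕ.+ n) (λ i → X - (q ^ 5) ^ i * Y) ≈ prefactor * (Π r 5 n * Π r′ 5 n)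
        product-side = begin
          ∏ (n ℕ.+ n) (λ i → X - (q ^ 5) ^ i * Y)
            ≈⟨ ∏-split n n _ ⟩
          ∏ n (λ i → X - (q ^ 5) ^ i * Y) * ∏ n (λ i → X - (q ^ 5) ^ (n ℕ.+ i) * Y)
            ≈⟨ *-cong (trans (∏-reverse n _) (trans (∏-cong< n lower) (∏-* n _ _))) (trans (∏-cong n upper) (∏-* n _ _)) ⟩
          (∏ n (λ i → - ((q ^ 5) ^ (n ℕ.∸ suc i) * Y)) * Π r′ 5 n) * (∏ n (λ _ → X) * Π r 5 n)
            ≈⟨ *-cong (*-congʳ (trans (sym (∏-reverse n (λ i → - ((q ^ 5) ^ i * Y)))) (∏-neg-geometric n Y))) (*-congʳ (∏-const n X)) ⟩
          ((- 1#) ^ n * ((q ^ 5) ^ tri n * Y ^ n) * Π r′ 5 n) * (X ^ n * Π r 5 n)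
            ≈⟨ trans (interchange _ _ _ _) (*-cong (trans (*-assoc _ _ _) (*-congˡ power)) (*-comm _ _)) ⟩
          prefactor * (Π r 5 n * Π r′ 5 n) ∎
          where
          power : (q ^ 5) ^ tri n * Y ^ n * X ^ n ≈ q ^ T
          power = begin
            (q ^ 5) ^ tri n * Y ^ n * X ^ n                   ≈⟨ *-cong (*-cong (Q^ (tri n)) (^-assocʳ q r n)) (^-assocʳ q (5 ℕ.* n) n) ⟩
            q ^ (5 ℕ.* tri n) * q ^ (r ℕ.* n) * q ^ (5 ℕ.* n ℕ.* n) ≈⟨ *-congʳ (^-homo-* q (5 ℕ.* tri n) (r ℕ.* n)) ⟨
            q ^ (5 ℕ.* tri n ℕ.+ r ℕ.* n) * q ^ (5 ℕ.* n ℕ.* n) ≈⟨ ^-homo-* q (5 ℕ.* tri n ℕ.+ r ℕ.* n) (5 ℕ.* n ℕ.* n) ⟨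
            q ^ T                                             ∎

        term : ∀ j → j ℕ.< suc (n ℕ.+ n) →
          (- 1#) ^ j * (q ^ 5) ^ tri j * X ^ ((n ℕ.+ n) ℕ.∸ j) * Y ^ j * qb (n ℕ.+ n) j
            ≈ prefactor * (θ q r r′ (ℤ.- + n ℤ.+ + j) * qb (n ℕ.+ n) j)
        term j (ℕ.s≤s j≤2n) = trans (*-congʳ (begin
          (- 1#) ^ j * (q ^ 5) ^ tri j * X ^ d * Y ^ j
            ≈⟨ trans (*-assoc _ _ _) (trans (*-assoc _ _ _) (*-cong sign power)) ⟩
          ((- 1#) ^ n * sgn k) * (q ^ T * q ^ expo r r′ k)
            ≈⟨ interchange _ _ _ _ ⟩
          prefactor * θ q r r′ k ∎)) (*-assoc _ _ _)
          where
          d : ℕ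
          d = (n ℕ.+ n) ℕ.∸ j
          k : ℤ
          k = ℤ.- + n ℤ.+ + j
          sign : (- 1#) ^ j ≈ (- 1#) ^ n * sgn k
          sign = sym (begin
            (- 1#) ^ n * sgn k                          ≈⟨ *-congˡ (trans (sgn-+ (ℤ.- + n) (+ j)) (*-congʳ (sgn-neg (+ n)))) ⟩
            (- 1#) ^ n * ((- 1#) ^ n * (- 1#) ^ j)      ≈⟨ *-assoc _ _ _ ⟨
            (- 1#) ^ n * (- 1#) ^ n * (- 1#) ^ j        ≈⟨ *-congʳ (sgn-square (+ n)) ⟩
            1# * (- 1#) ^ j                             ≈⟨ *-identityˡ _ ⟩
            (- 1#) ^ j                                  ∎)
          -- Put j = n + k, so that d = n - k: the cross term 5nk in 5 j (j - 1) / 2 is cancelled by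
          -- the one in 5 n d.
          e≡ : 5 ℕ.* tri j ℕ.+ (5 ℕ.* n ℕ.* d ℕ.+ r ℕ.* j) ≡ T ℕ.+ expo r r′ k
          e≡ = double-injective
            (≡.trans (cong (+ 2 ℤ.*_) (cong₂ ℤ._+_ (ℤ.pos-* 5 (tri j))
              (cong₂ ℤ._+_ (≡.trans (ℤ.pos-* (5 ℕ.* n) d) (cong (ℤ._* + d) (ℤ.pos-* 5 n))) (ℤ.pos-* r j))))
            (≡.trans (lem₁ (+ tri j) (+ n) (+ d) (+ r ℤ.* + j))
            (≡.trans (cong₂ (λ x y → + 5 ℤ.* x ℤ.+ + 10 ℤ.* (+ n ℤ.* y) ℤ.+ + 2 ℤ.* (+ r ℤ.* + j)) (tri-spec j) d≡)
            (≡.trans (lem₂ (+ n) (+ j) (+ r))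
            (≡.trans (cong₂ (λ x y → + 5 ℤ.* x ℤ.+ + 2 ℤ.* (+ r ℤ.* + n) ℤ.+ + 10 ℤ.* (+ n ℤ.* + n) ℤ.+ y)
              (≡.sym (tri-spec n)) (≡.sym (expo-spec r r′ r+r′ k)))
            (≡.trans (lem₃ (+ tri n) (+ r ℤ.* + n) (+ n) (+ expo r r′ k))
            (cong (+ 2 ℤ.*_) (cong (ℤ._+ + expo r r′ k) (≡.sym (cong₂ ℤ._+_ (cong₂ ℤ._+_ (ℤ.pos-* 5 (tri n)) (ℤ.pos-* r n))
              (≡.trans (ℤ.pos-* (5 ℕ.* n) n) (cong (ℤ._* + n) (ℤ.pos-* 5 n)))))))))))))
            where
            d≡ : + d ≡ + n ℤ.+ + n ℤ.- + j
            d≡ = pos-∸ j≤2n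
            lem₁ : ∀ t n d y → + 2 ℤ.* (+ 5 ℤ.* t ℤ.+ (+ 5 ℤ.* n ℤ.* d ℤ.+ y)) ≡ + 5 ℤ.* (+ 2 ℤ.* t) ℤ.+ + 10 ℤ.* (n ℤ.* d) ℤ.+ + 2 ℤ.* y
            lem₁ = ℤ-solve
            lem₂ : ∀ n j r → + 5 ℤ.* (j ℤ.* j ℤ.- j) ℤ.+ + 10 ℤ.* (n ℤ.* (n ℤ.+ n ℤ.- j)) ℤ.+ + 2 ℤ.* (r ℤ.* j)
              ≡ + 5 ℤ.* (n ℤ.* n ℤ.- n) ℤ.+ + 2 ℤ.* (r ℤ.* n) ℤ.+ + 10 ℤ.* (n ℤ.* n)
              ℤ.+ (+ 5 ℤ.* ((ℤ.- n ℤ.+ j) ℤ.* (ℤ.- n ℤ.+ j) ℤ.- (ℤ.- n ℤ.+ j)) ℤ.+ + 2 ℤ.* (r ℤ.* (ℤ.- n ℤ.+ j)))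
            lem₂ = ℤ-solve
            lem₃ : ∀ t x n e → + 5 ℤ.* (+ 2 ℤ.* t) ℤ.+ + 2 ℤ.* x ℤ.+ + 10 ℤ.* (n ℤ.* n) ℤ.+ + 2 ℤ.* e
              ≡ + 2 ℤ.* (+ 5 ℤ.* t ℤ.+ x ℤ.+ + 5 ℤ.* n ℤ.* n ℤ.+ e)
            lem₃ = ℤ-solve
          power : (q ^ 5) ^ tri j * (X ^ d * Y ^ j) ≈ q ^ T * q ^ expo r r′ k
          power = begin
            (q ^ 5) ^ tri j * (X ^ d * Y ^ j)                             ≈⟨ *-cong (Q^ (tri j)) (*-cong (^-assocʳ q (5 ℕ.* n) d) (^-assocʳ q r j)) ⟩
            q ^ (5 ℕ.* tri j) * (q ^ (5 ℕ.* n ℕ.* d) * q ^ (r ℕ.* j))     ≈⟨ *-congˡ (^-homo-* q (5 ℕ.* n ℕ.* d) (r ℕ.* j)) ⟨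
            q ^ (5 ℕ.* tri j) * q ^ (5 ℕ.* n ℕ.* d ℕ.+ r ℕ.* j)           ≈⟨ ^-homo-* q (5 ℕ.* tri j) _ ⟨
            q ^ (5 ℕ.* tri j ℕ.+ (5 ℕ.* n ℕ.* d ℕ.+ r ℕ.* j))             ≈⟨ pow e≡ ⟩
            q ^ (T ℕ.+ expo r r′ k)                                       ≈⟨ ^-homo-* q T _ ⟩
            q ^ T * q ^ expo r r′ k                                       ∎

        prefactor-cancel : ∀ {f g} → prefactor * f ≈ prefactor * g → f ≈ g
        prefactor-cancel {f} {g} p = q^-cancel T (*-cancel {(- 1#) ^ n} {(- 1#) ^ n} _ _ (sgn-square (+ n))
          (trans (sym (*-assoc _ _ f)) (trans p (*-assoc _ _ g))))

    finite : ∀ n → Π r 5 n * Π r′ 5 n ≈ ∑ (suc (n ℕ.+ n)) (λ j → θ q r r′ (ℤ.- + n ℤ.+ + j) * qb (n ℕ.+ n) j)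
    finite n = prefactor-cancel n (begin
      prefactor n * (Π r 5 n * Π r′ 5 n)
        ≈⟨ product-side n ⟨
      ∏ (n ℕ.+ n) (λ i → X n - (q ^ 5) ^ i * Y n)
        ≈⟨ q-binomial (n ℕ.+ n) (X n) (Y n) ⟩
      ∑ (suc (n ℕ.+ n)) (λ j → (- 1#) ^ j * (q ^ 5) ^ tri j * X n ^ ((n ℕ.+ n) ℕ.∸ j) * Y n ^ j * qb (n ℕ.+ n) j)
        ≈⟨ ∑-cong< (suc (n ℕ.+ n)) (term n) ⟩
      ∑ (suc (n ℕ.+ n)) (λ j → prefactor n * (θ q r r′ (ℤ.- + n ℤ.+ + j) * qb (n ℕ.+ n) j))
        ≈⟨ *-∑ (suc (n ℕ.+ n)) (prefactor n) (λ j → θ q r r′ (ℤ.- + n ℤ.+ + j) * qb (n ℕ.+ n) j) ⟨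
      prefactor n * ∑ (suc (n ℕ.+ n)) (λ j → θ q r r′ (ℤ.- + n ℤ.+ + j) * qb (n ℕ.+ n) j) ∎)

    -- The finite identity is used at n = 2N. If |k| < N, then j = n + k and 2n - j are both at
    -- least N and the Gaussian binomial has reached its limit; if |k| ≥ N, the theta term itself is
    -- 0 modulo q^N, whatever it is multiplied by.
    limit : ∀ {p p′} → Π r 5 ⟶ p → Π r′ 5 ⟶ p′ → ∀ N → p * p′ * subQ5 E ≈[ N ] Θ N q r r′
    limit {p} {p′} lim lim′ N =
      ring.trans (ring.*-congʳ {subQ5 E} (⟶-* lim lim′ N n (ℕ.m≤m+n N N)))
      (ring.trans (≈⇒≈[] (trans (*-congʳ (finite n)) (trans (∑-* (suc (n ℕ.+ n)) (λ j → ϑ j * qb (n ℕ.+ n) j) (subQ5 E))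
        (∑-cong (suc (n ℕ.+ n)) (λ j → *-assoc (ϑ j) (qb (n ℕ.+ n) j) (subQ5 E))))))
      (ring.trans (∑-cong<[] (suc (n ℕ.+ n)) tail)
      (≡.subst₂ (_≈[ N ]_) (∑ℤ-transfer (ℤ.- + n) (suc (n ℕ.+ n)) q r r′) (∑ℤ-transfer (ℤ.- + N) (N ℕ.+ N) q r r′)
        (T.∑ℤ-window N (T.θ q r r′) vanishes (ℤ.- + n) (suc (n ℕ.+ n)) N (suc N) (l₁ (+ N)) (l₂ (+ N))))))
      where
      open Truncated N
      n : ℕ
      n = N ℕ.+ N
      ϑ : ℕ → Series
      ϑ j = θ q r r′ (ℤ.- + n ℤ.+ + j)
      vanishes : T.Vanishes N (T.θ q r r′)
      vanishes = T.θ-vanishes {q} q^N≈0 r r′ 1≤r 1≤r′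
      l₁ : ∀ N → ℤ.- N ≡ ℤ.- (N ℤ.+ N) ℤ.+ N
      l₁ = ℤ-solve
      l₂ : ∀ N → ℤ.- (N ℤ.+ N) ℤ.+ (+ 1 ℤ.+ (N ℤ.+ N ℤ.+ (N ℤ.+ N))) ≡ N ℤ.+ (+ 1 ℤ.+ N)
      l₂ = ℤ-solve
      far : ∀ j x → N ℕ.≤ ℤ.∣ ℤ.- + n ℤ.+ + j ∣ → ϑ j * x ≈[ N ] ϑ j
      far j x N≤k = ring.trans (ring.*-congʳ {x} z) (ring.trans (ring.zeroˡ x) (ring.sym z))
        where
        z : ϑ j ≈[ N ] 0#
        z = ≡.subst (_≈[ N ] 0#) (θ-transfer q r r′ (ℤ.- + n ℤ.+ + j)) (vanishes (ℤ.- + n ℤ.+ + j) N≤k)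
      tail : ∀ j → j ℕ.< suc (n ℕ.+ n) → ϑ j * (qb (n ℕ.+ n) j * subQ5 E) ≈[ N ] ϑ j
      tail j (ℕ.s≤s j≤2n) with N ℕ.≤? j | N ℕ.≤? (n ℕ.+ n) ℕ.∸ j
      ... | yes N≤j | yes N≤d = ring.trans (ring.*-congˡ {ϑ j} (qb-limit N≤j N≤d j≤2n)) (ring.*-identityʳ _)
      ... | no N≰j | _ = far j _ (≡.subst (N ℕ.≤_) (≡.sym (≡.trans (cong ℤ.∣_∣ (≡.trans (ℤ.-m+n≡n⊖m n j) (ℤ.⊖-≤ j≤n))) (ℤ.∣-i∣≡∣i∣ (+ (n ℕ.∸ j)))))
              (ℕ.≤-trans (ℕ.m≤m+n N (N ℕ.∸ j)) (ℕ.≤-reflexive (≡.sym (ℕ.+-∸-assoc N (ℕ.<⇒≤ (ℕ.≰⇒> N≰j)))))))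
        where
        j≤n : j ℕ.≤ n
        j≤n = ℕ.≤-trans (ℕ.<⇒≤ (ℕ.≰⇒> N≰j)) (ℕ.m≤m+n N N)
      ... | _ | no N≰d = far j _ (≡.subst (N ℕ.≤_) (≡.sym (cong ℤ.∣_∣ (≡.trans (ℤ.-m+n≡n⊖m n j) (ℤ.⊖-≥ n≤j)))) N≤j-n)
        where
        n+N≤j : n ℕ.+ N ℕ.≤ j
        n+N≤j = ℕ.+-cancelˡ-≤ N (n ℕ.+ N) j (ℕ.≤-trans (ℕ.≤-reflexive (lem N))
          (ℕ.≤-trans (ℕ.≤-reflexive (≡.sym (ℕ.m∸n+n≡m j≤2n))) (ℕ.+-monoˡ-≤ j (ℕ.<⇒≤ (ℕ.≰⇒> N≰d)))))
          where
          lem : ∀ N → N ℕ.+ (N ℕ.+ N ℕ.+ N) ≡ N ℕ.+ N ℕ.+ (N ℕ.+ N)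
          lem = ℕ-solve
        n≤j : n ℕ.≤ j
        n≤j = ℕ.≤-trans (ℕ.m≤m+n n N) n+N≤j
        N≤j-n : N ℕ.≤ j ℕ.∸ n
        N≤j-n = ℕ.≤-trans (ℕ.≤-reflexive (≡.sym (ℕ.m+n∸m≡n n N))) (ℕ.∸-monoˡ-≤ n n+N≤j)

  subQ5-eleven : ∀ f g → subQ5 (f ^ 10 - κ (+ 11) * (q * (g ^ 5 * f ^ 5)) - q ^ 2 * g ^ 10)
    ≈ subQ5 f ^ 10 - κ (+ 11) * (q ^ 5 * (subQ5 g ^ 5 * subQ5 f ^ 5)) - (q ^ 5) ^ 2 * subQ5 g ^ 10
  subQ5-eleven f g = trans (subQ5-+ _ _) (+-cong (trans (subQ5-+ _ _) (+-cong (subQ5-^ f 10)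
    (trans (subQ5-neg _) (-‿cong (trans (subQ5-* _ _) (*-cong (subQ5-κ (+ 11)) (trans (subQ5-* _ _)
      (*-cong subQ5-q (trans (subQ5-* _ _) (*-cong (subQ5-^ g 5) (subQ5-^ f 5)))))))))))
    (trans (subQ5-neg _) (-‿cong (trans (subQ5-* _ _) (*-cong (trans (subQ5-^ q 2) (^-congˡ 2 subQ5-q)) (subQ5-^ g 10))))))

  -- The theta functions of level five

  α β F₁ F₂ : Series
  α = qPoch 1 5 * qPoch 4 5
  β = qPoch 2 5 * qPoch 3 5
  F₁ = α * subQ5 E
  F₂ = β * subQ5 E

  euler : E ≈ α * β * subQ5 E
  euler = ⟶-unique (⟶-subsequence (ℕ._* 5) (λ K → ℕ.m≤m*n K 5) E-limit)
    (⟶-* (⟶-* (⟶-* (qPoch-limit 0 4) (qPoch-limit 3 4)) (⟶-* (qPoch-limit 1 4) (qPoch-limit 2 4))) (⟶-subQ5 E-limit))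
    (λ K → trans (∏-mod5 K _) (trans
      (*-cong (*-cong (*-cong (*-cong (s K 0) (s K 1)) (s K 2)) (s K 3)) (trans (s K 4) (Π₅ K)))
      (*-congʳ (rearrange (Π 1 5 K) (Π 2 5 K) (Π 3 5 K) (Π 4 5 K)))))
    where
    lem : ∀ j i → 1 ℕ.+ 1 ℕ.* (j ℕ.+ i ℕ.* 5) ≡ suc j ℕ.+ 5 ℕ.* i
    lem = ℕ-solve
    s : ∀ K j → ∏ K (λ i → 1# - q ^ (1 ℕ.+ 1 ℕ.* (j ℕ.+ i ℕ.* 5))) ≈ Π (suc j) 5 K
    s K j = ∏-cong K (λ i → +-congˡ (-‿cong (reflexive (cong (q ^_) (lem j i)))))

  theta₁ : ∀ N → F₁ ≈[ N ] Θ N q 1 4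
  theta₁ = JacobiTriple.limit 1 4 ≡.refl (ℕ.s≤s ℕ.z≤n) (ℕ.s≤s ℕ.z≤n) (qPoch-limit 0 4) (qPoch-limit 3 4)

  theta₂ : ∀ N → F₂ ≈[ N ] Θ N q 2 3
  theta₂ = JacobiTriple.limit 2 3 ≡.refl (ℕ.s≤s ℕ.z≤n) (ℕ.s≤s ℕ.z≤n) (qPoch-limit 1 4) (qPoch-limit 2 4)

  subQ5-Θ : ∀ N r r′ → subQ5 (Θ N q r r′) ≈ Θ N (q ^ 5) r r′
  subQ5-Θ N r r′ = trans (subQ5-∑ (N ℕ.+ N) _) (∑-cong (N ℕ.+ N) (λ i → θ-q⁵ (ℤ.- + N ℤ.+ + i)))
    where
    θ-q⁵ : ∀ k → subQ5 (θ q r r′ k) ≈ θ (q ^ 5) r r′ k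
    θ-q⁵ k = trans (subQ5-* _ _) (*-cong
      (trans (subQ5-^ (- 1#) ℤ.∣ k ∣) (^-congˡ ℤ.∣ k ∣ (trans (subQ5-neg 1#) (-‿cong subQ5-one))))
      (trans (subQ5-^ q (expo r r′ k)) (^-congˡ (expo r r′ k) subQ5-q)))

  theta-quadratic : F₁ * F₂ ≈ subQ5 F₂ * subQ5 F₂ - q * (subQ5 F₁ * subQ5 F₂) - q ^ 2 * (subQ5 F₁ * subQ5 F₁)
  theta-quadratic .at n = mod (suc n) .at< n ℕ.≤-refl
    where
    mod : ∀ N → F₁ * F₂ ≈[ N ] subQ5 F₂ * subQ5 F₂ - q * (subQ5 F₁ * subQ5 F₂) - q ^ 2 * (subQ5 F₁ * subQ5 F₁)
    mod N = ring.trans (ring.*-cong (level₁ 1 4 (theta₁ N)) (level₁ 2 3 (theta₂ N)))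
      (ring.trans Θ-quadratic (ring.sym (ring.+-cong (ring.+-cong (ring.*-cong t₂ t₂)
        (ring.-‿cong (ring.*-congˡ {q} (ring.*-cong t₁ t₂)))) (ring.-‿cong (ring.*-congˡ {q ^ 2} (ring.*-cong t₁ t₁))))))
      where
      open Truncated N
      open T.Lattice q N q^N≈0
      level₁ : ∀ r r′ {f} → f ≈[ N ] Θ N q r r′ → f ≈[ N ] T.Θ N q r r′
      level₁ r r′ {f} = ≡.subst (f ≈[ N ]_) (≡.sym (∑ℤ-transfer (ℤ.- + N) (N ℕ.+ N) q r r′))
      level₅ : ∀ r r′ {f} → f ≈[ N ] Θ N q r r′ → subQ5 f ≈[ N ] T.Θ N Q r r′
      level₅ r r′ {f} p = ≡.subst (subQ5 f ≈[ N ]_) (≡.sym (∑ℤ-transfer (ℤ.- + N) (N ℕ.+ N) Q r r′))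
        (ring.trans (subQ5-cong[] p) (≈⇒≈[] (subQ5-Θ N r r′)))
      t₁ = level₅ 1 4 (theta₁ N)
      t₂ = level₅ 2 3 (theta₂ N)

  -- F₁ F₂ consists of the four products over nonzero residues and of E(q⁵)². The former reappear at
  -- q⁵; the latter lies in ℤ[[q⁵]], so its norm is E(q⁵)¹⁰.
  norm-product : Norm (F₁ * F₂) ≈ subQ5 (α * β * E ^ 10)
  norm-product = begin
    Norm (F₁ * F₂)
      ≈⟨ Norm-cong (arrange (qPoch 1 5) (qPoch 4 5) (qPoch 2 5) (qPoch 3 5) (subQ5 E)) ⟩
    Norm (1# * qPoch 1 5 * qPoch 4 5 * qPoch 2 5 * qPoch 3 5 * subQ5 E * subQ5 E)
      ≈⟨ ⟶-unique
           (⟶-Norm (⟶-* (⟶-* (⟶-* (⟶-* (⟶-* (⟶-* one-limit (qPoch-limit 0 4)) (qPoch-limit 3 4)) (qPoch-limit 1 4)) (qPoch-limit 2 4)) Π₅-limit) Π₅-limit))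
           (⟶-* (⟶-* (⟶-* (⟶-* (⟶-* (⟶-* one-limit (⟶-subQ5 (qPoch-limit 0 4))) (⟶-subQ5 (qPoch-limit 3 4))) (⟶-subQ5 (qPoch-limit 1 4))) (⟶-subQ5 (qPoch-limit 2 4)))
             (⟶-^ 5 Π₅-limit)) (⟶-^ 5 Π₅-limit))
           finite-norm ⟩
    1# * subQ5 (qPoch 1 5) * subQ5 (qPoch 4 5) * subQ5 (qPoch 2 5) * subQ5 (qPoch 3 5) * subQ5 E ^ 5 * subQ5 E ^ 5
      ≈⟨ arrange′ _ _ _ _ (subQ5 E) ⟩
    (subQ5 (qPoch 1 5) * subQ5 (qPoch 4 5)) * (subQ5 (qPoch 2 5) * subQ5 (qPoch 3 5)) * subQ5 E ^ 10
      ≈⟨ *-cong (*-cong (subQ5-* _ _) (subQ5-* _ _)) (subQ5-^ E 10) ⟨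
    subQ5 α * subQ5 β * subQ5 (E ^ 10)
      ≈⟨ trans (subQ5-* _ _) (*-congʳ (subQ5-* _ _)) ⟨
    subQ5 (α * β * E ^ 10) ∎
    where
    one-limit : (λ _ → 1#) ⟶ 1#
    one-limit N K _ = Mod.refl N
    ⟶-^ : ∀ n {F f} → F ⟶ f → (λ K → F K ^ n) ⟶ (f ^ n)
    ⟶-^ zero    p = one-limit
    ⟶-^ (suc n) p = ⟶-* p (⟶-^ n p)
    finite-norm : ∀ K → Norm (1# * Π 1 5 K * Π 4 5 K * Π 2 5 K * Π 3 5 K * Π 5 5 K * Π 5 5 K)
      ≈ 1# * subQ5 (Π 1 5 K) * subQ5 (Π 4 5 K) * subQ5 (Π 2 5 K) * subQ5 (Π 3 5 K) * Π 5 5 K ^ 5 * Π 5 5 K ^ 5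
    finite-norm K =
      trans (Norm-Π₅ K _) (*-congʳ (trans (Norm-Π₅ K _) (*-congʳ
      (trans (Norm-Π 3 (ℕ.s≤s ℕ.z≤n) (ℕ.s≤s (ℕ.s≤s (ℕ.s≤s ℕ.z≤n))) K _) (*-congʳ
      (trans (Norm-Π 2 (ℕ.s≤s ℕ.z≤n) (ℕ.s≤s (ℕ.s≤s ℕ.z≤n)) K _) (*-congʳ
      (trans (Norm-Π 4 (ℕ.s≤s ℕ.z≤n) ℕ.≤-refl K _) (*-congʳ
      (trans (Norm-Π 1 ℕ.≤-refl (ℕ.s≤s ℕ.z≤n) K _) (*-congʳ Norm-one)))))))))))

  -- In `theta-quadratic` the powers 1, q, q² multiply series in q⁵, so the sections of F₁ F₂ can be
  -- read off and two of them vanish.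
  norm-trinomial : Norm (F₁ * F₂) ≈ subQ5 (F₂ ^ 10 - κ (+ 11) * (q * (F₁ ^ 5 * F₂ ^ 5)) - q ^ 2 * F₁ ^ 10)
  norm-trinomial = begin
    Norm (F₁ * F₂)
      ≈⟨ Norm-cong (trans theta-quadratic (+-cong (+-cong (sym (subQ5-* F₂ F₂))
           (-‿cong (*-cong (sym (*-identityʳ q)) (sym (subQ5-* F₁ F₂))))) (-‿cong (*-congˡ (sym (subQ5-* F₁ F₁)))))) ⟩
    -- `q ^ 1` instead of `q`, so that `part-q^` treats both terms alike.
    Norm (A - q ^ 1 * B - q ^ 2 * G)
      ≈⟨ Nm-cong
           (trans (sections 0) (trans (+-cong (+-cong (part-subQ5 (F₂ * F₂)) (-‿cong (*-cong (*-identityʳ q) (z 3 (F₁ * F₂) ℕ.≤-refl)))) (-‿cong (*-congˡ (z 2 (F₁ * F₁) 3≤4)))) (section₀ A q)))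
           (trans (sections 1) (trans (+-cong (+-cong (z 0 (F₂ * F₂) 1≤4) (-‿cong (*-cong (*-identityʳ q) (part-subQ5 (F₁ * F₂))))) (-‿cong (*-congˡ (z 3 (F₁ * F₁) ℕ.≤-refl)))) (section₁ B q)))
           (trans (sections 2) (trans (+-cong (+-cong (z 1 (F₂ * F₂) 2≤4) (-‿cong (*-cong (*-identityʳ q) (z 0 (F₁ * F₂) 1≤4)))) (-‿cong (*-congˡ (part-subQ5 (F₁ * F₁))))) (section₂ G q)))
           (trans (sections 3) (trans (+-cong (+-cong (z 2 (F₂ * F₂) 3≤4) (-‿cong (*-cong (*-identityʳ q) (z 1 (F₁ * F₂) 2≤4)))) (-‿cong (*-congˡ (z 0 (F₁ * F₁) 1≤4)))) (section₃ q)))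
           (trans (sections 4) (trans (+-cong (+-cong (z 3 (F₂ * F₂) ℕ.≤-refl) (-‿cong (*-cong (*-identityʳ q) (z 2 (F₁ * F₂) 3≤4)))) (-‿cong (*-congˡ (z 1 (F₁ * F₁) 2≤4)))) (section₃ q))) ⟩
    Nm A (- (q * B)) (- (q ^ 2 * G)) (κ (+ 0)) (κ (+ 0))
      ≈⟨ Nm-cong (subQ5-* F₂ F₂) (-‿cong (*-congˡ (subQ5-* F₁ F₂))) (-‿cong (*-congˡ (subQ5-* F₁ F₁))) refl refl ⟩
    Nm (f₂ * f₂) (- (q * (f₁ * f₂))) (- (q ^ 2 * (f₁ * f₁))) (κ (+ 0)) (κ (+ 0))
      ≈⟨ Nm-trinomial f₂ f₁ q ⟩
    f₂ ^ 10 - κ (+ 11) * (q ^ 5 * (f₁ ^ 5 * f₂ ^ 5)) - (q ^ 5) ^ 2 * f₁ ^ 10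
      ≈⟨ subQ5-eleven F₂ F₁ ⟨
    subQ5 (F₂ ^ 10 - κ (+ 11) * (q * (F₁ ^ 5 * F₂ ^ 5)) - q ^ 2 * F₁ ^ 10) ∎
    where
    A B G f₁ f₂ : Series
    A = subQ5 (F₂ * F₂)
    B = subQ5 (F₁ * F₂)
    G = subQ5 (F₁ * F₁)
    f₁ = subQ5 F₁
    f₂ = subQ5 F₂
    1≤4 : 1 ℕ.≤ 4
    1≤4 = ℕ.s≤s ℕ.z≤n
    2≤4 : 2 ℕ.≤ 4
    2≤4 = ℕ.s≤s 1≤3 where 1≤3 = ℕ.s≤s ℕ.z≤n
    3≤4 : 3 ℕ.≤ 4
    3≤4 = ℕ.n≤1+n 3
    z : ∀ r f → r ℕ.< 4 → part (suc r) (subQ5 f) ≈ κ (+ 0)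
    z = part-subQ5-suc
    sections : ∀ r → part r (A - q ^ 1 * B - q ^ 2 * G) ≈ part r A - q ^ 1 * part (prevs 1 r) B - q ^ 2 * part (prevs 2 r) G
    sections r = trans (part-difference r (A - q ^ 1 * B) (q ^ 2 * G))
      (+-cong (trans (part-difference r A (q ^ 1 * B)) (+-congˡ (-‿cong (part-q^ 1 r B)))) (-‿cong (part-q^ 2 r G)))

  -- Both evaluations of the norm are series in q⁵, so the substitution can be undone by
  -- injectivity.
  eleven : β ^ 10 - κ (+ 11) * (q * (α ^ 5 * β ^ 5)) - q ^ 2 * α ^ 10 ≈ (α * β) ^ 11
  eleven = eleven-from-norm (inv-inverseˡ (subQ5 E) ≡.refl) euler
    (subQ5-injective (trans (sym norm-product) norm-trinomial))

  quadratic : α * β * (subQ5 α * subQ5 β) ^ 2 ≈ quad (subQ5 β) (q * subQ5 α)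
  quadratic = quadratic-from-theta (inv-inverseˡ (subQ5 (subQ5 E)) ≡.refl)
    (trans (subQ5-cong euler) (trans (subQ5-* _ _) (*-congʳ (subQ5-* _ _))))
    (trans theta-quadratic (+-cong (+-cong (*-cong s₂ s₂) (-‿cong (*-congˡ (*-cong s₁ s₂)))) (-‿cong (*-congˡ (*-cong s₁ s₁)))))
    where
    s₁ = subQ5-* α (subQ5 E)
    s₂ = subQ5-* β (subQ5 E)

  -- Series with nonnegative coefficients

  record NonNeg (f : Series) : Set where
    constructor mkNonNeg
    field coeff≥0 : ∀ n → + 0 ℤ.≤ f n
  open NonNeg

  NonNeg-cong : ∀ {f g} → f ≈ g → NonNeg f → NonNeg g
  NonNeg-cong p f≥0 .coeff≥0 n = ≡.subst (+ 0 ℤ.≤_) (p .at n) (f≥0 .coeff≥0 n)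

  NonNeg-limit : ∀ {F f} → F ⟶ f → (∀ K → NonNeg (F K)) → NonNeg f
  NonNeg-limit F⟶f F≥0 .coeff≥0 n =
    ≡.subst (+ 0 ℤ.≤_) (≡.sym (F⟶f (suc n) (suc n) ℕ.≤-refl .at< n ℕ.≤-refl)) (F≥0 (suc n) .coeff≥0 n)

  NonNeg-+ : ∀ {f g} → NonNeg f → NonNeg g → NonNeg (f + g)
  NonNeg-+ {f} {g} f≥0 g≥0 .coeff≥0 n =
    ≡.subst (+ 0 ℤ.≤_) (≡.sym (+ˢ-at f g n)) (ℤ.+-mono-≤ (f≥0 .coeff≥0 n) (g≥0 .coeff≥0 n))

  0≤-* : ∀ {i j} → + 0 ℤ.≤ i → + 0 ℤ.≤ j → + 0 ℤ.≤ i ℤ.* j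
  0≤-* {+ m} {+ n} _ _ = ≡.subst (+ 0 ℤ.≤_) (ℤ.pos-* m n) (ℤ.+≤+ ℕ.z≤n)

  NonNeg-* : ∀ {f g} → NonNeg f → NonNeg g → NonNeg (f * g)
  NonNeg-* {f} {g} f≥0 g≥0 .coeff≥0 n = go n f f≥0
    where
    go : ∀ n f → NonNeg f → + 0 ℤ.≤ (f * g) n
    go zero    f f≥0 = ≡.subst (+ 0 ℤ.≤_) (≡.sym (*ˢ-zero f g)) (0≤-* (f≥0 .coeff≥0 0) (g≥0 .coeff≥0 0))
    go (suc n) f f≥0 = ≡.subst (+ 0 ℤ.≤_) (≡.sym (*ˢ-suc f g n))
      (ℤ.+-mono-≤ (0≤-* (f≥0 .coeff≥0 0) (g≥0 .coeff≥0 (suc n))) (go n (tl f) (mkNonNeg λ m → f≥0 .coeff≥0 (suc m))))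

  NonNeg-κ : ∀ c → NonNeg (κ (+ c))
  NonNeg-κ c .coeff≥0 zero    = ℤ.+≤+ ℕ.z≤n
  NonNeg-κ c .coeff≥0 (suc n) = ℤ.+≤+ ℕ.z≤n

  NonNeg-one : NonNeg 1#
  NonNeg-one = NonNeg-cong (sym one≈κ1) (NonNeg-κ 1)

  NonNeg-q : NonNeg q
  NonNeg-q .coeff≥0 zero    = ℤ.+≤+ ℕ.z≤n
  NonNeg-q .coeff≥0 (suc n) = NonNeg-one .coeff≥0 n

  NonNeg-^ : ∀ {f} n → NonNeg f → NonNeg (f ^ n)
  NonNeg-^ zero    _   = NonNeg-one
  NonNeg-^ (suc n) f≥0 = NonNeg-* f≥0 (NonNeg-^ n f≥0)

  -- Strong induction: the equation gives coefficient n of g from that of h and from coefficient n -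
  -- m - 1 of g. This is how h / (1 - q^(m+1)) is handled without a geometric series.
  NonNeg-fixpoint : ∀ {g h} m → NonNeg h → g ≈ h + q ^ suc m * g → NonNeg g
  NonNeg-fixpoint {g} {h} m h≥0 eq .coeff≥0 n = go (suc n) n ℕ.≤-refl
    where
    unfold : ∀ n → g n ≡ h n ℤ.+ (q ^ suc m * g) n
    unfold n = ≡.trans (eq .at n) (+ˢ-at h (q ^ suc m * g) n)
    go : ∀ N n → n ℕ.< N → + 0 ℤ.≤ g n
    go (suc N) n (ℕ.s≤s n≤N) with suc m ℕ.≤? n
    ... | no m≰n = ≡.subst (+ 0 ℤ.≤_) (≡.sym (≡.trans (unfold n) (≡.trans
          (cong (λ x → h n ℤ.+ x) (q^-*-low (suc m) g n (ℕ.≰⇒> m≰n))) (ℤ.+-identityʳ _)))) (h≥0 .coeff≥0 n)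
    ... | yes m<n = ≡.subst (+ 0 ℤ.≤_) (≡.sym (≡.trans (unfold n) (cong (λ x → h n ℤ.+ x) (≡.trans
          (cong (q ^ suc m * g) (≡.sym (ℕ.m+[n∸m]≡n m<n))) (q^-*-high (suc m) g (n ℕ.∸ suc m))))))
          (ℤ.+-mono-≤ (h≥0 .coeff≥0 n) (go N (n ℕ.∸ suc m)
            (ℕ.<-≤-trans (ℕ.∸-monoʳ-< {o = 0} (ℕ.s≤s ℕ.z≤n) m<n) n≤N)))

  -- Bounds for a product of factors 1 - q^k and its inverse

  u : ℕ → Series
  u zero    = κ (+ 0)
  u (suc m) = u m + q ^ suc m

  NonNeg-u : ∀ m → NonNeg (u m)
  NonNeg-u zero    = NonNeg-κ 0
  NonNeg-u (suc m) = NonNeg-+ (NonNeg-u m) (NonNeg-^ (suc m) NonNeg-q)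

  -- f is a product of factors 1 - q^k with 1 ≤ k ≤ m, and g is its inverse.
  record Bounded (v : Series) (m : ℕ) (f g : Series) : Set where
    field
      inverse : g * f ≈ 1#
      nonneg  : NonNeg g
      minus   : NonNeg (g - f)
      plus    : NonNeg (g + f)
      lower   : NonNeg (g - v)
      bound   : NonNeg (u m * g - (1# - f))
  open Bounded

  module _ {v : Series} {m : ℕ} {f g : Series} (b : Bounded v m f g) where

    skip : Bounded v (suc m) f g
    skip = record
      { inverse = b .inverse ; nonneg = b .nonneg ; minus = b .minus ; plus = b .plus ; lower = b .lower
      ; bound = NonNeg-cong (skip-bound f g (u m) (q ^ suc m))
                  (NonNeg-+ (b .bound) (NonNeg-* (NonNeg-^ (suc m) NonNeg-q) (b .nonneg))) }

    private
      x i : Series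
      x = q ^ suc m
      i = inv (1# - x)

      x≥0 : NonNeg x
      x≥0 = NonNeg-^ (suc m) NonNeg-q

      i-inverse : i * (1# - x) ≈ 1#
      i-inverse = inv-inverseˡ (1# - x) (-ˢ-q^-at 1# (suc m) 0)

      g′≥0 : NonNeg (g * i)
      g′≥0 = NonNeg-fixpoint m (b .nonneg) (divide-unfold i-inverse g)

      xg′≥0 : NonNeg (x * (g * i))
      xg′≥0 = NonNeg-* x≥0 g′≥0

    step : Bounded v (suc m) (f * (1# - q ^ suc m)) (g * inv (1# - q ^ suc m))
    step = record
      { inverse = divide-inverse i-inverse (b .inverse)
      ; nonneg  = g′≥0
      ; minus   = NonNeg-cong (divide-minus i-inverse f g) (NonNeg-+ (b .minus) (NonNeg-* x≥0 (NonNeg-+ (b .plus) xg′≥0)))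
      ; plus    = NonNeg-cong (divide-plus i-inverse f g) (NonNeg-+ (b .plus) (NonNeg-* x≥0 (NonNeg-+ (b .minus) xg′≥0)))
      ; lower   = NonNeg-cong (divide-lower i-inverse g v) (NonNeg-+ (b .lower) xg′≥0)
      ; bound   = NonNeg-cong (divide-bound i-inverse f g (u m)) (NonNeg-+ (b .bound)
          (NonNeg-+ (NonNeg-* x≥0 (NonNeg-* (NonNeg-u m) g′≥0)) (NonNeg-* x≥0 (NonNeg-+ (b .minus) xg′≥0)))) }

  start₀ : Bounded 1# 0 1# 1#
  start₀ = record
    { inverse = *-identityˡ 1# ; nonneg = NonNeg-one
    ; minus = NonNeg-cong (sym start-minus) (NonNeg-κ 0) ; plus = NonNeg-+ NonNeg-one NonNeg-one
    ; lower = NonNeg-cong (sym start-minus) (NonNeg-κ 0) ; bound = NonNeg-cong (sym start-bound) (NonNeg-κ 0) }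

  o : Series
  o _ = + 1

  o-unfold : o ≈ 1# + q * o
  o-unfold .at n = ≡.sym (≡.trans (+ˢ-at 1# (q * o) n) (≡.trans (cong (λ x → one n ℤ.+ x) (q-* o .at n)) (lem n)))
    where
    lem : ∀ n → one n ℤ.+ shift o n ≡ + 1
    lem zero    = ≡.refl
    lem (suc n) = ≡.refl

  NonNeg-o : NonNeg o
  NonNeg-o .coeff≥0 n = ℤ.+≤+ ℕ.z≤n

  -- For α the induction begins with the factor 1 - q already present, so that its inverse `o`, all
  -- of whose coefficients are 1, is the lower bound carried along.
  start₁ : Bounded o 1 (1# - q ^ 1) o
  start₁ = record
    { inverse = trans (*-congˡ q¹) (geometric-inverse o-unfold)
    ; nonneg  = NonNeg-o
    ; minus   = NonNeg-cong (trans (geometric-minus o-unfold) (+-congˡ (-‿cong (sym q¹)))) (NonNeg-+ (NonNeg-* NonNeg-q NonNeg-o) NonNeg-q)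
    ; plus    = NonNeg-cong (trans (geometric-plus o-unfold) (+-congˡ (sym q¹)))
                  (NonNeg-+ (NonNeg-+ NonNeg-one NonNeg-one) (NonNeg-* NonNeg-q (NonNeg-* NonNeg-q NonNeg-o)))
    ; lower   = NonNeg-cong (sym (-‿inverseʳ o)) (NonNeg-κ 0)
    ; bound   = NonNeg-cong (trans (geometric-bound o-unfold) (+-congˡ (-‿cong (+-congˡ (-‿cong (sym q¹))))))
                  (NonNeg-* NonNeg-q (NonNeg-* NonNeg-q NonNeg-o)) }
    where
    q¹ : 1# - q ^ 1 ≈ 1# - q
    q¹ = +-congˡ (-‿cong (*-identityʳ q))

  Bounded-cong : ∀ {v m n f f′ g} → m ≡ n → f ≈ f′ → Bounded v m f g → Bounded v n f′ g
  Bounded-cong ≡.refl p b = record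
    { inverse = trans (*-congˡ (sym p)) (b .inverse) ; nonneg = b .nonneg
    ; minus = NonNeg-cong (+-congˡ (-‿cong p)) (b .minus) ; plus = NonNeg-cong (+-congˡ p) (b .plus)
    ; lower = b .lower ; bound = NonNeg-cong (+-congˡ (-‿cong (+-congˡ (-‿cong p)))) (b .bound) }

  -- The exponents 5K + 1 to 5K + 5 are treated in order: skip, step, step, skip, skip.
  β-bounded : ∀ K → ∃ λ g → Bounded 1# (5 ℕ.* K) (Π 2 5 K * Π 3 5 K) g
  β-bounded zero = 1# , Bounded-cong ≡.refl (sym (*-identityˡ 1#)) start₀
  β-bounded (suc K) with β-bounded K
  ... | g , b = _ , Bounded-cong (lem K) (trans (*-assoc _ _ _) (trans (interchange _ _ _ _)
        (*-cong (sym (∏-snoc K _)) (sym (∏-snoc K _))))) (skip (skip (step (step (skip b)))))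
    where
    lem : ∀ K → 5 ℕ.+ 5 ℕ.* K ≡ 5 ℕ.* suc K
    lem = ℕ-solve

  -- A round ends at exponent 1 + 5K, so the product over residue 1 is one factor ahead. The next
  -- exponents 5K + 2 to 5K + 6 are skip, skip, step, skip, step.
  α-bounded : ∀ K → ∃ λ g → Bounded o (1 ℕ.+ 5 ℕ.* K) (Π 1 5 (suc K) * Π 4 5 K) g
  α-bounded zero = o , Bounded-cong ≡.refl (sym (trans (*-identityʳ _) (*-identityʳ _))) start₁
  α-bounded (suc K) with α-bounded K
  ... | g , b = _ , Bounded-cong (lem K) (begin
        Π 1 5 (suc K) * Π 4 5 K * (1# - q ^ (4 ℕ.+ 5 ℕ.* K)) * (1# - q ^ (6 ℕ.+ 5 ℕ.* K))
          ≈⟨ trans (*-congʳ (*-assoc _ _ _)) (*-cong (*-congˡ (sym (∏-snoc K _))) (+-congˡ (-‿cong (pow (lem K))))) ⟩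
        Π 1 5 (suc K) * Π 4 5 (suc K) * (1# - q ^ (1 ℕ.+ 5 ℕ.* suc K))
          ≈⟨ trans (*-assoc _ _ _) (trans (*-congˡ (*-comm _ _)) (sym (*-assoc _ _ _))) ⟩
        Π 1 5 (suc K) * (1# - q ^ (1 ℕ.+ 5 ℕ.* suc K)) * Π 4 5 (suc K)
          ≈⟨ *-congʳ (∏-snoc (suc K) (λ k → 1# - q ^ (1 ℕ.+ 5 ℕ.* k))) ⟨
        Π 1 5 (suc (suc K)) * Π 4 5 (suc K) ∎) (step (skip (step (skip (skip b)))))
    where
    lem : ∀ K → 6 ℕ.+ 5 ℕ.* K ≡ 1 ℕ.+ 5 ℕ.* suc K
    lem = ℕ-solve

  ⟶-inv : ∀ {F G f} → F ⟶ f → (∀ K → G K * F K ≈ 1#) → f 0 ≡ + 1 → G ⟶ inv f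
  ⟶-inv {F} {G} {f} F⟶f GF≈1 f₀ N K N≤K = RingTheory.*-cancel (series/ N) (κ-hom/ N) {inv f} {f} (inv f) (G K)
    (≈⇒≈[] (inv-inverseˡ f f₀))
    (Mod.trans N (≈⇒≈[] (trans (inv-inverseʳ f f₀) (trans (sym (GF≈1 K)) (*-comm _ _))))
      (Mod.*-congʳ N {G K} (Mod.sym N (F⟶f N K N≤K))))

  a b : Series
  a = inv α
  b = inv β

  α₀ : α 0 ≡ + 1
  α₀ = *ˢ-zero (qPoch 1 5) (qPoch 4 5)

  β₀ : β 0 ≡ + 1
  β₀ = *ˢ-zero (qPoch 2 5) (qPoch 3 5)

  b≥0 : NonNeg b
  b≥0 = NonNeg-limit (⟶-inv (⟶-* (qPoch-limit 1 4) (qPoch-limit 2 4)) (λ K → proj₂ (β-bounded K) .inverse) β₀)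
    (λ K → proj₂ (β-bounded K) .nonneg)

  private
    α-limit : (λ K → Π 1 5 (suc K) * Π 4 5 K) ⟶ α
    α-limit = ⟶-* (⟶-subsequence suc ℕ.n≤1+n (qPoch-limit 0 4)) (qPoch-limit 3 4)

    a-limit : (λ K → proj₁ (α-bounded K)) ⟶ a
    a-limit = ⟶-inv α-limit (λ K → proj₂ (α-bounded K) .inverse) α₀

    const-limit : ∀ f → (λ _ → f) ⟶ f
    const-limit f N K _ = Mod.refl N

    ⟶-+ : ∀ {F G f g} → F ⟶ f → G ⟶ g → (λ K → F K + G K) ⟶ (f + g)
    ⟶-+ p r N K N≤K = Mod.+-cong N (p N K N≤K) (r N K N≤K)

    ⟶-neg : ∀ {F f} → F ⟶ f → (λ K → - F K) ⟶ (- f)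
    ⟶-neg p N K N≤K = Mod.-‿cong N (p N K N≤K)

  a≥0 : NonNeg a
  a≥0 = NonNeg-limit a-limit (λ K → proj₂ (α-bounded K) .nonneg)

  a≥o : NonNeg (a - o)
  a≥o = NonNeg-limit (⟶-+ a-limit (const-limit (- o))) (λ K → proj₂ (α-bounded K) .lower)

  u-tail : ∀ m → u m + q ^ suc m * o ≈ q * o
  u-tail zero    = trans (+-identityˡ _) (*-congʳ (*-identityʳ q))
  u-tail (suc m) = trans (sym (tail-unfold o-unfold (u m) (q ^ suc m))) (u-tail m)

  -- The finite bounds give 1 - α ≤ (q + ... + q^m) a. Adding the tail q^(m+1) `o` makes the left
  -- factor q `o` independent of m, so the limit can be taken; finally `o` ≤ a.
  1-α≤qa² : NonNeg (q * (a * a) - (1# - α))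
  1-α≤qa² = NonNeg-cong (square-bound q o a α) (NonNeg-+ (NonNeg-* NonNeg-q (NonNeg-* a≥o a≥0))
    (NonNeg-limit (⟶-+ (⟶-* (const-limit (q * o)) a-limit) (⟶-neg (⟶-+ (const-limit 1#) (⟶-neg α-limit)))) finite))
    where
    finite : ∀ K → NonNeg (q * o * proj₁ (α-bounded K) - (1# - Π 1 5 (suc K) * Π 4 5 K))
    finite K = let g , bd = α-bounded K ; m = 1 ℕ.+ 5 ℕ.* K in
      NonNeg-cong (trans (skip-bound (Π 1 5 (suc K) * Π 4 5 K) g (u m) (q ^ suc m * o)) (+-congʳ (*-congʳ (u-tail m))))
        (NonNeg-+ (bd .bound) (NonNeg-* (NonNeg-* (NonNeg-^ (suc m) NonNeg-q) NonNeg-o) (bd .nonneg)))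

  -- Strictly positive coefficients

  record Pos (f : Series) : Set where
    constructor mkPos
    field coeff≥1 : ∀ n → + 1 ℤ.≤ f n
  open Pos

  record Unital (f : Series) : Set where
    constructor mkUnital
    field
      nonneg   : NonNeg f
      constant : f 0 ≡ + 1
  open Unital

  Unital-* : ∀ {f g} → Unital f → Unital g → Unital (f * g)
  Unital-* {f} {g} f₁ g₁ = mkUnital (NonNeg-* (f₁ .nonneg) (g₁ .nonneg))
    (≡.trans (*ˢ-zero f g) (cong₂ ℤ._*_ (f₁ .constant) (g₁ .constant)))

  Unital-^ : ∀ {f} n → Unital f → Unital (f ^ n)
  Unital-^ zero    _  = mkUnital NonNeg-one ≡.refl
  Unital-^ (suc n) f₁ = Unital-* f₁ (Unital-^ n f₁)

  Unital-1 : ∀ {f} → Unital f → NonNeg (f - 1#)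
  Unital-1 {f} f₁ .coeff≥0 n = ≡.subst (+ 0 ℤ.≤_) (≡.sym (≡.trans (+ˢ-at f (- 1#) n) (cong (λ x → f n ℤ.+ x) (-ˢ-at 1# n)))) (go n)
    where
    go : ∀ n → + 0 ℤ.≤ f n ℤ.- one n
    go zero    = ≡.subst (λ x → + 0 ℤ.≤ x ℤ.- + 1) (≡.sym (f₁ .constant)) ℤ.≤-refl
    go (suc n) = ≡.subst (+ 0 ℤ.≤_) (≡.sym (ℤ.+-identityʳ (f (suc n)))) (f₁ .nonneg .coeff≥0 (suc n))

  Pos-cong : ∀ {f g} → f ≈ g → Pos f → Pos g
  Pos-cong p f>0 .coeff≥1 n = ≡.subst (+ 1 ℤ.≤_) (p .at n) (f>0 .coeff≥1 n)

  Pos-+ : ∀ {f g} → Pos f → NonNeg g → Pos (f + g)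
  Pos-+ {f} {g} f>0 g≥0 .coeff≥1 n =
    ≡.subst (+ 1 ℤ.≤_) (≡.sym (+ˢ-at f g n)) (ℤ.+-mono-≤ (f>0 .coeff≥1 n) (g≥0 .coeff≥0 n))

  Pos-* : ∀ {f g} → Unital f → Pos g → Pos (f * g)
  Pos-* {f} {g} f₁ g>0 .coeff≥1 zero = ≡.subst (+ 1 ℤ.≤_)
    (≡.sym (≡.trans (*ˢ-zero f g) (≡.trans (cong (ℤ._* g 0) (f₁ .constant)) (ℤ.*-identityˡ (g 0))))) (g>0 .coeff≥1 0)
  Pos-* {f} {g} f₁ g>0 .coeff≥1 (suc n) = ≡.subst (+ 1 ℤ.≤_)
    (≡.sym (≡.trans (*ˢ-suc f g n) (cong (ℤ._+ (tl f * g) n) (≡.trans (cong (ℤ._* g (suc n)) (f₁ .constant)) (ℤ.*-identityˡ (g (suc n)))))))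
    (ℤ.+-mono-≤ (g>0 .coeff≥1 (suc n)) (NonNeg-* {tl f} {g} (mkNonNeg λ m → f₁ .nonneg .coeff≥0 (suc m))
      (mkNonNeg λ m → ℤ.≤-trans (ℤ.+≤+ ℕ.z≤n) (g>0 .coeff≥1 m)) .coeff≥0 n))

  Pos-κ-* : ∀ c {f} → Pos f → Pos (κ (+ suc c) * f)
  Pos-κ-* c {f} f>0 .coeff≥1 n with f n | f>0 .coeff≥1 n | κ-*ˢ (+ suc c) f .at n
  ... | + suc m | _ | eq = ≡.subst (+ 1 ℤ.≤_) (≡.sym eq) (ℤ.+≤+ (ℕ.s≤s ℕ.z≤n))
  ... | + 0     | ℤ.+≤+ () | _

  Pos⇒>0 : ∀ {f} → Pos f → ∀ n → f n ℤ.> + 0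
  Pos⇒>0 f>0 n = ℤ.<-≤-trans (ℤ.+<+ (ℕ.s≤s ℕ.z≤n)) (f>0 .coeff≥1 n)

  κ-neg-*<0 : ∀ c {f} → Pos f → ∀ n → (κ -[1+ c ] * f) n ℤ.< + 0
  κ-neg-*<0 c {f} f>0 n with f n | f>0 .coeff≥1 n | κ-*ˢ -[1+ c ] f .at n
  ... | + suc m | _ | eq = ≡.subst (ℤ._< + 0) (≡.sym eq) ℤ.-<+
  ... | + 0     | ℤ.+≤+ () | _

  Pos-a : Pos a
  Pos-a .coeff≥1 n = ℤ.0≤i-j⇒j≤i (≡.subst (+ 0 ℤ.≤_)
    (≡.trans (+ˢ-at a (- o) n) (cong (λ x → a n ℤ.+ x) (-ˢ-at o n))) (a≥o .coeff≥0 n))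

  Unital-a : Unital a
  Unital-a = mkUnital a≥0 ≡.refl

  Unital-b : Unital b
  Unital-b = mkUnital b≥0 ≡.refl

  -- One factor `a` supplies strict positivity, since its coefficients dominate those of 1 / (1 -
  -- q). The series `b` cannot do so: its coefficient at q is 0.
  Pos-monomial : ∀ i j → Pos (a ^ suc i * b ^ j)
  Pos-monomial i j = Pos-cong (trans (*-comm _ _) (sym (*-assoc _ _ _)))
    (Pos-* (Unital-* (Unital-^ i Unital-a) (Unital-^ j Unital-b)) Pos-a)

  NonNeg-monomial : ∀ i j → NonNeg (a ^ i * b ^ j)
  NonNeg-monomial i j = NonNeg-* (NonNeg-^ i a≥0) (NonNeg-^ j b≥0)

  h₁ h₂ h₃ h₄ : Series
  h₁ = b * α + κ (+ 8) * (q * (a ^ 5 * b ^ 7)) + q ^ 2 * b ^ 12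
  h₂ = κ (+ 3) * (a ^ 9 * b ^ 3) + q * (a ^ 4 * b ^ 8)
  h₃ = κ (+ 3) * (a ^ 8 * b ^ 4) + q * (a ^ 3 * b ^ 9)
  h₄ = κ (+ 8) * (a ^ 7 * b ^ 5) + q * (a ^ 2 * b ^ 10)

  Pos-h₁ : Pos h₁
  Pos-h₁ = Pos-cong (first-component a b α q) (Pos-+ leading (NonNeg-+ (NonNeg-* b≥0 1-α≤qa²)
    (NonNeg-+ (NonNeg-* (NonNeg-κ 6) (NonNeg-* NonNeg-q (NonNeg-monomial 5 7)))
    (NonNeg-+ (NonNeg-* NonNeg-q (NonNeg-* (NonNeg-* (NonNeg-* a≥0 a≥0) b≥0) (Unital-1 (Unital-* (Unital-^ 3 Unital-a) (Unital-^ 6 Unital-b)))))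
      (NonNeg-* (NonNeg-^ 2 NonNeg-q) (NonNeg-^ 12 b≥0))))))
    where
    M : Series
    M = a ^ 5 * b ^ 7
    -- `b` contributes its constant term 1; every later coefficient is covered by the shifted `M`.
    leading : Pos (b + q * M)
    leading .coeff≥1 n = ≡.subst (+ 1 ℤ.≤_) (≡.sym (≡.trans (+ˢ-at b (q * M) n) (cong (λ x → b n ℤ.+ x) (q-* M .at n)))) (go n)
      where
      go : ∀ n → + 1 ℤ.≤ b n ℤ.+ shift M n
      go zero    = ℤ.≤-refl
      go (suc n) = ≡.subst (+ 1 ℤ.≤_) (ℤ.+-comm (M n) (b (suc n))) (ℤ.+-mono-≤ (Pos-monomial 4 7 .coeff≥1 n) (b≥0 .coeff≥0 (suc n)))

  Pos-h₂ : Pos h₂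
  Pos-h₂ = Pos-+ (Pos-κ-* 2 (Pos-monomial 8 3)) (NonNeg-* NonNeg-q (NonNeg-monomial 4 8))

  Pos-h₃ : Pos h₃
  Pos-h₃ = Pos-+ (Pos-κ-* 2 (Pos-monomial 7 4)) (NonNeg-* NonNeg-q (NonNeg-monomial 3 9))

  Pos-h₄ : Pos h₄
  Pos-h₄ = Pos-+ (Pos-κ-* 7 (Pos-monomial 6 5)) (NonNeg-* NonNeg-q (NonNeg-monomial 2 10))

  -- The quintisection of C

  ^ˢ≡^ : ∀ f n → f ^ˢ n ≡ f ^ n
  ^ˢ≡^ f zero    = ≡.refl
  ^ˢ≡^ f (suc n) = ≡.trans (cong (f ⊛_) (^ˢ≡^ f n)) (≡.sym (*ˢ≡⊛ f (f ^ n)))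

  R≡ : R ≡ α * b
  R≡ = ≡.sym (≡.trans (*ˢ≡⊛ α (inv β)) (cong₂ (λ x y → x ⊛ inv y) (*ˢ≡⊛ (qPoch 1 5) (qPoch 4 5)) (*ˢ≡⊛ (qPoch 2 5) (qPoch 3 5))))

  C≡ : C ≡ R ^ 5 * inv (subQ5 R)
  C≡ = ≡.trans (≡.sym (*ˢ≡⊛ (R ^ˢ 5) (inv (subQ5 R)))) (cong (_* inv (subQ5 R)) (^ˢ≡^ R 5))

  aα : a * α ≈ 1#
  aα = inv-inverseˡ α α₀

  bβ : b * β ≈ 1#
  bβ = inv-inverseˡ β β₀

  subQ5-inverse : ∀ {f g} → f * g ≈ 1# → subQ5 f * subQ5 g ≈ 1#
  subQ5-inverse {f} {g} p = trans (sym (subQ5-* f g)) (trans (subQ5-cong p) subQ5-one)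

  C-defining : β ^ 5 * subQ5 α * C ≈ α ^ 5 * subQ5 β
  C-defining = trans (*-congˡ (reflexive C≡)) (quotient-relation Rβ σRσβ (inv-inverseˡ (subQ5 R) (≡.trans (cong (λ f → f 0) R≡)
      (≡.trans (*ˢ-zero α b) (≡.trans (cong (ℤ._* b 0) α₀) ≡.refl)))))
    where
    Rβ : R * β ≈ α
    Rβ = trans (*-congʳ (reflexive R≡)) (trans (*-assoc α b β) (trans (*-congˡ bβ) (*-identityʳ α)))
    σRσβ : subQ5 R * subQ5 β ≈ subQ5 α
    σRσβ = trans (sym (subQ5-* R β)) (subQ5-cong Rβ)

  -- The constant term is read off in ℤ[[q]]/(q), where β and β(q⁵) are 1 and q is 0. It makes the
  -- factor of the unwanted root invertible.
  unit-constant : (β ^ 5 * (subQ5 β * denom (subQ5 β) (q * subQ5 α)) + q * (q * subQ5 α) * (α ^ 5 * numer (subQ5 β) (q * subQ5 α))) 0 ≡ + 1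
  unit-constant = RingTheory.unit-factor (series/ 1) (κ-hom/ 1) {α} {β} {subQ5 α} {subQ5 β} {q}
    (mk≈[] (λ { zero _ → β₀ ; (suc i) (ℕ.s≤s ()) })) (mk≈[] (λ { zero _ → β₀ ; (suc i) (ℕ.s≤s ()) }))
    (mk≈[] (λ { zero _ → ≡.refl ; (suc i) (ℕ.s≤s ()) })) .at< 0 ℕ.≤-refl

  component : ℕ → Series
  component 0 = 1# + κ -[1+ 24 ] * (q * (a ^ 6 * b ^ 6))
  component 1 = κ -[1+ 4 ] * h₁
  component 2 = κ (+ 5) * h₂
  component 3 = κ -[1+ 9 ] * h₃
  component _ = κ (+ 5) * h₄

  C-sections : C ≈ subQ5 (component 0) + q * subQ5 (component 1) + q ^ 2 * subQ5 (component 2)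
                   + q ^ 3 * subQ5 (component 3) + q ^ 4 * subQ5 (component 4)
  C-sections = trans
    (quintisection bβ (subQ5-inverse aα) (subQ5-inverse bβ) quadratic eleven
      (trans (sym (subQ5-eleven β α)) (trans (subQ5-cong eleven) (trans (subQ5-^ (α * β) 11) (^-congˡ 11 (subQ5-* α β)))))
      (inv-inverseˡ _ unit-constant) C-defining)
    (+-cong (+-cong (+-cong (+-cong s₀ (*-congˡ s₁)) (*-congˡ s₂)) (*-congˡ s₃)) (*-congˡ s₄))
    where
    a′ b′ : Series
    a′ = subQ5 a
    b′ = subQ5 b
    mono : ∀ i j → subQ5 (a ^ i * b ^ j) ≈ a′ ^ i * b′ ^ j
    mono i j = trans (subQ5-* _ _) (*-cong (subQ5-^ a i) (subQ5-^ b j))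
    scale : ∀ c {f g} → subQ5 f ≈ g → subQ5 (κ c * f) ≈ κ c * g
    scale c p = trans (subQ5-* _ _) (*-cong (subQ5-κ c) p)
    q-scale : ∀ {f g} → subQ5 f ≈ g → subQ5 (q * f) ≈ q ^ 5 * g
    q-scale p = trans (subQ5-* _ _) (*-cong subQ5-q p)
    sum′ : ∀ {f f′ g g′} → subQ5 f ≈ f′ → subQ5 g ≈ g′ → subQ5 (f + g) ≈ f′ + g′
    sum′ p r = trans (subQ5-+ _ _) (+-cong p r)
    difference : ∀ {f f′ g g′} → subQ5 f ≈ f′ → subQ5 g ≈ g′ → subQ5 (f - g) ≈ f′ - g′
    difference p r = sum′ p (trans (subQ5-neg _) (-‿cong r))
    s₀ : a′ ^ 11 * b′ - κ (+ 36) * (q ^ 5 * (a′ ^ 6 * b′ ^ 6)) - (q ^ 5) ^ 2 * (a′ * b′ ^ 11) ≈ subQ5 (component 0)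
    s₀ = sym (trans (subQ5-cong (sym (component₀ aα bβ eleven)))
      (difference (difference (trans (subQ5-* _ _) (*-congʳ (subQ5-^ a 11))) (scale (+ 36) (q-scale (mono 6 6))))
        (trans (subQ5-* _ _) (*-cong (trans (subQ5-^ q 2) (^-congˡ 2 subQ5-q)) (trans (subQ5-* _ _) (*-congˡ (subQ5-^ b 11)))))))
    s₁ : κ -[1+ 4 ] * (a′ ^ 10 * b′ ^ 2 - κ (+ 3) * (q ^ 5 * (a′ ^ 5 * b′ ^ 7))) ≈ subQ5 (component 1)
    s₁ = sym (trans (subQ5-cong (*-congˡ (sym (component₁ aα bβ eleven))))
      (scale -[1+ 4 ] (difference (mono 10 2) (scale (+ 3) (q-scale (mono 5 7))))))
    s₂ : κ (+ 5) * (κ (+ 3) * (a′ ^ 9 * b′ ^ 3) + q ^ 5 * (a′ ^ 4 * b′ ^ 8)) ≈ subQ5 (component 2)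
    s₂ = sym (scale (+ 5) (sum′ (scale (+ 3) (mono 9 3)) (q-scale (mono 4 8))))
    s₃ : κ -[1+ 9 ] * (κ (+ 3) * (a′ ^ 8 * b′ ^ 4) + q ^ 5 * (a′ ^ 3 * b′ ^ 9)) ≈ subQ5 (component 3)
    s₃ = sym (scale -[1+ 9 ] (sum′ (scale (+ 3) (mono 8 4)) (q-scale (mono 3 9))))
    s₄ : κ (+ 5) * (κ (+ 8) * (a′ ^ 7 * b′ ^ 5) + q ^ 5 * (a′ ^ 2 * b′ ^ 10)) ≈ subQ5 (component 4)
    s₄ = sym (scale (+ 5) (sum′ (scale (+ 8) (mono 7 5)) (q-scale (mono 2 10))))

  subQ5-off : ∀ d n f → d ℕ.< 4 → subQ5 f (suc d ℕ.+ n ℕ.* 5) ≡ + 0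
  subQ5-off 0 zero    f _ = ≡.refl
  subQ5-off 1 zero    f _ = ≡.refl
  subQ5-off 2 zero    f _ = ≡.refl
  subQ5-off 3 zero    f _ = ≡.refl
  subQ5-off 0 (suc n) f p = ≡.trans (subQ5-tail f (1 ℕ.+ n ℕ.* 5)) (subQ5-off 0 n (tl f) p)
  subQ5-off 1 (suc n) f p = ≡.trans (subQ5-tail f (2 ℕ.+ n ℕ.* 5)) (subQ5-off 1 n (tl f) p)
  subQ5-off 2 (suc n) f p = ≡.trans (subQ5-tail f (3 ℕ.+ n ℕ.* 5)) (subQ5-off 2 n (tl f) p)
  subQ5-off 3 (suc n) f p = ≡.trans (subQ5-tail f (4 ℕ.+ n ℕ.* 5)) (subQ5-off 3 n (tl f) p)
  subQ5-off (suc (suc (suc (suc d)))) n f (ℕ.s≤s (ℕ.s≤s (ℕ.s≤s (ℕ.s≤s ()))))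

  q^-subQ5-at : ∀ j f n → (q ^ j * subQ5 f) (j ℕ.+ n ℕ.* 5) ≡ f n
  q^-subQ5-at j f n = ≡.trans (q^-*-high j (subQ5 f) (n ℕ.* 5)) (subQ5-multiple f n)

  q^-subQ5-above : ∀ j d f n → d ℕ.< 4 → (q ^ j * subQ5 f) (j ℕ.+ (suc d ℕ.+ n ℕ.* 5)) ≡ + 0
  q^-subQ5-above j d f n d<4 = ≡.trans (q^-*-high j (subQ5 f) (suc d ℕ.+ n ℕ.* 5)) (subQ5-off d n f d<4)

  -- For positive n, one 5 = (d + 1) + (e + 1) is borrowed from 5n, which reduces to
  -- `q^-subQ5-above`; for n = 0 the exponent is too small.
  q^-subQ5-below : ∀ r d e f n → suc d ℕ.+ suc e ≡ 5 → (q ^ (r ℕ.+ suc d) * subQ5 f) (r ℕ.+ n ℕ.* 5) ≡ + 0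
  q^-subQ5-below r d e f zero    _ = q^-*-low (r ℕ.+ suc d) (subQ5 f) (r ℕ.+ 0)
    (ℕ.+-monoʳ-< r (ℕ.s≤s ℕ.z≤n))
  q^-subQ5-below r d e f (suc n) p = ≡.trans (cong (q ^ (r ℕ.+ suc d) * subQ5 f) (≡.trans
      (cong (λ x → r ℕ.+ (x ℕ.+ n ℕ.* 5)) (≡.sym p)) (lem r d e (n ℕ.* 5))))
    (q^-subQ5-above (r ℕ.+ suc d) e f n (e<4 d e p))
    where
    lem : ∀ r d e m → r ℕ.+ (suc d ℕ.+ suc e ℕ.+ m) ≡ (r ℕ.+ suc d) ℕ.+ (suc e ℕ.+ m)
    lem = ℕ-solve
    e<4 : ∀ d e → suc d ℕ.+ suc e ≡ 5 → e ℕ.< 4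
    e<4 d e p = ℕ.≤-trans (ℕ.m≤n+m (suc e) d) (ℕ.≤-reflexive (ℕ.suc-injective p))

  C-at : ∀ m {x₀ x₁ x₂ x₃ x₄} → (q ^ 0 * subQ5 (component 0)) m ≡ x₀ → (q ^ 1 * subQ5 (component 1)) m ≡ x₁ →
         (q ^ 2 * subQ5 (component 2)) m ≡ x₂ → (q ^ 3 * subQ5 (component 3)) m ≡ x₃ → (q ^ 4 * subQ5 (component 4)) m ≡ x₄ →
         C m ≡ x₀ ℤ.+ x₁ ℤ.+ x₂ ℤ.+ x₃ ℤ.+ x₄
  C-at m p₀ p₁ p₂ p₃ p₄ = ≡.trans (C≈ .at m) (add (add (add (add p₀ p₁) p₂) p₃) p₄)
    where
    C≈ : C ≈ q ^ 0 * subQ5 (component 0) + q ^ 1 * subQ5 (component 1) + q ^ 2 * subQ5 (component 2)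
               + q ^ 3 * subQ5 (component 3) + q ^ 4 * subQ5 (component 4)
    C≈ = trans C-sections (+-congʳ (+-congʳ (+-congʳ (+-cong (sym (*-identityˡ _)) (*-congʳ (sym (*-identityʳ q)))))))
    add : ∀ {f g x y} → f m ≡ x → g m ≡ y → (f + g) m ≡ x ℤ.+ y
    add {f} {g} p r = ≡.trans (+ˢ-at f g m) (cong₂ ℤ._+_ p r)

  C-section₀ : ∀ n → C (n ℕ.* 5) ≡ component 0 n
  C-section₀ n = ≡.trans (C-at (n ℕ.* 5)
      (q^-subQ5-at 0 (component 0) n) (q^-subQ5-below 0 0 3 (component 1) n ≡.refl)
      (q^-subQ5-below 0 1 2 (component 2) n ≡.refl) (q^-subQ5-below 0 2 1 (component 3) n ≡.refl) (q^-subQ5-below 0 3 0 (component 4) n ≡.refl))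
    (lem (component 0 n))
    where
    lem : ∀ x → x ℤ.+ + 0 ℤ.+ + 0 ℤ.+ + 0 ℤ.+ + 0 ≡ x
    lem = ℤ-solve

  C-section₁ : ∀ n → C (1 ℕ.+ n ℕ.* 5) ≡ component 1 n
  C-section₁ n = ≡.trans (C-at (1 ℕ.+ n ℕ.* 5)
      (q^-subQ5-above 0 0 (component 0) n (ℕ.s≤s ℕ.z≤n)) (q^-subQ5-at 1 (component 1) n)
      (q^-subQ5-below 1 0 3 (component 2) n ≡.refl) (q^-subQ5-below 1 1 2 (component 3) n ≡.refl) (q^-subQ5-below 1 2 1 (component 4) n ≡.refl))
    (lem (component 1 n))
    where
    lem : ∀ x → + 0 ℤ.+ x ℤ.+ + 0 ℤ.+ + 0 ℤ.+ + 0 ≡ x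
    lem = ℤ-solve

  C-section₂ : ∀ n → C (2 ℕ.+ n ℕ.* 5) ≡ component 2 n
  C-section₂ n = ≡.trans (C-at (2 ℕ.+ n ℕ.* 5)
      (q^-subQ5-above 0 1 (component 0) n (ℕ.s≤s (ℕ.s≤s ℕ.z≤n))) (q^-subQ5-above 1 0 (component 1) n (ℕ.s≤s ℕ.z≤n))
      (q^-subQ5-at 2 (component 2) n) (q^-subQ5-below 2 0 3 (component 3) n ≡.refl) (q^-subQ5-below 2 1 2 (component 4) n ≡.refl))
    (lem (component 2 n))
    where
    lem : ∀ x → + 0 ℤ.+ + 0 ℤ.+ x ℤ.+ + 0 ℤ.+ + 0 ≡ x
    lem = ℤ-solve

  C-section₃ : ∀ n → C (3 ℕ.+ n ℕ.* 5) ≡ component 3 n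
  C-section₃ n = ≡.trans (C-at (3 ℕ.+ n ℕ.* 5)
      (q^-subQ5-above 0 2 (component 0) n (ℕ.s≤s (ℕ.s≤s (ℕ.s≤s ℕ.z≤n)))) (q^-subQ5-above 1 1 (component 1) n (ℕ.s≤s (ℕ.s≤s ℕ.z≤n)))
      (q^-subQ5-above 2 0 (component 2) n (ℕ.s≤s ℕ.z≤n)) (q^-subQ5-at 3 (component 3) n) (q^-subQ5-below 3 0 3 (component 4) n ≡.refl))
    (lem (component 3 n))
    where
    lem : ∀ x → + 0 ℤ.+ + 0 ℤ.+ + 0 ℤ.+ x ℤ.+ + 0 ≡ x
    lem = ℤ-solve

  C-section₄ : ∀ n → C (4 ℕ.+ n ℕ.* 5) ≡ component 4 n
  C-section₄ n = ≡.trans (C-at (4 ℕ.+ n ℕ.* 5)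
      (q^-subQ5-above 0 3 (component 0) n ℕ.≤-refl) (q^-subQ5-above 1 2 (component 1) n (ℕ.s≤s (ℕ.s≤s (ℕ.s≤s ℕ.z≤n))))
      (q^-subQ5-above 2 1 (component 2) n (ℕ.s≤s (ℕ.s≤s ℕ.z≤n))) (q^-subQ5-above 3 0 (component 3) n (ℕ.s≤s ℕ.z≤n)) (q^-subQ5-at 4 (component 4) n))
    (lem (component 4 n))
    where
    lem : ∀ x → + 0 ℤ.+ + 0 ℤ.+ + 0 ℤ.+ + 0 ℤ.+ x ≡ x
    lem = ℤ-solve

  -- The summand 1 is felt only at exponent 0, which is the exceptional value; the factor q makes
  -- coefficient n + 1 equal to -25 times coefficient n of a⁶ b⁶.
  component₀<0 : ∀ n → component 0 (suc n) ℤ.< + 0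
  component₀<0 n = ≡.subst (ℤ._< + 0) (≡.sym (≡.trans (+ˢ-at 1# _ (suc n)) (≡.trans (ℤ.+-identityˡ _)
    (≡.trans (κ-*ˢ -[1+ 24 ] (q * M) .at (suc n)) (≡.trans (cong (-[1+ 24 ] ℤ.*_) (q-* M .at (suc n))) (≡.sym (κ-*ˢ -[1+ 24 ] M .at n)))))))
    (κ-neg-*<0 24 {M} (Pos-monomial 5 6) n)
    where
    M : Series
    M = a ^ 6 * b ^ 6

  5*n+r : ∀ r n → 5 ℕ.* n ℕ.+ r ≡ r ℕ.+ n ℕ.* 5
  5*n+r = ℕ-solve

-- The sign pattern of C

open QSeries
open import Data.Nat using (ℕ; suc; _*_; _+_)
open import Data.Integer using (ℤ; +_; _<_; _>_)
open import Data.Product using (_×_)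
open import Relation.Binary.PropositionalEquality using (_≡_)

theorem1p4 : C 0 ≡ + 1
    × ((n : ℕ) → C (5 * suc n) < + 0)
    × ((n : ℕ) → C (5 * n + 1) < + 0)
    × ((n : ℕ) → C (5 * n + 2) > + 0)
    × ((n : ℕ) → C (5 * n + 3) < + 0)
    × ((n : ℕ) → C (5 * n + 4) > + 0)
theorem1p4 = ≡.refl
  , (λ n → ≡.subst (_< + 0) (≡.sym (≡.trans (cong C (ℕ.*-comm 5 (suc n))) (C-section₀ (suc n)))) (component₀<0 n))
  , (λ n → ≡.subst (_< + 0) (≡.sym (≡.trans (cong C (5*n+r 1 n)) (C-section₁ n))) (κ-neg-*<0 4 Pos-h₁ n))
  , (λ n → ≡.subst (_> + 0) (≡.sym (≡.trans (cong C (5*n+r 2 n)) (C-section₂ n))) (Pos⇒>0 (Pos-κ-* 4 Pos-h₂) n))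
  , (λ n → ≡.subst (_< + 0) (≡.sym (≡.trans (cong C (5*n+r 3 n)) (C-section₃ n))) (κ-neg-*<0 9 Pos-h₃ n))
  , (λ n → ≡.subst (_> + 0) (≡.sym (≡.trans (cong C (5*n+r 4 n)) (C-section₄ n))) (Pos⇒>0 (Pos-κ-* 4 Pos-h₄) n))
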